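{- Let $A$ be an integral matrix with columns $A_1,\dots,A_n$ which is homogeneous, i.e. there is a nonzero vector $w$ with $w^TA_j=1$ for all $j$. Then $LP^+_i(A,b)=IP^+_i(A,b)$ for all $i\in\{1,\dots,n\}$ and all IP-feasible $b$ if and only if $P_A=\mathrm{conv}(A_1,\dots,A_n)$ is compressed.
   Context: $IP^+_i(A,b)$ is the optimal value of: maximize $x_i$ subject to $A\mathbf{x}=b$, $\mathbf{x}\ge0$, $\mathbf{x}$ integral; $LP^+_i(A,b)$ is the optimal value of the linear programming relaxation (drop integrality). $b$ is IP-feasible if $b=A\mathbf{x}$ for some nonnegative integral $\mathbf{x}$. $P_A$ is compressed with respect to the smallest lattice $\mathcal{L}$ containing $A_1,\dots,A_n$: for every ordering of the lattice points $P_A\cap\mathcal{L}$, the pulling triangulation (recursively: if the points are affinely independent, the single simplex; otherwise cone from the first point over the pulling triangulations, with induced ordering, of all facets not containing it) is unimodular, i.e. every simplex attains the minimal volume among all simplices spanned by lattice points of $P_A$. -}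

module Defs where

open import Data.Nat using (ℕ; zero; suc)
import Data.Nat as ℕ
open import Data.Integer as ℤ using (ℤ; +_)
open import Data.Rational as ℚ using (ℚ; 0ℚ; 1ℚ; _/_)
open import Data.Rational.Properties using (_≟_)
open import Data.Fin using (Fin; zero; suc; toℕ)
open import Data.Vec as Vec using (Vec; []; _∷_; lookup; zipWith; foldr; replicate; fromList; removeAt)
open import Data.List as List using (List; []; _∷_; length; filter)
open import Data.List.Relation.Unary.All using (All)
open import Data.List.Relation.Unary.Unique.Propositional using (Unique)
open import Data.List.Membership.Propositional using (_∈_)
open import Data.List.Relation.Binary.Sublist.Propositional using (_⊆_)
open import Data.Product using (Σ; ∃; ∃-syntax; _×_; _,_)
open import Relation.Binary.PropositionalEquality using (_≡_)
open import Relation.Nullary using (¬_)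
open import Function.Bundles using (_⇔_)

Pt : ℕ → Set
Pt d = Vec ℤ d

-- an integral d×n matrix, given by its n columns A₁ … Aₙ ∈ ℤ^d
Mat : ℕ → ℕ → Set
Mat d n = Vec (Pt d) n

toℚ : ℤ → ℚ
toℚ z = z / 1

toℚv : ∀ {d} → Vec ℤ d → Vec ℚ d
toℚv = Vec.map toℚ

ℕtoℚ : ℕ → ℚ
ℕtoℚ k = + k / 1

dotℚ : ∀ {d} → Vec ℚ d → Vec ℚ d → ℚ
dotℚ u v = foldr _ ℚ._+_ 0ℚ (zipWith ℚ._*_ u v)

dotℤ : ∀ {d} → Vec ℤ d → Vec ℤ d → ℤ
dotℤ u v = foldr _ ℤ._+_ (+ 0) (zipWith ℤ._*_ u v)

lincombℚ : ∀ {d n} → Vec ℚ n → Vec (Vec ℚ d) n → Vec ℚ d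
lincombℚ [] [] = replicate _ 0ℚ
lincombℚ (c ∷ cs) (v ∷ vs) = zipWith ℚ._+_ (Vec.map (c ℚ.*_) v) (lincombℚ cs vs)

mulℚ : ∀ {d n} → Mat d n → Vec ℚ n → Vec ℚ d
mulℚ A x = lincombℚ x (Vec.map toℚv A)

mulℕ : ∀ {d n} → Mat d n → Vec ℕ n → Vec ℚ d
mulℕ A x = mulℚ A (Vec.map ℕtoℚ x)

Homogeneous : ∀ {d n} → Mat d n → Set
Homogeneous {d} {n} A =
  ∃[ w ] (¬ (w ≡ replicate d 0ℚ)) × (∀ (j : Fin n) → dotℚ w (toℚv (lookup A j)) ≡ 1ℚ)

LPFeasible : ∀ {d n} → Mat d n → Pt d → Vec ℚ n → Set
LPFeasible {n = n} A b x = (∀ (j : Fin n) → 0ℚ ℚ.≤ lookup x j) × (mulℚ A x ≡ toℚv b)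

IPFeasible : ∀ {d n} → Mat d n → Pt d → Vec ℕ n → Set
IPFeasible A b x = mulℕ A x ≡ toℚv b

IPFeasibleRHS : ∀ {d n} → Mat d n → Pt d → Set
IPFeasibleRHS A b = ∃[ x ] IPFeasible A b x

IsLPOpt : ∀ {d n} → Mat d n → Pt d → Fin n → ℚ → Set
IsLPOpt A b i v =
  (∃[ x ] LPFeasible A b x × lookup x i ≡ v) ×
  (∀ x → LPFeasible A b x → lookup x i ℚ.≤ v)

IsIPOpt : ∀ {d n} → Mat d n → Pt d → Fin n → ℚ → Set
IsIPOpt A b i v =
  (∃[ x ] IPFeasible A b x × ℕtoℚ (lookup x i) ≡ v) ×
  (∀ x → IPFeasible A b x → ℕtoℚ (lookup x i) ℚ.≤ v)

LPeqIP : ∀ {d n} → Mat d n → Pt d → Fin n → Set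
LPeqIP A b i = ∃[ v ] IsLPOpt A b i v × IsIPOpt A b i v

InPA : ∀ {d n} → Mat d n → Pt d → Set
InPA {n = n} A p =
  ∃[ λs ] (∀ (j : Fin n) → 0ℚ ℚ.≤ lookup λs j)
        × (foldr _ ℚ._+_ 0ℚ λs ≡ 1ℚ)
        × (mulℚ A λs ≡ toℚv p)

InLattice : ∀ {d n} → Mat d n → Pt d → Set
InLattice A p = ∃[ c ] mulℚ A (toℚv c) ≡ toℚv p

InPAL : ∀ {d n} → Mat d n → Pt d → Set
InPAL A p = InPA A p × InLattice A p

_-ᵥ_ : ∀ {d} → Pt d → Pt d → Pt d
u -ᵥ v = zipWith ℤ._-_ u v

LinIndep : ∀ {d} → List (Pt d) → Set
LinIndep {d} vs =
  (cs : Vec ℚ (length vs)) →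
  lincombℚ cs (Vec.map toℚv (fromList vs)) ≡ replicate d 0ℚ →
  cs ≡ replicate (length vs) 0ℚ

AffIndep : ∀ {d} → List (Pt d) → Set
AffIndep [] = Data.Unit.⊤
  where import Data.Unit
AffIndep (q ∷ qs) = LinIndep (List.map (_-ᵥ q) qs)

AffDim : ∀ {d} → List (Pt d) → ℕ → Set
AffDim S k =
  (∃[ T ] T ⊆ S × AffIndep T × length T ≡ suc k) ×
  (∀ T → T ⊆ S → AffIndep T → length T ℕ.≤ suc k)

-- points of S on the hyperplane c·x = m (order of S is kept: induced ordering)
onHyperplane : ∀ {d} → Vec ℚ d → ℚ → List (Pt d) → List (Pt d)
onHyperplane c m = filter (λ q → dotℚ c (toℚv q) ≟ m)

-- PullSimplex S σ : σ (listed by its vertices) is a simplex of the pulling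
-- triangulation of the ordered point list S.
--  * if S is affinely independent, the only simplex is S itself;
--  * otherwise, with S = p ∷ S', the simplices are p ∷ τ where τ is a simplex
--    of the pulling triangulation (induced ordering) of a facet F of conv(S)
--    not containing p.  A facet is {q ∈ S : c·q = m} for a valid inequality
--    c·x ≤ m of conv(S) whose face has dimension dim conv(S) − 1.
data PullSimplex {d : ℕ} : List (Pt d) → List (Pt d) → Set where
  pull-simplex : ∀ {S} → AffIndep S → PullSimplex S S
  pull-cone : ∀ {p S τ} (c : Vec ℚ d) (m : ℚ) (k : ℕ) →
    ¬ AffIndep (p ∷ S) →
    All (λ q → dotℚ c (toℚv q) ℚ.≤ m) (p ∷ S) →
    ¬ (dotℚ c (toℚv p) ≡ m) →
    AffDim (p ∷ S) (suc k) →
    AffDim (onHyperplane c m S) k →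
    PullSimplex (onHyperplane c m S) τ →
    PullSimplex (p ∷ S) (p ∷ τ)

det : ∀ {k} → Vec (Vec ℤ k) k → ℤ
det {zero} [] = + 1
det {suc k} (r ∷ rs) = go r (Vec.allFin _) 
  where
    go : ∀ {m} → Vec ℤ (suc k) → Vec (Fin (suc k)) m → ℤ
    go r [] = + 0
    go r (j ∷ js) =
      (sgn (toℕ j) ℤ.* (lookup r j ℤ.* det (Vec.map (λ row → removeAt row j) rs)))
        ℤ.+ go r js
      where
        sgn : ℕ → ℤ
        sgn zero = + 1
        sgn (suc zero) = ℤ.- (+ 1)
        sgn (suc (suc t)) = sgn t

-- Gram determinant of the edge vectors q₁−q₀,…,q_k−q₀ of the simplex with
-- vertices q₀,…,q_k; it equals (k! · vol_k)², so for simplices with the same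
-- number of vertices it orders them by k-dimensional volume.
gram : ∀ {d} → List (Pt d) → ℤ
gram [] = + 1
gram (q ∷ qs) = det (Vec.map (λ u → Vec.map (λ v → dotℤ u v) es) es)
  where es = fromList (List.map (_-ᵥ q) qs)

MinVolume : ∀ {d n} → Mat d n → List (Pt d) → Set
MinVolume A σ =
  ∀ τ → All (InPAL A) τ → AffIndep τ → length τ ≡ length σ → gram σ ℤ.≤ gram τ

IsOrdering : ∀ {d n} → Mat d n → List (Pt d) → Set
IsOrdering A S = Unique S × (∀ p → (p ∈ S → InPAL A p) × (InPAL A p → p ∈ S))

Compressed : ∀ {d n} → Mat d n → Set
Compressed A = ∀ S → IsOrdering A S → ∀ σ → PullSimplex S σ → MinVolume A σ

LPeqIPForAll : ∀ {d n} → Mat d n → Set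
LPeqIPForAll A = ∀ i b → IPFeasibleRHS A b → LPeqIP A b i

{-# OPTIONS --safe #-}
module Submission where

open import Defs
open import Data.Nat using (ℕ)
open import Function.Bundles using (_⇔_)

open import Data.Empty using (⊥; ⊥-elim)
open import Data.Fin using (Fin; zero; suc; toℕ)
import Data.Fin.Properties as Fin
open import Data.Integer as ℤ using (ℤ; +_; -[1+_])
import Data.Integer.Properties as ℤ
open import Data.List using (List; []; _∷_; _++_; length; map; filter; cartesianProductWith; upTo)
open import Data.List.Membership.DecPropositional using () renaming (_∈?_ to ∈-dec)
open import Data.List.Membership.Propositional using (_∈_)
open import Data.List.Membership.Propositional.Properties
  using (∈-map⁺; ∈-map⁻; ∈-++⁺ˡ; ∈-++⁺ʳ; ∈-++⁻; ∈-filter⁺; ∈-filter⁻; ∈-cartesianProductWith⁺;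
    ∈-cartesianProductWith⁻; ∈-upTo⁺)
open import Data.List.Properties using (filter-reject; length-filter; length-map)
open import Data.List.Relation.Binary.Sublist.Propositional as Sublist using (_⊆_; []; _∷_; _∷ʳ_; ⊆-trans)
open import Data.List.Relation.Binary.Sublist.Propositional.Properties using (filter-⊆)
open import Data.List.Relation.Unary.All as All using (All)
open import Data.List.Relation.Unary.AllPairs using ([]; _∷_)
open import Data.List.Relation.Unary.Any using (here; there)
open import Data.List.Relation.Unary.Unique.Propositional using (Unique)
import Data.List.Relation.Unary.Unique.Propositional.Properties as Unique
open import Data.Nat as ℕ using (zero; suc)
open import Data.Nat.Coprimality using (1-coprimeTo) renaming (sym to coprime-sym)
import Data.Nat.Properties as ℕ
open import Data.Product using (∃-syntax; _×_; _,_; proj₁; proj₂) renaming (swap to swap×)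
open import Data.Rational as ℚ hiding (NonZero; ≢-nonZero)
open import Data.Rational.Properties as ℚ hiding (_≟_)
import Data.Rational.Unnormalised as ℚᵘ
import Data.Rational.Unnormalised.Properties as ℚᵘ
open import Data.Sum using (_⊎_; inj₁; inj₂; [_,_]′)
open import Data.Unit using (⊤; tt)
open import Data.Vec as Vec using (Vec; []; _∷_; lookup; removeAt; tabulate; _[_]%=_; toList; foldr)
open import Data.Vec.Properties
  using (lookup-map; lookup-zipWith; lookup-replicate; tabulate∘lookup; tabulate-cong; lookup∘tabulate;
    lookup∘updateAt; lookup∘updateAt′; ∷-injective; map-∘; map-cong; toList∘fromList; ≡-dec)
open import Function using (_∘_; id)
open import Function.Bundles using (mk⇔)
open import Relation.Binary.Definitions using (tri<; tri≈; tri>)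
open import Relation.Binary.PropositionalEquality
open import Relation.Nullary using (¬_; Dec; yes; no; ¬¬-map)
open import Relation.Nullary.Decidable using (dec⇒maybe; ¬?; _×-dec_)
open import Relation.Unary using (Decidable)
open import Tactic.RingSolver using (solve-∀)
open import Tactic.RingSolver.Core.AlmostCommutativeRing using (AlmostCommutativeRing; fromCommutativeRing)

-- Every LP = IP question lives in the cone over the columns, graded by w.
--
-- (⇒) If LP = IP, then b ∈ ℕA and b − s p ∈ cone(A) imply b − k p ∈ ℕA for some natural k ≥ s.  This makes
-- ℤA ∩ cone(A) = ℕA, so the lattice points of P_A are the columns, and it passes to faces.  For a facet F and
-- points p, q off F, apply it to b = q + (a large natural combination of F): the rational coefficient of p in q
-- modulo the span of F is attained, hence natural.  Thus q ∈ ℤp + ℤF, and inductively every simplex σ of a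
-- pulling triangulation satisfies ℤσ = ℤA.  The edges of any other lattice simplex τ are then integral
-- combinations of those of σ, so gram τ = D² · gram σ with D a nonzero integer.
--
-- (⇐) If P_A is compressed, pulling p or q first over the same simplex of a facet F gives equal volumes, so all
-- lattice points off F have the same height over F.  The largest s with b − s p ∈ cone(A) is the height of b
-- over the height of p for some facet, hence an integer when b ∈ ℤA.  Subtracting such multiples of generators
-- of the current face ends at 0 and writes b as an element of ℕA with the LP-optimal coefficient of p.

-- Volumes, dimensions and facets are affine notions, while the cone arguments are linear. On the
-- hyperplane w = 1 the two agree, so the proof works with linear spans and meets affine
-- independence only where `AffDim`, `PullSimplex` and `gram` ask for it. The property of b - k p
-- demands k ≥ s and not the best k, because this form passes to faces without any mention of
-- optima. In the converse, equal volumes determine heights for this reason: q = s p modulo the span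
-- of F, where s > 0 is the quotient of the heights, and replacing the apex p by q multiplies the
-- Gram determinant by s². Hence every column has height 0 or that of p, and the height of an
-- element of ℤA is an integral multiple of the height of p. The obstacle there is that `Compressed`
-- yields nothing until an ordering of all lattice points of P_A is given, and membership in `InPAL`
-- is not decided. An ordering is obtained only up to double negation.

ℚ-ring : AlmostCommutativeRing _ _
ℚ-ring = fromCommutativeRing +-*-commutativeRing (λ x → dec⇒maybe (0ℚ ℚ.≟ x))

-- Order on the rationals and the embedding of the integers

0≤+ : ∀ {a b} → 0ℚ ≤ a → 0ℚ ≤ b → 0ℚ ≤ a + b
0≤+ = +-mono-≤

0≤* : ∀ {a b} → 0ℚ ≤ a → 0ℚ ≤ b → 0ℚ ≤ a * b
0≤* {a} {b} p q = nonNegative⁻¹ (a * b) {{nonNeg*nonNeg⇒nonNeg a {{ℚ.nonNegative p}} b {{ℚ.nonNegative q}}}}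

0<* : ∀ {a b} → 0ℚ < a → 0ℚ < b → 0ℚ < a * b
0<* {a} {b} p q = positive⁻¹ (a * b) {{pos*pos⇒pos a {{ℚ.positive p}} b {{ℚ.positive q}}}}

0≤*-cancelˡ : ∀ {a b} → 0ℚ < a → 0ℚ ≤ a * b → 0ℚ ≤ b
0≤*-cancelˡ {a} {b} p q =
  *-cancelˡ-≤-pos a {{ℚ.positive p}} (subst (_≤ a * b) (sym (*-zeroʳ a)) q)

0<*-cancelˡ : ∀ {a b} → 0ℚ ≤ a → 0ℚ < a * b → 0ℚ < b
0<*-cancelˡ {a} {b} p q =
  *-cancelˡ-<-nonNeg a {{ℚ.nonNegative p}} (subst (_< a * b) (sym (*-zeroʳ a)) q)

≤⇒0≤- : ∀ {a b} → a ≤ b → 0ℚ ≤ b - a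
≤⇒0≤- {a} {b} p = subst (_≤ b - a) (+-inverseʳ a) (+-monoˡ-≤ (- a) p)

0≤-⇒≤ : ∀ {a b} → 0ℚ ≤ b - a → a ≤ b
0≤-⇒≤ {a} {b} p = subst₂ _≤_ (+-identityˡ a) (lem a b) (+-monoˡ-≤ a p)
  where
  lem : ∀ a b → b - a + a ≡ b
  lem = solve-∀ ℚ-ring

0≤⇒-≤0 : ∀ {a} → 0ℚ ≤ a → - a ≤ 0ℚ
0≤⇒-≤0 = neg-antimono-≤

0<⇒-<0 : ∀ {a} → 0ℚ < a → - a < 0ℚ
0<⇒-<0 = neg-antimono-<

<0⇒0<- : ∀ {a} → a < 0ℚ → 0ℚ < - a
<0⇒0<- = neg-antimono-<

<⇒≱ : ∀ {a b} → a < b → ¬ (b ≤ a)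
<⇒≱ p q = <-irrefl refl (<-≤-trans p q)

≤∧≢⇒< : ∀ {a b} → a ≤ b → ¬ (a ≡ b) → a < b
≤∧≢⇒< {a} {b} p q = ≰⇒> λ r → q (≤-antisym p r)

0<1 : 0ℚ < 1ℚ
0<1 = positive⁻¹ 1ℚ

0≤+-zeroˡ : ∀ {a b} → 0ℚ ≤ a → 0ℚ ≤ b → a + b ≡ 0ℚ → a ≡ 0ℚ
0≤+-zeroˡ {a} {b} p q e = ≤-antisym
  (0≤-⇒≤ (subst (0ℚ ≤_) (trans (lem a b) (cong (_- a) e)) q))
  p
  where
  lem : ∀ a b → b ≡ a + b - a
  lem = solve-∀ ℚ-ring

0≤+-zeroʳ : ∀ {a b} → 0ℚ ≤ a → 0ℚ ≤ b → a + b ≡ 0ℚ → b ≡ 0ℚ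
0≤+-zeroʳ {a} {b} p q e = 0≤+-zeroˡ q p (trans (+-comm b a) e)

opaque
  inv : ∀ a → ¬ (a ≡ 0ℚ) → ∃[ r ] r * a ≡ 1ℚ
  inv a a≢0 = (1/ a) {{ℚ.≢-nonZero a≢0}} , *-inverseˡ a {{ℚ.≢-nonZero a≢0}}

opaque
  inv-pos : ∀ {a} → 0ℚ < a → ∃[ r ] 0ℚ < r × r * a ≡ 1ℚ
  inv-pos {a} p = 1/a , 0<r , *-inverseˡ a {{ℚ.≢-nonZero a≢0}}
    where
    a≢0 : ¬ (a ≡ 0ℚ)
    a≢0 e = <-irrefl (sym e) p
    1/a : ℚ
    1/a = (1/ a) {{ℚ.≢-nonZero a≢0}}
    0<r : 0ℚ < 1/a
    0<r = 0<*-cancelˡ {a} (<⇒≤ p) (subst (0ℚ <_) (sym (*-inverseʳ a {{ℚ.≢-nonZero a≢0}})) 0<1)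

*-zero-cases : ∀ {a b} → a * b ≡ 0ℚ → a ≡ 0ℚ ⊎ b ≡ 0ℚ
*-zero-cases {a} {b} e with a ℚ.≟ 0ℚ
... | yes p = inj₁ p
... | no p with inv a p
... | r , ra = inj₂ (trans (sym (*-identityˡ b)) (trans (cong (_* b) (sym ra))
                 (trans (*-assoc r a b) (trans (cong (r *_) e) (*-zeroʳ r)))))

0≤square : ∀ a → 0ℚ ≤ a * a
0≤square a with 0ℚ ≤? a
... | yes p = 0≤* p p
... | no p = subst (0ℚ ≤_) (lem a) (0≤* q q)
  where
  q : 0ℚ ≤ - a
  q = <⇒≤ (<0⇒0<- (≰⇒> p))
  lem : ∀ a → (- a) * (- a) ≡ a * a
  lem = solve-∀ ℚ-ring

toℚ-mk : ∀ z → toℚ z ≡ mkℚ z 0 (coprime-sym (1-coprimeTo ℤ.∣ z ∣))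
toℚ-mk z = ↥p/↧p≡p (mkℚ z 0 (coprime-sym (1-coprimeTo ℤ.∣ z ∣)))

toℚᵘ-toℚ : ∀ z → toℚᵘ (toℚ z) ≡ ℚᵘ.mkℚᵘ z 0
toℚᵘ-toℚ z = cong toℚᵘ (toℚ-mk z)

toℚ-+ : ∀ a b → toℚ (a ℤ.+ b) ≡ toℚ a + toℚ b
toℚ-+ a b = toℚᵘ-injective (ℚᵘ.≃-trans (ℚᵘ.≃-reflexive (toℚᵘ-toℚ (a ℤ.+ b)))
  (ℚᵘ.≃-trans (ℚᵘ.*≡* (cong (ℤ._* + 1) (cong₂ ℤ._+_ (sym (ℤ.*-identityʳ a)) (sym (ℤ.*-identityʳ b)))))
  (ℚᵘ.≃-trans (ℚᵘ.≃-reflexive (cong₂ ℚᵘ._+_ (sym (toℚᵘ-toℚ a)) (sym (toℚᵘ-toℚ b))))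
    (ℚᵘ.≃-sym (toℚᵘ-homo-+ (toℚ a) (toℚ b))))))

toℚ-* : ∀ a b → toℚ (a ℤ.* b) ≡ toℚ a * toℚ b
toℚ-* a b = toℚᵘ-injective (ℚᵘ.≃-trans (ℚᵘ.≃-reflexive (toℚᵘ-toℚ (a ℤ.* b)))
  (ℚᵘ.≃-trans (ℚᵘ.*≡* refl)
  (ℚᵘ.≃-trans (ℚᵘ.≃-reflexive (cong₂ ℚᵘ._*_ (sym (toℚᵘ-toℚ a)) (sym (toℚᵘ-toℚ b))))
    (ℚᵘ.≃-sym (toℚᵘ-homo-* (toℚ a) (toℚ b))))))

toℚ-neg : ∀ a → toℚ (ℤ.- a) ≡ - toℚ a
toℚ-neg a = trans (lem (toℚ (ℤ.- a)) (toℚ a))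
  (trans (cong (_- toℚ a) (trans (sym (toℚ-+ (ℤ.- a) a)) (cong toℚ (ℤ.+-inverseˡ a))))
      (+-identityˡ (- toℚ a)))
  where
  lem : ∀ x y → x ≡ (x + y) - y
  lem = solve-∀ ℚ-ring

toℚ-- : ∀ a b → toℚ (a ℤ.- b) ≡ toℚ a - toℚ b
toℚ-- a b = trans (toℚ-+ a (ℤ.- b)) (cong (λ z → toℚ a + z) (toℚ-neg b))

toℚ-injective : ∀ {a b} → toℚ a ≡ toℚ b → a ≡ b
toℚ-injective {a} {b} e = proj₁ (mkℚ-injective (trans (sym (toℚ-mk a)) (trans e (toℚ-mk b))))

toℚ-mono-≤ : ∀ {a b} → a ℤ.≤ b → toℚ a ≤ toℚ b
toℚ-mono-≤ {a} {b} p rewrite toℚ-mk a | toℚ-mk b = *≤* (ℤ.*-monoʳ-≤-nonNeg (+ 1) p)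

toℚ-cancel-≤ : ∀ {a b} → toℚ a ≤ toℚ b → a ℤ.≤ b
toℚ-cancel-≤ {a} {b} p rewrite toℚ-mk a | toℚ-mk b = ℤ.*-cancelʳ-≤-pos a b (+ 1) (drop-*≤* p)

-- Coefficient semirings

Any NN Int Nat : ℚ → Set
Any a = ⊤
NN a = 0ℚ ≤ a
Int a = ∃[ z ] a ≡ toℚ z
Nat a = ∃[ k ] a ≡ ℕtoℚ k

-- Semiring closure only, since `NN` and `Nat` have no negatives. Where a difference is formed,
-- `comb-⊖` asks for `P (- 1ℚ)` in addition.
record Coeffs (P : ℚ → Set) : Set where
  field
    P0 : P 0ℚ
    P1 : P 1ℚ
    P+ : ∀ {a b} → P a → P b → P (a + b)
    P* : ∀ {a b} → P a → P b → P (a * b)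

open Coeffs {{...}} public

instance
  any-coeffs : Coeffs Any
  any-coeffs = record { P0 = tt ; P1 = tt ; P+ = λ _ _ → tt ; P* = λ _ _ → tt }

  nn-coeffs : Coeffs NN
  nn-coeffs = record { P0 = ≤-refl ; P1 = <⇒≤ 0<1 ; P+ = 0≤+ ; P* = 0≤* }

  int-coeffs : Coeffs Int
  int-coeffs = record
    { P0 = + 0 , refl ; P1 = + 1 , refl
    ; P+ = λ { (x , e) (y , e′) → x ℤ.+ y , trans (cong₂ _+_ e e′) (sym (toℚ-+ x y)) }
    ; P* = λ { (x , e) (y , e′) → x ℤ.* y , trans (cong₂ _*_ e e′) (sym (toℚ-* x y)) } }

  nat-coeffs : Coeffs Nat
  nat-coeffs = record
    { P0 = 0 , refl ; P1 = 1 , refl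
    ; P+ = λ { (x , e) (y , e′) → x ℕ.+ y , trans (cong₂ _+_ e e′) (sym (toℚ-+ (+ x) (+ y))) }
    ; P* = λ { (x , e) (y , e′) → x ℕ.* y , trans (cong₂ _*_ e e′)
               (trans (sym (toℚ-* (+ x) (+ y))) (cong toℚ (sym (ℤ.pos-* x y)))) } }

Int-neg : ∀ {a} → Int a → Int (- a)
Int-neg (z , e) = ℤ.- z , trans (cong -_ e) (sym (toℚ-neg z))

Nat⇒NN : ∀ {a} → Nat a → NN a
Nat⇒NN (k , refl) = toℚ-mono-≤ {+ 0} {+ k} (ℤ.+≤+ ℕ.z≤n)

Nat⇒Int : ∀ {a} → Nat a → Int a
Nat⇒Int (k , e) = + k , e

Int∧NN⇒Nat : ∀ {a} → Int a → NN a → Nat a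
Int∧NN⇒Nat (+ k , e) _ = k , e
Int∧NN⇒Nat (-[1+ k ] , refl) p with toℚ-cancel-≤ {+ 0} { -[1+ k ]} p
... | ()

Nat≡0⊎1≤ : ∀ {a} → Nat a → a ≡ 0ℚ ⊎ 1ℚ ≤ a
Nat≡0⊎1≤ (zero , e) = inj₁ e
Nat≡0⊎1≤ (suc k , refl) = inj₂ (toℚ-mono-≤ {+ 1} {+ suc k} (ℤ.+≤+ (ℕ.s≤s ℕ.z≤n)))

-- Vectors and combinations of lists of vectors

V : ℕ → Set
V d = Fin d → ℚ

infix 4 _≈_
infixl 6 _⊕_ _⊖_
infixr 7 _∙_
infix 8 _·_

_≈_ : ∀ {d} → V d → V d → Set
u ≈ v = ∀ i → u i ≡ v i

0v : ∀ {d} → V d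
0v _ = 0ℚ

_⊕_ _⊖_ : ∀ {d} → V d → V d → V d
(u ⊕ v) i = u i + v i
(u ⊖ v) i = u i - v i

_∙_ : ∀ {d} → ℚ → V d → V d
(a ∙ v) i = a * v i

_·_ : ∀ {d} → V d → V d → ℚ
_·_ {zero} u v = 0ℚ
_·_ {suc d} u v = u zero * v zero + (u ∘ suc) · (v ∘ suc)

≈-sym : ∀ {d} {u v : V d} → u ≈ v → v ≈ u
≈-sym e i = sym (e i)

≈-trans : ∀ {d} {u v x : V d} → u ≈ v → v ≈ x → u ≈ x
≈-trans e e′ i = trans (e i) (e′ i)

·-comm : ∀ {d} (u v : V d) → u · v ≡ v · u
·-comm {zero} u v = refl
·-comm {suc d} u v = cong₂ _+_ (*-comm (u zero) (v zero)) (·-comm (u ∘ suc) (v ∘ suc))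

·-linʳ : ∀ {d} (h : V d) {x} a y z → x ≈ a ∙ y ⊕ z → h · x ≡ a * h · y + h · z
·-linʳ {zero} h a y z e = sym (trans (cong (_+ 0ℚ) (*-zeroʳ a)) (+-identityʳ 0ℚ))
·-linʳ {suc d} h {x} a y z e = trans
  (cong₂ (λ s t → h zero * s + t) (e zero) (·-linʳ (h ∘ suc) a (y ∘ suc) (z ∘ suc) (e ∘ suc)))
  (lem (h zero) a (y zero) (z zero) _ _)
  where
  lem : ∀ h a y z p q → h * (a * y + z) + (a * p + q) ≡ a * (h * y + p) + (h * z + q)
  lem = solve-∀ ℚ-ring

·-linˡ : ∀ {d} (x : V d) {h} a f g → h ≈ a ∙ f ⊕ g → h · x ≡ a * f · x + g · x
·-linˡ x {h} a f g e = trans (·-comm h x) (trans (·-linʳ x a f g e)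
  (cong₂ (λ s t → a * s + t) (·-comm x f) (·-comm x g)))

·-congʳ : ∀ {d} (h : V d) {x y} → x ≈ y → h · x ≡ h · y
·-congʳ {zero} h e = refl
·-congʳ {suc d} h e = cong₂ (λ s t → h zero * s + t) (e zero) (·-congʳ (h ∘ suc) (e ∘ suc))

·-zeroʳ : ∀ {d} (h : V d) → h · 0v ≡ 0ℚ
·-zeroʳ {zero} h = refl
·-zeroʳ {suc d} h = trans (cong₂ _+_ (*-zeroʳ (h zero)) (·-zeroʳ (h ∘ suc))) (+-identityʳ 0ℚ)

·-⊕ʳ : ∀ {d} (h x y : V d) → h · (x ⊕ y) ≡ h · x + h · y
·-⊕ʳ h x y = trans (·-linʳ h 1ℚ x y λ i → cong (_+ y i) (sym (*-identityˡ (x i))))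
  (cong (_+ h · y) (*-identityˡ (h · x)))

·-∙ʳ : ∀ {d} (h : V d) a x → h · (a ∙ x) ≡ a * h · x
·-∙ʳ h a x = trans (·-linʳ h a x 0v λ i → sym (+-identityʳ (a * x i)))
  (trans (cong (λ t → a * h · x + t) (·-zeroʳ h)) (+-identityʳ (a * h · x)))

·-⊖ʳ : ∀ {d} (h x y : V d) → h · (x ⊖ y) ≡ h · x - h · y
·-⊖ʳ h x y = trans (·-linʳ h (- 1ℚ) y x λ i → lem (x i) (y i)) (sym (lem (h · x) (h · y)))
  where
  lem : ∀ x y → x - y ≡ (- 1ℚ) * y + x
  lem = solve-∀ ℚ-ring

·-lin₂ˡ : ∀ {d} a (f : V d) b g x → (a ∙ f ⊕ b ∙ g) · x ≡ a * f · x + b * g · x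
·-lin₂ˡ a f b g x = trans (·-linˡ x a f (b ∙ g) λ _ → refl) (cong (λ t → a * f · x + t)
  (trans (·-comm (b ∙ g) x) (trans (·-∙ʳ x b g) (cong (b *_) (·-comm x g)))))

0≤norm : ∀ {d} (v : V d) → 0ℚ ≤ v · v
0≤norm {zero} v = ≤-refl
0≤norm {suc d} v = 0≤+ (0≤square (v zero)) (0≤norm (v ∘ suc))

norm≡0⇒≈0 : ∀ {d} (v : V d) → v · v ≡ 0ℚ → v ≈ 0v
norm≡0⇒≈0 {suc d} v e zero = [ id , id ]′ (*-zero-cases (0≤+-zeroˡ (0≤square (v zero)) (0≤norm (v ∘ suc)) e))
norm≡0⇒≈0 {suc d} v e (suc i) = norm≡0⇒≈0 (v ∘ suc) (0≤+-zeroʳ (0≤square (v zero)) (0≤norm (v ∘ suc)) e) i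

pt : ∀ {d} → Pt d → V d
pt p i = toℚ (lookup p i)

pt-injective : ∀ {d} {p q : Pt d} → pt p ≈ pt q → p ≡ q
pt-injective {p = []} {[]} e = refl
pt-injective {p = x ∷ p} {y ∷ q} e = cong₂ _∷_ (toℚ-injective (e zero)) (pt-injective (e ∘ suc))

-- With `Any`, `NN`, `Int` and `Nat` this is the span, the cone, the lattice and the monoid
-- generated by a list. The map f lets one relation serve integral points (`pt`), vectors (`id`) and
-- signed generators (`±`); the premises with `≈` stand in for function extensionality.
data Comb {d : ℕ} {X : Set} (f : X → V d) (P : ℚ → Set) : List X → V d → Set where
  nil  : ∀ {x} → x ≈ 0v → Comb f P [] x
  cons : ∀ {v vs x} a y → P a → Comb f P vs y → x ≈ a ∙ f v ⊕ y → Comb f P (v ∷ vs) x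

Span : ∀ {d} {X : Set} → (X → V d) → List X → V d → Set
Span f = Comb f Any

module _ {d : ℕ} {X : Set} {f : X → V d} {P : ℚ → Set} where

  comb-≈ : ∀ {vs x y} → x ≈ y → Comb f P vs x → Comb f P vs y
  comb-≈ e (nil n) = nil (≈-trans (≈-sym e) n)
  comb-≈ e (cons a z p c n) = cons a z p c (≈-trans (≈-sym e) n)

  comb-weaken : ∀ {Q} → (∀ {a} → P a → Q a) → ∀ {vs x} → Comb f P vs x → Comb f Q vs x
  comb-weaken i (nil n) = nil n
  comb-weaken i (cons a z p c n) = cons a z (i p) (comb-weaken i c) n

  comb-vanish : ∀ (h : V d) {vs x} → (∀ {v} → v ∈ vs → h · f v ≡ 0ℚ) → Comb f P vs x → h · x ≡ 0ℚ
  comb-vanish h z (nil e) = trans (·-congʳ h e) (·-zeroʳ h)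
  comb-vanish h z (cons a y p c e) = trans (·-linʳ h a _ y e)
    (trans (cong₂ (λ s t → a * s + t) (z (here refl)) (comb-vanish h (z ∘ there) c))
      (trans (+-identityʳ (a * 0ℚ)) (*-zeroʳ a)))

  comb-nonneg : ∀ (h : V d) → (∀ {a} → P a → NN a) → ∀ {vs x} →
    (∀ {v} → v ∈ vs → 0ℚ ≤ h · f v) → Comb f P vs x → 0ℚ ≤ h · x
  comb-nonneg h nn z (nil e) = ≤-reflexive (sym (trans (·-congʳ h e) (·-zeroʳ h)))
  comb-nonneg h nn z (cons a y p c e) = subst (0ℚ ≤_) (sym (·-linʳ h a _ y e))
    (0≤+ (0≤* (nn p) (z (here refl))) (comb-nonneg h nn (z ∘ there) c))

  comb-[] : ∀ {x} → Comb f P [] x → x ≈ 0v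
  comb-[] (nil e) = e

  module _ {{_ : Coeffs P}} where

    comb-0 : ∀ vs → Comb f P vs 0v
    comb-0 [] = nil λ _ → refl
    comb-0 (v ∷ vs) = cons 0ℚ 0v P0 (comb-0 vs) λ i → sym (trans (+-identityʳ _) (*-zeroˡ (f v i)))

    comb-skip : ∀ {v vs x} → Comb f P vs x → Comb f P (v ∷ vs) x
    comb-skip {v} {x = x} c = cons 0ℚ x P0 c λ i → sym
        (trans (cong (_+ x i) (*-zeroˡ (f v i))) (+-identityˡ (x i)))

    comb-∈ : ∀ {v vs} → v ∈ vs → Comb f P vs (f v)
    comb-∈ {v} (here refl) = cons 1ℚ 0v P1 (comb-0 _) λ i → sym (trans (+-identityʳ _) (*-identityˡ (f v i)))
    comb-∈ (there m) = comb-skip (comb-∈ m)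

    comb-+ : ∀ {vs x y} → Comb f P vs x → Comb f P vs y → Comb f P vs (x ⊕ y)
    comb-+ (nil e) (nil e′) = nil λ i → trans (cong₂ _+_ (e i) (e′ i)) (+-identityʳ 0ℚ)
    comb-+ (cons a y p c e) (cons b z q c′ e′) = cons (a + b) (y ⊕ z) (P+ p q) (comb-+ c c′)
      λ i → trans (cong₂ _+_ (e i) (e′ i)) (lem a b _ (y i) (z i))
      where
      lem : ∀ a b v y z → (a * v + y) + (b * v + z) ≡ (a + b) * v + (y + z)
      lem = solve-∀ ℚ-ring

    comb-∙ : ∀ {vs x a} → P a → Comb f P vs x → Comb f P vs (a ∙ x)
    comb-∙ {a = a} p (nil e) = nil λ i → trans (cong (a *_) (e i)) (*-zeroʳ a)
    comb-∙ {a = a} p (cons b y q c e) = cons (a * b) (a ∙ y) (P* p q) (comb-∙ p c)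
      λ i → trans (cong (a *_) (e i)) (lem a b _ (y i))
      where
      lem : ∀ a b v y → a * (b * v + y) ≡ a * b * v + a * y
      lem = solve-∀ ℚ-ring

    comb-lin : ∀ {vs x} a y z → P a → Comb f P vs y → Comb f P vs z → x ≈ a ∙ y ⊕ z → Comb f P vs x
    comb-lin a y z p c c′ e = comb-≈ (≈-sym e) (comb-+ (comb-∙ p c) c′)

module _ {d : ℕ} {X Y : Set} {f : X → V d} {g : Y → V d} {P : ℚ → Set} {{_ : Coeffs P}} where

  comb-trans : ∀ {vs ws x} → (∀ {v} → v ∈ vs → Comb g P ws (f v)) → Comb f P vs x → Comb g P ws x
  comb-trans {ws = ws} t (nil e) = comb-≈ (≈-sym e) (comb-0 ws)
  comb-trans t (cons a y p c e) = comb-lin a _ y p (t (here refl)) (comb-trans (t ∘ there) c) e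

  -- The terms a (h · f v) are nonnegative with sum 0, so each is 0: a generator off the face h = 0
  -- can only have coefficient 0.
  comb-face : ∀ (h : V d) → (∀ {a} → P a → NN a) → ∀ {vs ws x} → (∀ {v} → v ∈ vs → 0ℚ ≤ h · f v) →
    (∀ {v} → v ∈ vs → h · f v ≡ 0ℚ → Comb g P ws (f v)) → h · x ≡ 0ℚ → Comb f P vs x → Comb g P ws x
  comb-face h nn {ws = ws} pos t z (nil e) = comb-≈ (≈-sym e) (comb-0 ws)
  comb-face h nn {v ∷ _} {ws} {x} pos t z (cons a y p c e) = go (*-zero-cases av≡0)
    where
    sum≡0 : a * h · f v + h · y ≡ 0ℚ
    sum≡0 = trans (sym (·-linʳ h a (f v) y e)) z
    av≥0 : 0ℚ ≤ a * h · f v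
    av≥0 = 0≤* (nn p) (pos (here refl))
    y≥0 : 0ℚ ≤ h · y
    y≥0 = comb-nonneg h nn (pos ∘ there) c
    av≡0 : a * h · f v ≡ 0ℚ
    av≡0 = 0≤+-zeroˡ av≥0 y≥0 sum≡0
    rest : Comb g P ws y
    rest = comb-face h nn (pos ∘ there) (t ∘ there) (0≤+-zeroʳ av≥0 y≥0 sum≡0) c
    go : a ≡ 0ℚ ⊎ h · f v ≡ 0ℚ → Comb g P ws x
    go (inj₁ a≡0) = comb-≈ (λ i → sym (trans (e i) (trans (cong (λ s → s * f v i + y i) a≡0)
      (trans (cong (_+ y i) (*-zeroˡ (f v i))) (+-identityˡ (y i)))))) rest
    go (inj₂ hv≡0) = comb-lin a (f v) y p (t (here refl) hv≡0) rest e

comb-⊆ : ∀ {d} {X : Set} {f : X → V d} {P} {{_ : Coeffs P}} {vs ws x} →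
  (∀ {v} → v ∈ vs → v ∈ ws) → Comb f P vs x → Comb f P ws x
comb-⊆ s = comb-trans (comb-∈ ∘ s)

comb-⊖ : ∀ {d} {X : Set} {f : X → V d} {P} {{_ : Coeffs P}} → P (- 1ℚ) → ∀ {vs x y} →
  Comb f P vs x → Comb f P vs y → Comb f P vs (x ⊖ y)
comb-⊖ p {x = x} {y} c c′ = comb-lin (- 1ℚ) y x p c′ c λ i → lem (x i) (y i)
  where
  lem : ∀ x y → x - y ≡ (- 1ℚ) * y + x
  lem = solve-∀ ℚ-ring

∀⊎∃ : ∀ {A : Set} {P : A → Set} → Decidable P → (xs : List A) →
  (∀ {x} → x ∈ xs → P x) ⊎ (∃[ x ] x ∈ xs × ¬ P x)
∀⊎∃ P? [] = inj₁ λ ()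
∀⊎∃ P? (x ∷ xs) with P? x | ∀⊎∃ P? xs
... | no ¬p | _ = inj₂ (x , here refl , ¬p)
... | yes p | inj₂ (y , m , ¬q) = inj₂ (y , there m , ¬q)
... | yes p | inj₁ ps = inj₁ λ { (here refl) → p ; (there m) → ps m }

-- Minkowski–Weyl by Fourier–Motzkin elimination

-- The base case of the elimination: the cone {0} is cut out by the coordinate functionals and their
-- negatives.
zero-tests : ∀ d → ∃[ H ] (∀ (x : V d) → (∀ {h} → h ∈ H → 0ℚ ≤ h · x) → x ≈ 0v)
zero-tests zero = [] , λ x _ ()
zero-tests (suc d) with zero-tests d
... | H , t = H′ , λ x nn → λ
      { zero → ≤-antisym (subst (_≤ 0ℚ) (lem (x zero)) (neg-antimono-≤ (nn₀ x nn (- 1ℚ) (there (here refl)))))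
                         (subst (0ℚ ≤_) (*-identityˡ (x zero)) (nn₀ x nn 1ℚ (here refl)))
      ; (suc i) → t (x ∘ suc)
          (λ {h} m → subst (0ℚ ≤_) (trans (cong (_+ h · (x ∘ suc)) (*-zeroˡ (x zero))) (+-identityˡ _))
                                   (nn (there (there (∈-map⁺ (ext 0ℚ) m))))) i }
  where
  ext : ℚ → V d → V (suc d)
  ext a h zero = a
  ext a h (suc i) = h i
  H′ : List (V (suc d))
  H′ = ext 1ℚ 0v ∷ ext (- 1ℚ) 0v ∷ map (ext 0ℚ) H
  lem : ∀ x → - ((- 1ℚ) * x) ≡ x
  lem = solve-∀ ℚ-ring
  nn₀ : ∀ x → (∀ {h} → h ∈ H′ → 0ℚ ≤ h · x) → ∀ a → ext a 0v ∈ H′ → 0ℚ ≤ a * x zero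
  nn₀ x nn a m = subst (0ℚ ≤_) (trans (cong (λ t → a * x zero + t)
    (trans (·-comm 0v (x ∘ suc)) (·-zeroʳ (x ∘ suc)))) (+-identityʳ _)) (nn m)

-- The least t ≥ 0 such that every k ∈ H with k · q < 0 is nonnegative at x − t q.
least-shift : ∀ {d} (q x : V d) H → ∃[ t ] 0ℚ ≤ t × (∀ {k} → k ∈ H → k · q < 0ℚ → 0ℚ ≤ k · x - t * k · q) ×
  (t ≡ 0ℚ ⊎ ∃[ k ] k ∈ H × k · q < 0ℚ × k · x ≡ t * k · q)
least-shift q x [] = 0ℚ , ≤-refl , (λ ()) , inj₁ refl
least-shift q x (k ∷ H) with least-shift q x H
... | t , 0≤t , ok , at with k · q <? 0ℚ
... | no kq≮0 = t , 0≤t , (λ { (here refl) kq<0 → ⊥-elim (kq≮0 kq<0) ; (there m) → ok m }) , at′ at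
  where
  at′ : (t ≡ 0ℚ ⊎ ∃[ k ] k ∈ H × k · q < 0ℚ × k · x ≡ t * k · q) → _
  at′ (inj₁ e) = inj₁ e
  at′ (inj₂ (k′ , m , r)) = inj₂ (k′ , there m , r)
... | yes kq<0 with 0ℚ ≤? k · x - t * k · q
... | yes p = t , 0≤t , (λ { (here refl) _ → p ; (there m) → ok m }) , at′ at
  where
  at′ : (t ≡ 0ℚ ⊎ ∃[ k ] k ∈ H × k · q < 0ℚ × k · x ≡ t * k · q) → _
  at′ (inj₁ e) = inj₁ e
  at′ (inj₂ (k′ , m , r)) = inj₂ (k′ , there m , r)
... | no ¬p = t′ , ≤-trans 0≤t (0≤-⇒≤ (<⇒≤ t<t′)) , ok′ , inj₂ (k , here refl , kq<0 , tight)
  where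
  r : ∃[ r ] r * k · q ≡ 1ℚ
  r = inv (k · q) (<⇒≢ kq<0)
  t′ : ℚ
  t′ = k · x * proj₁ r
  tight : k · x ≡ t′ * k · q
  tight = sym (trans (*-assoc (k · x) (proj₁ r) (k · q))
      (trans (cong (k · x *_) (proj₂ r)) (*-identityʳ (k · x))))
  t<t′ : 0ℚ < t′ - t
  t<t′ = 0<*-cancelˡ { - (k · q)} (<⇒≤ (<0⇒0<- kq<0))
    (subst (0ℚ <_) (trans (cong (λ s → - (s - t * k · q)) tight) (lem (k · q) t t′)) (<0⇒0<- (≰⇒> ¬p)))
    where
    lem : ∀ k t t′ → - (t′ * k - t * k) ≡ (- k) * (t′ - t)
    lem = solve-∀ ℚ-ring
  ok′ : ∀ {j} → j ∈ k ∷ H → j · q < 0ℚ → 0ℚ ≤ j · x - t′ * j · q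
  ok′ (here refl) _ = ≤-reflexive (sym (trans (cong (_- t′ * k · q) tight) (+-inverseʳ (t′ * k · q))))
  ok′ {j} (there m) jq<0 = subst (0ℚ ≤_) (lem (j · x) (j · q) t t′)
    (0≤+ (ok m jq<0) (0≤* (<⇒≤ t<t′) (<⇒≤ (<0⇒0<- jq<0))))
    where
    lem : ∀ x q t t′ → (x - t * q) + (t′ - t) * (- q) ≡ x - t′ * q
    lem = solve-∀ ℚ-ring

module _ {d : ℕ} {X : Set} (f : X → V d) where

  Valid : V d → List X → Set
  Valid h vs = ∀ {v} → v ∈ vs → 0ℚ ≤ h · f v

  opaque
    -- For a new generator q, the inequalities that are nonnegative at q are kept, and each h
    -- positive at q is combined with each k negative at q so that q cancels. Conversely, if x
    -- satisfies the new list, x minus the least sufficient multiple of q satisfies the old one.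
    minkowski-weyl : ∀ vs → ∃[ H ] (∀ {h} → h ∈ H → Valid h vs) ×
      (∀ x → (∀ {h} → h ∈ H → 0ℚ ≤ h · x) → Comb f NN vs x)
    minkowski-weyl [] with zero-tests d
    ... | H , t = H , (λ _ ()) , λ x nn → nil (t x nn)
    minkowski-weyl (v ∷ vs) with minkowski-weyl vs
    ... | H , valid , complete = H′ , valid′ , complete′
      where
      q : V d
      q = f v
      0≤q? : Decidable (λ h → 0ℚ ≤ h · q)
      0≤q? h = 0ℚ ≤? h · q
      0<q? : Decidable (λ h → 0ℚ < h · q)
      0<q? h = 0ℚ <? h · q
      q<0? : Decidable (λ h → h · q < 0ℚ)
      q<0? h = h · q <? 0ℚ
      elim : V d → V d → V d
      elim h k = (- (k · q)) ∙ h ⊕ (h · q) ∙ k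
      elim-· : ∀ h k x → elim h k · x ≡ (- (k · q)) * h · x + h · q * k · x
      elim-· h k x = ·-lin₂ˡ (- (k · q)) h (h · q) k x
      kept eliminated H′ : List (V d)
      kept = filter 0≤q? H
      eliminated = cartesianProductWith elim (filter 0<q? H) (filter q<0? H)
      H′ = kept ++ eliminated
      valid-elim : ∀ {h k} → h ∈ H → 0ℚ < h · q → k ∈ H → k · q < 0ℚ → Valid (elim h k) (v ∷ vs)
      valid-elim {h} {k} _ _ _ _ (here refl) = ≤-reflexive (sym (trans (elim-· h k q) (lem (h · q) (k · q))))
        where
        lem : ∀ h k → (- k) * h + h * k ≡ 0ℚ
        lem = solve-∀ ℚ-ring
      valid-elim {h} {k} h∈ hq k∈ kq (there m) = subst (0ℚ ≤_) (sym (elim-· h k _))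
        (0≤+ (0≤* (<⇒≤ (<0⇒0<- kq)) (valid h∈ m)) (0≤* (<⇒≤ hq) (valid k∈ m)))
      valid′ : ∀ {h} → h ∈ H′ → Valid h (v ∷ vs)
      valid′ h∈ with ∈-++⁻ kept h∈
      ... | inj₁ m = λ { (here refl) → proj₂ (∈-filter⁻ 0≤q? {xs = H} m) ; (there n) → valid
          (proj₁ (∈-filter⁻ 0≤q? m)) n }
      ... | inj₂ m with ∈-cartesianProductWith⁻ elim (filter 0<q? H) (filter q<0? H) m
      ... | h , k , h∈′ , k∈′ , refl = valid-elim (proj₁ h′) (proj₂ h′) (proj₁ k′) (proj₂ k′)
        where
        h′ : h ∈ H × 0ℚ < h · q
        h′ = ∈-filter⁻ 0<q? h∈′
        k′ : k ∈ H × k · q < 0ℚ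
        k′ = ∈-filter⁻ q<0? k∈′
      complete′ : ∀ x → (∀ {h} → h ∈ H′ → 0ℚ ≤ h · x) → Comb f NN (v ∷ vs) x
      complete′ x nn with least-shift q x H
      ... | t , 0≤t , ok , at = cons t (x ⊖ t ∙ q) 0≤t (complete (x ⊖ t ∙ q) nn′) λ i → lem (x i) (t * q i)
        where
        lem : ∀ x y → x ≡ y + (x - y)
        lem = solve-∀ ℚ-ring
        shifted : ∀ h → h · (x ⊖ t ∙ q) ≡ h · x - t * h · q
        shifted h = trans (·-⊖ʳ h x (t ∙ q)) (cong (λ s → h · x - s) (·-∙ʳ h t q))
        above : ∀ {h} → h ∈ H → 0ℚ < h · q → (t ≡ 0ℚ ⊎ ∃[ k ] k ∈ H × k · q < 0ℚ × k · x ≡ t * k · q) →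
          0ℚ ≤ h · x - t * h · q
        above {h} m hq (inj₁ t≡0) = subst (0ℚ ≤_)
          (sym (trans (cong (λ s → h · x - s * h · q) t≡0) (lem₀ (h · x) (h · q))))
          (nn (∈-++⁺ˡ (∈-filter⁺ 0≤q? m (<⇒≤ hq))))
          where
          lem₀ : ∀ x y → x - 0ℚ * y ≡ x
          lem₀ = solve-∀ ℚ-ring
        -- Since k is tight at x - t q, the combined inequality at x is -(k · q) > 0 times the
        -- wanted value of h at x - t q.
        above {h} m hq (inj₂ (k , k∈ , kq , tight)) = 0≤*-cancelˡ (<0⇒0<- kq) (subst (0ℚ ≤_)
          (trans (elim-· h k x)
              (trans (cong (λ s → (- (k · q)) * h · x + h · q * s) tight) (lem₁ (k · q) (h · x) (h · q) t)))
          (nn (∈-++⁺ʳ kept (∈-cartesianProductWith⁺ elim (∈-filter⁺ 0<q? m hq) (∈-filter⁺ q<0? k∈ kq)))))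
          where
          lem₁ : ∀ k x h t → (- k) * x + h * (t * k) ≡ (- k) * (x - t * h)
          lem₁ = solve-∀ ℚ-ring
        nn′ : ∀ {h} → h ∈ H → 0ℚ ≤ h · (x ⊖ t ∙ q)
        nn′ {h} m with <-cmp (h · q) 0ℚ
        ... | tri< hq _ _ = subst (0ℚ ≤_) (sym (shifted h)) (ok m hq)
        ... | tri> _ _ hq = subst (0ℚ ≤_) (sym (shifted h)) (above m hq at)
        ... | tri≈ _ hq _ = subst (0ℚ ≤_)
            (sym (trans (shifted h) (trans (cong (λ s → h · x - t * s) hq) (lem₀ (h · x) t))))
                (nn (∈-++⁺ˡ (∈-filter⁺ 0≤q? m (≤-reflexive (sym hq)))))
          where
          lem₀ : ∀ x y → x - y * 0ℚ ≡ x
          lem₀ = solve-∀ ℚ-ring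

module _ {d : ℕ} {X : Set} (f : X → V d) where

  ± : X ⊎ X → V d
  ± (inj₁ v) = f v
  ± (inj₂ v) = 0v ⊖ f v

  -- A span is the cone over the vectors and their negatives.
  opaque
    span-separation : ∀ vs x → Span f vs x ⊎ ∃[ h ] (∀ {v} → v ∈ vs → h · f v ≡ 0ℚ) × ¬ (h · x ≡ 0ℚ)
    span-separation vs x with minkowski-weyl ± (map inj₁ vs ++ map inj₂ vs)
    ... | H , valid , complete with ∀⊎∃ (λ h → 0ℚ ≤? h · x) H
    ... | inj₁ nn = inj₁ (comb-trans inSpan (comb-weaken (λ _ → tt) (complete x nn)))
      where
      inSpan : ∀ {v} → v ∈ map inj₁ vs ++ map inj₂ vs → Span f vs (± v)
      inSpan m with ∈-++⁻ (map inj₁ vs) m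
      ... | inj₁ m′ with ∈-map⁻ inj₁ m′
      ... | v , v∈ , refl = comb-∈ v∈
      inSpan m | inj₂ m′ with ∈-map⁻ inj₂ m′
      ... | v , v∈ , refl = comb-⊖ tt (comb-0 vs) (comb-∈ v∈)
    ... | inj₂ (h , h∈ , ¬nn) = inj₂ (h , vanish , λ e → ¬nn (≤-reflexive (sym e)))
      where
      vanish : ∀ {v} → v ∈ vs → h · f v ≡ 0ℚ
      vanish {v} v∈ = ≤-antisym
        (0≤-⇒≤ (subst (0ℚ ≤_) (trans (·-⊖ʳ h 0v (f v)) (cong (_- h · f v) (·-zeroʳ h)))
          (valid h∈ (∈-++⁺ʳ (map inj₁ vs) (∈-map⁺ inj₂ v∈)))))
        (valid h∈ (∈-++⁺ˡ (∈-map⁺ inj₁ v∈)))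

  opaque
    span? : ∀ vs x → Dec (Span f vs x)
    span? vs x with span-separation vs x
    ... | inj₁ c = yes c
    ... | inj₂ (h , vanish , hx≢0) = no λ c → hx≢0 (comb-vanish h vanish c)

  -- Independence in recursive form, each vector being outside the span of the later ones; this
  -- suits induction on lists better than the vanishing of coefficient vectors in `LinIndep`.
  Indep : List X → Set
  Indep [] = ⊤
  Indep (v ∷ vs) = ¬ Span f vs (f v) × Indep vs

  indep? : ∀ vs → Dec (Indep vs)
  indep? [] = yes tt
  indep? (v ∷ vs) = ¬? (span? vs (f v)) ×-dec indep? vs

  opaque
    basis : ∀ vs → ∃[ B ] B ⊆ vs × Indep B × (∀ {v} → v ∈ vs → Span f B (f v))
    basis [] = [] , [] , tt , λ ()
    basis (v ∷ vs) with basis vs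
    ... | B , B⊆ , ind , spans with span? B (f v)
    ... | yes c = B , v ∷ʳ B⊆ , ind , λ { (here refl) → c ; (there m) → spans m }
    ... | no ¬c = v ∷ B , refl ∷ B⊆ , (¬c , ind) ,
        λ { (here refl) → comb-∈ (here refl) ; (there m) → comb-skip (spans m) }

  -- Some vector of C has a nonzero coefficient in the expansion of t, as t is not in the span of T.
  -- The first such vector can be solved for and replaced by t.
  exchange : ∀ C T {t} → Span f (C ++ T) (f t) → ¬ Span f T (f t) →
    ∃[ C′ ] length C ≡ suc (length C′) × (∀ {v} → v ∈ C ++ T → Span f (C′ ++ t ∷ T) (f v))
  exchange [] T c ¬c = ⊥-elim (¬c c)
  exchange (c ∷ C) T {t} (cons a y _ s e) ¬s with a ℚ.≟ 0ℚ
  ... | yes refl with exchange C T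
      (comb-≈ (λ i → sym (trans (e i) (trans (cong (_+ y i) (*-zeroˡ (f c i))) (+-identityˡ (y i))))) s) ¬s
  ... | C′ , len , spans = c ∷ C′ , cong suc len ,
      λ { (here refl) → comb-∈ (here refl) ; (there m) → comb-skip (spans m) }
  exchange (c ∷ C) T {t} (cons a y _ s e) ¬s | no a≢0 = C , refl ,
      λ { (here refl) → c∈ ; (there m) → comb-∈ (weaken m) }
    where
    weaken : ∀ {v} → v ∈ C ++ T → v ∈ C ++ t ∷ T
    weaken m with ∈-++⁻ C m
    ... | inj₁ m′ = ∈-++⁺ˡ m′
    ... | inj₂ m′ = ∈-++⁺ʳ C (there m′)
    r : ∃[ r ] r * a ≡ 1ℚ
    r = inv a a≢0
    c∈ : Span f (C ++ t ∷ T) (f c)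
    c∈ = comb-≈ (λ i → trans (cong (λ s → proj₁ r * (s - y i)) (e i))
           (trans (lem (proj₁ r) a (f c i) (y i)) (trans (cong (_* f c i) (proj₂ r)) (*-identityˡ (f c i)))))
         (comb-∙ {a = proj₁ r} tt (comb-⊖ tt (comb-∈ (∈-++⁺ʳ C (here refl))) (comb-⊆ weaken s)))
      where
      lem : ∀ r a c y → r * (a * c + y - y) ≡ r * a * c
      lem = solve-∀ ℚ-ring

  steinitz : ∀ T B → Indep T → (∀ {v} → v ∈ T → Span f B (f v)) →
    ∃[ C ] length B ≡ length T ℕ.+ length C × (∀ {v} → v ∈ B → Span f (C ++ T) (f v))
  steinitz [] B _ _ = B , refl , λ m → comb-∈ (∈-++⁺ˡ m)
  steinitz (t ∷ T) B (¬t , ind) inB with steinitz T B ind (inB ∘ there)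
  ... | C , len , spans with exchange C T (comb-trans spans (inB (here refl))) ¬t
  ... | C′ , len′ , spans′ = C′ , trans len
      (trans (cong (length T ℕ.+_) len′) (ℕ.+-suc (length T) (length C′)))
      , λ m → comb-trans spans′ (spans m)

  indep-length : ∀ T B → Indep T → (∀ {v} → v ∈ T → Span f B (f v)) → length T ℕ.≤ length B
  indep-length T B ind inB with steinitz T B ind inB
  ... | C , len , _ = subst (length T ℕ.≤_) (sym len) (ℕ.m≤m+n (length T) (length C))

-- Linear and affine independence

vec-ext : ∀ {A : Set} {n} {u v : Vec A n} → (∀ i → lookup u i ≡ lookup v i) → u ≡ v
vec-ext {u = u} {v} e = trans (sym (tabulate∘lookup u)) (trans (tabulate-cong e) (tabulate∘lookup v))

lookup-toℚv : ∀ {d} (p : Pt d) → lookup (toℚv p) ≈ pt p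
lookup-toℚv p i = lookup-map i toℚ p

lookup-lincombℚ : ∀ {d n} c (cs : Vec ℚ n) p (ps : Vec (Pt d) n) →
  lookup (lincombℚ (c ∷ cs) (Vec.map toℚv (p ∷ ps))) ≈ c ∙ pt p ⊕ lookup (lincombℚ cs (Vec.map toℚv ps))
lookup-lincombℚ c cs p ps i = trans
    (lookup-zipWith _+_ i (Vec.map (c *_) (toℚv p)) (lincombℚ cs (Vec.map toℚv ps)))
  (cong (_+ lookup (lincombℚ cs (Vec.map toℚv ps)) i)
    (trans (lookup-map i (c *_) (toℚv p)) (cong (c *_) (lookup-toℚv p i))))

lincombL : ∀ {d} (vs : List (Pt d)) → Vec ℚ (length vs) → V d
lincombL vs cs = lookup (lincombℚ cs (Vec.map toℚv (Vec.fromList vs)))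

lincombL-span : ∀ {d} (vs : List (Pt d)) cs → Span pt vs (lincombL vs cs)
lincombL-span {d} [] [] = nil λ i → lookup-replicate i 0ℚ
lincombL-span (v ∷ vs) (c ∷ cs) =
  cons c _ tt (lincombL-span vs cs) (lookup-lincombℚ c cs v (Vec.fromList vs))

span-lincombL : ∀ {d} {vs : List (Pt d)} {x} → Span pt vs x → ∃[ cs ] lincombL vs cs ≈ x
span-lincombL (nil e) = [] , λ i → trans (lookup-replicate i 0ℚ) (sym (e i))
span-lincombL {vs = v ∷ vs} (cons a y _ c e) with span-lincombL c
... | cs , e′ = a ∷ cs , λ i → trans (lookup-lincombℚ a cs v (Vec.fromList vs) i)
      (trans (cong (λ t → a * pt v i + t) (e′ i)) (sym (e i)))

LinIndep⇒Indep : ∀ {d} (vs : List (Pt d)) → LinIndep vs → Indep pt vs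
LinIndep⇒Indep [] _ = tt
LinIndep⇒Indep {d} (v ∷ vs) li = ¬span , LinIndep⇒Indep vs tail
  where
  ¬span : ¬ Span pt vs (pt v)
  lem : ∀ x → (- 1ℚ) * x + x ≡ 0ℚ
  lem = solve-∀ ℚ-ring
  -1≢0 : ¬ (- 1ℚ ≡ 0ℚ)
  -1≢0 ()
  ¬span c = let cs , e = span-lincombL c in
    -1≢0 (proj₁ (∷-injective
        (li (- 1ℚ ∷ cs) (vec-ext λ i → trans (lookup-lincombℚ (- 1ℚ) cs v (Vec.fromList vs) i)
      (trans (cong (λ t → (- 1ℚ) * pt v i + t) (e i))
          (trans (lem (pt v i)) (sym (lookup-replicate i 0ℚ))))))))
  tail : LinIndep vs
  tail cs e = proj₂ (∷-injective
      (li (0ℚ ∷ cs) (vec-ext λ i → trans (lookup-lincombℚ 0ℚ cs v (Vec.fromList vs) i)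
    (trans (cong (_+ lincombL vs cs i) (*-zeroˡ (pt v i)))
        (trans (+-identityˡ _) (cong (λ u → lookup u i) e))))))

Indep⇒LinIndep : ∀ {d} (vs : List (Pt d)) → Indep pt vs → LinIndep vs
Indep⇒LinIndep [] _ [] _ = refl
Indep⇒LinIndep {d} (v ∷ vs) (¬span , ind) (c ∷ cs) e with c ℚ.≟ 0ℚ
... | yes refl = cong (0ℚ ∷_) (Indep⇒LinIndep vs ind cs (vec-ext λ i →
        trans (sym (+-identityˡ _)) (trans (cong (_+ lincombL vs cs i) (sym (*-zeroˡ (pt v i))))
          (trans (sym (lookup-lincombℚ 0ℚ cs v (Vec.fromList vs) i)) (cong (λ u → lookup u i) e)))))
... | no c≢0 = ⊥-elim (¬span (comb-≈ v≈ (comb-∙ {a = - r} tt (lincombL-span vs cs))))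
  where
  r : ℚ
  r = proj₁ (inv c c≢0)
  v≈ : (- r) ∙ lincombL vs cs ≈ pt v
  v≈ i = trans (lem r c (pt v i) (lincombL vs cs i))
    (trans (cong₂ (λ s t → s * pt v i - r * t) (proj₂ (inv c c≢0))
      (trans (sym (lookup-lincombℚ c cs v (Vec.fromList vs) i))
          (trans (cong (λ u → lookup u i) e) (lookup-replicate i 0ℚ))))
      (lem′ (pt v i) r))
    where
    lem : ∀ r c v l → (- r) * l ≡ r * c * v - r * (c * v + l)
    lem = solve-∀ ℚ-ring
    lem′ : ∀ v r → 1ℚ * v - r * 0ℚ ≡ v
    lem′ = solve-∀ ℚ-ring

pt--ᵥ : ∀ {d} (p q : Pt d) → pt (p -ᵥ q) ≈ pt p ⊖ pt q
pt--ᵥ p q i = trans (cong toℚ (lookup-zipWith ℤ._-_ i p q)) (toℚ-- (lookup p i) (lookup q i))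

module _ {d : ℕ} (w : V d) where

  Level1 : List (Pt d) → Set
  Level1 vs = ∀ {v} → v ∈ vs → w · pt v ≡ 1ℚ

  -- Translating the generators by -q subtracts q once for each unit of the coefficient sum, and on
  -- level 1 that sum is w · y.
  comb-shift : ∀ {P} q {vs y} → Level1 vs → Comb pt P vs y →
    Comb pt P (map (_-ᵥ q) vs) (y ⊖ (w · y) ∙ pt q)
  comb-shift q l (nil e) = nil λ i → trans
      (cong₂ (λ s t → s - t * pt q i) (e i) (trans (·-congʳ w e) (·-zeroʳ w))) (lem (pt q i))
    where
    lem : ∀ x → 0ℚ - 0ℚ * x ≡ 0ℚ
    lem = solve-∀ ℚ-ring
  comb-shift q {v ∷ vs} {y} l (cons a z p c e) = cons a _ p (comb-shift q (l ∘ there) c)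
    λ i → trans (cong₂ (λ s t → s - t * pt q i) (e i)
            (trans (·-linʳ w a (pt v) z e) (cong (λ t → a * t + w · z) (l (here refl)))))
          (trans (lem a (pt v i) (z i) (w · z) (pt q i))
            (cong (λ t → a * t + (z i - w · z * pt q i)) (sym (pt--ᵥ v q i))))
    where
    lem : ∀ a v z wz q → (a * v + z) - (a * 1ℚ + wz) * q ≡ a * (v - q) + (z - wz * q)
    lem = solve-∀ ℚ-ring

  span-unshift : ∀ (q : Pt d) vs {y : V d} → Span pt (map (_-ᵥ q) vs) y → ∃[ c ] Span pt vs (y ⊕ c ∙ pt q)
  span-unshift q [] (nil e) = 0ℚ , nil λ i → trans (cong₂ _+_ (e i) (*-zeroˡ (pt q i))) (+-identityʳ 0ℚ)
  span-unshift q (v ∷ vs) (cons a z _ s e) with span-unshift q vs s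
  ... | c , s′ = c + a , cons a _ tt s′ λ i → trans
      (cong (_+ (c + a) * pt q i) (trans (e i) (cong (λ t → a * t + z i) (pt--ᵥ v q i))))
          (lem a (pt v i) (z i) c (pt q i))
    where
    lem : ∀ a v z c q → a * (v - q) + z + (c + a) * q ≡ a * v + (z + c * q)
    lem = solve-∀ ℚ-ring

  -- Applying w to a linear relation among points of level 1 shows that its coefficients balance, so
  -- it is a relation among differences.
  Indep-shift : ∀ q vs → w · pt q ≡ 1ℚ → Level1 vs → Indep pt (map (_-ᵥ q) vs) → Indep pt (q ∷ vs)
  Indep-shift q [] wq l _ = (λ { (nil e) → 1≢0 (trans (sym wq) (trans (·-congʳ w e) (·-zeroʳ w))) }) , tt
  Indep-shift q (r ∷ rs) wq l (¬r , ind) with Indep-shift q rs wq (l ∘ there) ind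
  ... | ¬q , ind′ = ¬q′ , (λ c → ¬r (comb-≈ (λ i → trans (cong (λ t → pt r i - t * pt q i) (l (here refl)))
                       (trans (cong (λ t → pt r i - t) (*-identityˡ (pt q i))) (sym (pt--ᵥ r q i))))
                     (comb-shift q (l ∘ there) c))) , ind′
    where
    ¬q′ : ¬ Span pt (r ∷ rs) (pt q)
    ¬q′ (cons a y _ c e) with a ℚ.≟ 0ℚ
    ... | yes refl = ¬q (comb-≈
        (λ i → sym (trans (e i) (trans (cong (_+ y i) (*-zeroˡ (pt r i))) (+-identityˡ (y i))))) c)
    -- Here q = a r + y with w · y = 1 - a, so y - (1 - a) q = -a (r - q); dividing by -a puts r - q
    -- in the span of the differences.
    ... | no a≢0 = ¬r (comb-≈ r-q≈ (comb-∙ {a = - s} tt (comb-shift q (l ∘ there) c)))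
      where
      s : ℚ
      s = proj₁ (inv a a≢0)
      wy : w · y ≡ 1ℚ - a
      wy = trans (lem a (w · y)) (cong (_- a) (trans (cong (λ t → a * t + w · y) (sym (l (here refl))))
             (trans (sym (·-linʳ w a (pt r) y e)) wq)))
        where
        lem : ∀ a y → y ≡ (a * 1ℚ + y) - a
        lem = solve-∀ ℚ-ring
      r-q≈ : (- s) ∙ (y ⊖ (w · y) ∙ pt q) ≈ pt (r -ᵥ q)
      r-q≈ i = trans (cong (λ t → (- s) * (y i - t * pt q i)) wy)
        (trans (lem s a (pt r i) (y i) (pt q i))
        (trans (cong₂ (λ t u → t * (pt r i - pt q i) + s * (u - (a * pt r i + y i))) (proj₂ (inv a a≢0))
            (e i))
        (trans (lem′ (pt r i - pt q i) s (a * pt r i + y i)) (sym (pt--ᵥ r q i)))))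
        where
        lem : ∀ s a r y q → (- s) * (y - (1ℚ - a) * q) ≡ s * a * (r - q) + s * (q - (a * r + y))
        lem = solve-∀ ℚ-ring
        lem′ : ∀ x s z → 1ℚ * x + s * (z - z) ≡ x
        lem′ = solve-∀ ℚ-ring

  Indep-unshift : ∀ q vs → Indep pt (q ∷ vs) → Indep pt (map (_-ᵥ q) vs)
  Indep-unshift q [] _ = tt
  Indep-unshift q (r ∷ rs) (¬q , ¬r , ind) = ¬s , Indep-unshift q rs ((¬q ∘ comb-skip) , ind)
    where
    ¬s : ¬ Span pt (map (_-ᵥ q) rs) (pt (r -ᵥ q))
    ¬s s with span-unshift q rs s
    -- Now r + (c - 1) q lies in the span of rs: for c = 1 this makes r dependent, otherwise q.
    ... | c , s′ with c - 1ℚ ℚ.≟ 0ℚ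
    ... | yes e = ¬r (comb-≈
        (λ i → trans (cong (_+ c * pt q i) (pt--ᵥ r q i)) (trans (lem (pt r i) (pt q i) c)
                     (trans (cong (λ t → pt r i + t * pt q i) e)
                         (trans (cong (λ t → pt r i + t) (*-zeroˡ (pt q i))) (+-identityʳ (pt r i)))))) s′)
      where
      lem : ∀ r q c → r - q + c * q ≡ r + (c - 1ℚ) * q
      lem = solve-∀ ℚ-ring
    ... | no c≢1 = ¬q (comb-≈ q≈ (comb-∙ {a = t} tt (comb-⊖ tt (comb-skip s′) (comb-∈ (here refl)))))
      where
      t : ℚ
      t = proj₁ (inv (c - 1ℚ) c≢1)
      q≈ : t ∙ ((pt (r -ᵥ q) ⊕ c ∙ pt q) ⊖ pt r) ≈ pt q
      q≈ i = trans (cong (λ z → t * (z + c * pt q i - pt r i)) (pt--ᵥ r q i))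
          (trans (lem t (pt r i) (pt q i) c)
        (trans (cong (_* pt q i) (proj₂ (inv (c - 1ℚ) c≢1))) (*-identityˡ (pt q i))))
        where
        lem : ∀ t r q c → t * (r - q + c * q - r) ≡ t * (c - 1ℚ) * q
        lem = solve-∀ ℚ-ring

  AffIndep⇒Indep : ∀ vs → Level1 vs → AffIndep vs → Indep pt vs
  AffIndep⇒Indep [] _ _ = tt
  AffIndep⇒Indep (q ∷ qs) l a = Indep-shift q qs (l (here refl)) (l ∘ there) (LinIndep⇒Indep _ a)

  Indep⇒AffIndep : ∀ vs → Indep pt vs → AffIndep vs
  Indep⇒AffIndep [] _ = tt
  Indep⇒AffIndep (q ∷ qs) ind = Indep⇒LinIndep _ (Indep-unshift q qs ind)

-- Alternating multilinear functions of a list of vectors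

-- The premise `x ≈ a ∙ y ⊕ z` in `lin` also supplies invariance under `≈`, which an arbitrary
-- function of functions need not have.
record Alternating {d : ℕ} (f : List (V d) → ℚ) : Set where
  field
    lin : ∀ pre {x} a y z post → x ≈ a ∙ y ⊕ z →
      f (pre ++ x ∷ post) ≡ a * f (pre ++ y ∷ post) + f (pre ++ z ∷ post)
    alt : ∀ pre {x post} → x ∈ post → f (pre ++ x ∷ post) ≡ 0ℚ

  tail : ∀ v → Alternating (f ∘ (v ∷_))
  tail v = record { lin = λ pre → lin (v ∷ pre) ; alt = λ pre → alt (v ∷ pre) }

open Alternating

module _ {d : ℕ} {f : List (V d) → ℚ} (A : Alternating f) where

  alt-zero : ∀ {x} vs → x ≈ 0v → f (x ∷ vs) ≡ 0ℚ
  alt-zero {x} vs e = trans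
      (lin A [] (- 1ℚ) x x vs λ i → trans (e i)
      (sym (trans (cong₂ (λ s t → (- 1ℚ) * s + t) (e i) (e i)) refl)))
    (lem (f (x ∷ vs)))
    where
    lem : ∀ x → (- 1ℚ) * x + x ≡ 0ℚ
    lem = solve-∀ ℚ-ring

  alt-span : ∀ {P ys z} vs → (∀ {y} → y ∈ ys → y ∈ vs) → Comb id P ys z → f (z ∷ vs) ≡ 0ℚ
  alt-span vs s (nil e) = alt-zero vs e
  alt-span vs s (cons a y _ c e) = trans (lin A [] a _ y vs e)
    (trans (cong₂ (λ p q → a * p + q) (alt A [] (s (here refl))) (alt-span vs (s ∘ there) c))
      (trans (+-identityʳ (a * 0ℚ)) (*-zeroʳ a)))

  alt-scale : ∀ {x} a y z vs → x ≈ a ∙ y ⊕ z → Span id vs z → f (x ∷ vs) ≡ a * f (y ∷ vs)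
  alt-scale a y z vs e c = trans (lin A [] a y z vs e)
    (trans (cong (λ t → a * f (y ∷ vs) + t) (alt-span vs id c)) (+-identityʳ _))

  swap : ∀ x y vs → f (x ∷ y ∷ vs) ≡ - f (y ∷ x ∷ vs)
  swap x y vs = trans (lem (f (x ∷ y ∷ vs)) (f (y ∷ x ∷ vs)))
      (trans (cong (λ t → t - f (y ∷ x ∷ vs)) sum≡0) (+-identityˡ _))
    where
    lem : ∀ p q → p ≡ (p + q) - q
    lem = solve-∀ ℚ-ring
    x+y : ∀ i → (x ⊕ y) i ≡ 1ℚ * x i + y i
    x+y i = cong (_+ y i) (sym (*-identityˡ (x i)))
    expand : f ((x ⊕ y) ∷ (x ⊕ y) ∷ vs) ≡
      1ℚ * (1ℚ * f (x ∷ x ∷ vs) + f (x ∷ y ∷ vs)) + (1ℚ * f (y ∷ x ∷ vs) + f (y ∷ y ∷ vs))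
    expand = trans (lin A [] 1ℚ x y _ x+y)
      (cong₂ (λ p q → 1ℚ * p + q) (lin A (x ∷ []) 1ℚ x y vs x+y) (lin A (y ∷ []) 1ℚ x y vs x+y))
    lem′ : ∀ p q → 1ℚ * (1ℚ * 0ℚ + p) + (1ℚ * q + 0ℚ) ≡ p + q
    lem′ = solve-∀ ℚ-ring
    sum≡0 : f (x ∷ y ∷ vs) + f (y ∷ x ∷ vs) ≡ 0ℚ
    sum≡0 = trans (sym (lem′ (f (x ∷ y ∷ vs)) (f (y ∷ x ∷ vs)))) (trans
      (cong₂ (λ p q → 1ℚ * (1ℚ * p + f (x ∷ y ∷ vs)) + (1ℚ * f (y ∷ x ∷ vs) + q)) (sym (alt A [] (here refl)))
          (sym (alt A [] (here refl))))
      (trans (sym expand) (alt A [] (here refl))))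

module _ {d : ℕ} {P : ℚ → Set} {{_ : Coeffs P}} (P-neg : ∀ {a} → P a → P (- a)) where

  -- D does not depend on f, so it can be applied once in each argument of a Gram determinant; this
  -- produces the factor D².
  Proportional : List (V d) → List (V d) → Set
  Proportional us vs = ∃[ D ] P D × (∀ {f} → Alternating f → f us ≡ D * f vs)

  bring-to-front : ∀ {x : V d} vs → x ∈ vs → ∃[ vs′ ] length vs ≡ suc (length vs′) ×
    (∀ {v} → v ∈ vs → v ≡ x ⊎ v ∈ vs′) × Proportional (x ∷ vs′) vs
  bring-to-front (x ∷ vs) (here refl) = vs , refl , (λ { (here e) → inj₁ e ; (there m) → inj₂ m }) ,
    1ℚ , P1 , λ {f} _ → sym (*-identityˡ _)
  bring-to-front {x} (y ∷ vs) (there m) with bring-to-front vs m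
  ... | vs′ , len , cover , D , p , prop = y ∷ vs′ , cong suc len , cover′ , - D , P-neg p ,
        λ {f} A → trans (swap A x y vs′) (trans (cong -_ (prop (tail A y))) (neg-distribˡ-* D (f (y ∷ vs))))
    where
    cover′ : ∀ {v} → v ∈ y ∷ vs → v ≡ x ⊎ v ∈ y ∷ vs′
    cover′ (here e) = inj₂ (here e)
    cover′ (there n) with cover n
    ... | inj₁ e = inj₁ e
    ... | inj₂ n′ = inj₂ (there n′)

  split-off : ∀ {x : V d} {vs vs′ u} → (∀ {v} → v ∈ vs → v ≡ x ⊎ v ∈ vs′) → Comb id P vs u →
    ∃[ c ] ∃[ u′ ] P c × Comb id P vs′ u′ × u ≈ c ∙ x ⊕ u′
  split-off {x} {vs′ = vs′} cover (nil e) = 0ℚ , 0v , P0 , comb-0 vs′ ,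
    λ i → trans (e i) (sym (trans (+-identityʳ _) (*-zeroˡ (x i))))
  split-off {x} cover (cons {v} a y p c e) with split-off (cover ∘ there) c | cover (here refl)
  ... | b , u′ , q , c′ , e′ | inj₁ refl = a + b , u′ , P+ p q , c′ ,
        λ i → trans (e i) (trans (cong (λ t → a * v i + t) (e′ i)) (lem a b (v i) (u′ i)))
    where
    lem : ∀ a b v u → a * v + (b * v + u) ≡ (a + b) * v + u
    lem = solve-∀ ℚ-ring
  ... | b , u′ , q , c′ , e′ | inj₂ m = b , a ∙ v ⊕ u′ , q , comb-+ (comb-∙ p (comb-∈ m)) c′ ,
        λ i → trans (e i) (trans (cong (λ t → a * v i + t) (e′ i)) (lem (a * v i) (b * x i) (u′ i)))
    where
    lem : ∀ a b u → a + (b + u) ≡ b + (a + u)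
    lem = solve-∀ ℚ-ring

  -- A function that vanishes as soon as x occurs does not see multiples of x, so x can be struck
  -- from the expansion of every argument.
  reduce-mod : ∀ {x : V d} {vs vs′} → (∀ {v} → v ∈ vs → v ≡ x ⊎ v ∈ vs′) → ∀ us →
      (∀ {u} → u ∈ us → Comb id P vs u) →
    ∃[ us′ ] length us ≡ length us′ × (∀ {u} → u ∈ us′ → Comb id P vs′ u) ×
      (∀ {g} → Alternating g → (∀ pre post → g (pre ++ x ∷ post) ≡ 0ℚ) → g us ≡ g us′)
  reduce-mod cover [] _ = [] , refl , (λ ()) , λ _ _ → refl
  reduce-mod {x} {vs} {vs′} cover (u ∷ us) inVs with reduce-mod {x} {vs} {vs′} cover us
      (inVs ∘ there) | split-off cover (inVs (here refl))
  ... | us′ , len , inVs′ , same | c , u′ , _ , u′∈ , e = u′ ∷ us′ , cong suc len ,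
        (λ { (here refl) → u′∈ ; (there m) → inVs′ m }) ,
        λ {g} A kill → trans (lin A [] c x u′ us e)
          (trans (cong₂ (λ s t → c * s + t) (kill [] us) (same (tail A u′) (λ pre → kill (u′ ∷ pre))))
            (trans (cong (_+ g (u′ ∷ us′)) (*-zeroʳ c)) (+-identityˡ _)))

  -- D acts as the determinant of the coefficients, but no matrix is formed: the first vector is
  -- expanded over vs, each vector that occurs is brought to the front, and the remaining ones are
  -- reduced modulo it. Only ring operations are used, so D stays in P.
  proportional : ∀ us vs → length us ≡ length vs → (∀ {u} → u ∈ us → Comb id P vs u) → Proportional us vs
  proportional us vs len = go (length vs) us vs len refl
    where
    go : ∀ n us vs → length us ≡ n → length vs ≡ n → (∀ {u} → u ∈ us → Comb id P vs u) → Proportional us vs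
    go zero [] [] _ _ _ = 1ℚ , P1 , λ _ → sym (*-identityˡ _)
    go (suc n) (u ∷ us) vs len len′ inVs = combine id (inVs (here refl))
      where
      member : ∀ {x} → x ∈ vs → Proportional (x ∷ us) vs
      member {x} m with bring-to-front vs m
      ... | vs′ , l , cover , D , p , prop with reduce-mod {x} {vs} {vs′} cover us (inVs ∘ there)
      ... | us′ , l′ , inVs′ , same with go n us′ vs′ (trans (sym l′) (ℕ.suc-injective len))
          (ℕ.suc-injective (trans (sym l) len′)) inVs′
      ... | E , q , prop′ = E * D , P* q p , λ {f} A →
              trans (same (tail A x) (λ pre post → alt A [] (∈-++⁺ʳ pre (here refl))))
              (trans (prop′ (tail A x)) (trans (cong (E *_) (prop A)) (sym (*-assoc E D (f vs)))))
      combine : ∀ {ys z} → (∀ {y} → y ∈ ys → y ∈ vs) → Comb id P ys z → Proportional (z ∷ us) vs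
      combine s (nil e) = 0ℚ , P0 , λ {f} A → trans (alt-zero A us e) (sym (*-zeroˡ (f vs)))
      combine s (cons a y p c e) with member (s (here refl)) | combine (s ∘ there) c
      ... | D , q , prop | E , r , prop′ = a * D + E , P+ (P* p q) r , λ {f} A → trans (lin A [] a _ y us e)
              (trans (cong₂ (λ s t → a * s + t) (prop A) (prop′ A)) (lem a D E (f vs)))
        where
        lem : ∀ a d e f → a * (d * f) + e * f ≡ (a * d + e) * f
        lem = solve-∀ ℚ-ring

-- Contraction of ψ by u.  Iterating it is Laplace expansion along the first row, and written this way the
-- expansion needs neither indices nor signs.
ι : ∀ {d} → V d → (List (V d) → ℚ) → List (V d) → ℚ
ι u ψ [] = 0ℚ
ι u ψ (v ∷ vs) = u · v * ψ vs - ι u (ψ ∘ (v ∷_)) vs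

module _ {d : ℕ} where

  ι-lin : ∀ (u : V d) {ψ} a φ χ → (∀ vs → ψ vs ≡ a * φ vs + χ vs) → ∀ vs → ι u ψ vs ≡ a * ι u φ vs + ι u χ vs
  ι-lin u a φ χ e [] = sym (trans (+-identityʳ _) (*-zeroʳ a))
  ι-lin u a φ χ e (v ∷ vs) = trans
    (cong₂ (λ s t → u · v * s - t) (e vs) (ι-lin u a (φ ∘ (v ∷_)) (χ ∘ (v ∷_)) (e ∘ (v ∷_)) vs))
    (lem (u · v) a (φ vs) (χ vs) _ _)
    where
    lem : ∀ u a p q r s → u * (a * p + q) - (a * r + s) ≡ a * (u * p - r) + (u * q - s)
    lem = solve-∀ ℚ-ring

  ι-linᵘ : ∀ {u : V d} a y z ψ → u ≈ a ∙ y ⊕ z → ∀ vs → ι u ψ vs ≡ a * ι y ψ vs + ι z ψ vs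
  ι-linᵘ a y z ψ e [] = sym (trans (+-identityʳ _) (*-zeroʳ a))
  ι-linᵘ a y z ψ e (v ∷ vs) = trans
    (cong₂ (λ s t → s * ψ vs - t) (·-linˡ v a y z e) (ι-linᵘ a y z (ψ ∘ (v ∷_)) e vs))
    (lem (y · v) (z · v) a (ψ vs) _ _)
    where
    lem : ∀ y z a p r s → (a * y + z) * p - (a * r + s) ≡ a * (y * p - r) + (z * p - s)
    lem = solve-∀ ℚ-ring

  ι-zero : ∀ (u : V d) {ψ} → (∀ vs → ψ vs ≡ 0ℚ) → ∀ vs → ι u ψ vs ≡ 0ℚ
  ι-zero u e [] = refl
  ι-zero u e (v ∷ vs) = trans (cong₂ (λ s t → u · v * s - t) (e vs) (ι-zero u (e ∘ (v ∷_)) vs)) (lem (u · v))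
    where
    lem : ∀ x → x * 0ℚ - 0ℚ ≡ 0ℚ
    lem = solve-∀ ℚ-ring

  ι-neg : ∀ (u : V d) {ψ φ} → (∀ vs → ψ vs ≡ - φ vs) → ∀ vs → ι u ψ vs ≡ - ι u φ vs
  ι-neg u {ψ} {φ} e vs = trans (ι-lin u (- 1ℚ) φ (λ _ → 0ℚ) (λ vs → trans (e vs) (lem (φ vs))) vs)
    (trans (cong (λ t → (- 1ℚ) * ι u φ vs + t) (ι-zero u (λ _ → refl) vs)) (sym (lem (ι u φ vs))))
    where
    lem : ∀ x → - x ≡ (- 1ℚ) * x + 0ℚ
    lem = solve-∀ ℚ-ring

  -- This holds for arbitrary ψ and is the source of the alternation of `Det` in its rows;
  -- alternation in the columns comes from `ι-alternating`.
  ι-anticomm : ∀ (u t : V d) ψ vs → ι u (ι t ψ) vs ≡ - ι t (ι u ψ) vs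
  ι-anticomm u t ψ [] = refl
  ι-anticomm u t ψ (v ∷ vs) = trans (cong (λ s → u · v * ι t ψ vs - s) (expand u t))
    (trans (cong (λ s → u · v * ι t ψ vs - (t · v * ι u ψ vs - s)) (ι-anticomm u t (ψ ∘ (v ∷_)) vs))
      (trans (lem (u · v) (ι t ψ vs) (t · v) (ι u ψ vs) _)
        (cong (λ s → - (t · v * ι u ψ vs - s)) (sym (expand t u)))))
    where
    expand : ∀ u t → ι u (ι t ψ ∘ (v ∷_)) vs ≡ t · v * ι u ψ vs - ι u (ι t (ψ ∘ (v ∷_))) vs
    expand u t = trans (ι-lin u (t · v) ψ (λ ws → - ι t (ψ ∘ (v ∷_)) ws) (λ _ → refl) vs)
      (cong (λ s → t · v * ι u ψ vs + s) (ι-neg u (λ _ → refl) vs))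
    lem : ∀ a b c d e → a * b - (c * d - (- e)) ≡ - (c * d - (a * b - e))
    lem = solve-∀ ℚ-ring

  ι-square : ∀ (u : V d) ψ vs → ι u (ι u ψ) vs ≡ 0ℚ
  ι-square u ψ vs with *-zero-cases {1ℚ + 1ℚ}
      (trans (lem x) (trans (cong (λ s → x + s) (ι-anticomm u u ψ vs)) (+-inverseʳ x)))
    where
    x : ℚ
    x = ι u (ι u ψ) vs
    lem : ∀ x → (1ℚ + 1ℚ) * x ≡ x + x
    lem = solve-∀ ℚ-ring
  ... | inj₂ e = e

  ι-alternating : ∀ (u : V d) {ψ} → Alternating ψ → Alternating (ι u ψ)
  ι-alternating u A = record { lin = λ pre → ι-multilin pre A ; alt = λ pre → ι-alt pre A }
    where
    ι-multilin : ∀ {ψ} pre → Alternating ψ → ∀ {x} a y z post → x ≈ a ∙ y ⊕ z →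
      ι u ψ (pre ++ x ∷ post) ≡ a * ι u ψ (pre ++ y ∷ post) + ι u ψ (pre ++ z ∷ post)
    ι-multilin {ψ} [] A {x} a y z post e = trans
      (cong₂ (λ s t → s * ψ post - t) (·-linʳ u a y z e)
          (ι-lin u a (ψ ∘ (y ∷_)) (ψ ∘ (z ∷_)) (λ vs → lin A [] a y z vs e) post))
      (lem (u · y) (u · z) a (ψ post) _ _)
      where
      lem : ∀ y z a p r s → (a * y + z) * p - (a * r + s) ≡ a * (y * p - r) + (z * p - s)
      lem = solve-∀ ℚ-ring
    ι-multilin {ψ} (p ∷ pre) A a y z post e = trans
      (cong₂ (λ s t → u · p * s - t) (lin A pre a y z post e) (ι-multilin pre (tail A p) a y z post e))
      (lem (u · p) a _ _ _ _)
      where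
      lem : ∀ u a p q r s → u * (a * p + q) - (a * r + s) ≡ a * (u * p - r) + (u * q - s)
      lem = solve-∀ ℚ-ring
    ι-alt : ∀ {ψ} pre → Alternating ψ → ∀ {x post} → x ∈ post → ι u ψ (pre ++ x ∷ post) ≡ 0ℚ
    ι-alt {ψ} [] A {x} {_ ∷ post} (here refl) = trans
      (cong (λ s → u · x * ψ (x ∷ post) - (u · x * ψ (x ∷ post) - s))
          (ι-zero u (λ vs → alt A [] (here refl)) post))
      (lem (u · x * ψ (x ∷ post)))
      where
      lem : ∀ p → p - (p - 0ℚ) ≡ 0ℚ
      lem = solve-∀ ℚ-ring
    -- Swapping x past y leaves the contraction of `ψ ∘ (y ∷_)` at `x ∷ post`, where x is one place
    -- closer to its repetition.
    ι-alt {ψ} [] A {x} {y ∷ post} (there m) = trans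
      (cong₂ (λ s t → u · x * ψ (y ∷ post) - (u · y * s - t)) (alt A [] m)
          (ι-neg u (λ vs → swap A x y vs) post))
      (trans (lem (u · x * ψ (y ∷ post)) (u · y) _) (ι-alt [] (tail A y) m))
      where
      lem : ∀ p q r → p - (q * 0ℚ - (- r)) ≡ p - r
      lem = solve-∀ ℚ-ring
    ι-alt {ψ} (p ∷ pre) A m = trans (cong₂ (λ s t → u · p * s - t) (alt A pre m) (ι-alt pre (tail A p) m))
        (lem (u · p))
      where
      lem : ∀ x → x * 0ℚ - 0ℚ ≡ 0ℚ
      lem = solve-∀ ℚ-ring

  -- The determinant of the matrix of the products u · v, with value 0 if the matrix is not square.
  Det : List (V d) → List (V d) → ℚ
  Det [] [] = 1ℚ
  Det [] (_ ∷ _) = 0ℚ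
  Det (u ∷ us) = ι u (Det us)

  Det-alternatingʳ : ∀ us → Alternating (Det us)
  Det-alternatingʳ [] = record { lin = λ pre {x} a y z post _ → trans (Det[] pre x post)
                                   (sym (trans (cong₂ (λ s t → a * s + t) (Det[] pre y post)
                                       (Det[] pre z post)) (trans (+-identityʳ _) (*-zeroʳ a))))
                               ; alt = λ pre {x} {post} _ → Det[] pre x post }
    where
    Det[] : ∀ pre x post → Det [] (pre ++ x ∷ post) ≡ 0ℚ
    Det[] [] x post = refl
    Det[] (_ ∷ _) x post = refl
  Det-alternatingʳ (u ∷ us) = ι-alternating u (Det-alternatingʳ us)

  Det-alternatingˡ : ∀ vs → Alternating (λ us → Det us vs)
  Det-alternatingˡ vs = record { lin = λ pre a y z post e → multilin pre a y z post e vs ; alt = λ pre m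
      → vanish pre m vs }
    where
    multilin : ∀ pre {x} a y z post → x ≈ a ∙ y ⊕ z → ∀ vs →
      Det (pre ++ x ∷ post) vs ≡ a * Det (pre ++ y ∷ post) vs + Det (pre ++ z ∷ post) vs
    multilin [] a y z post e = ι-linᵘ a y z (Det post) e
    multilin (p ∷ pre) a y z post e = ι-lin p a _ _ (multilin pre a y z post e)
    vanish₀ : ∀ {x post} → x ∈ post → ∀ vs → ι x (Det post) vs ≡ 0ℚ
    vanish₀ {x} {_ ∷ post} (here refl) vs = ι-square x (Det post) vs
    vanish₀ {x} {t ∷ post} (there m) vs = trans (ι-anticomm x t (Det post) vs)
      (cong -_ (ι-zero t (vanish₀ m) vs))
    vanish : ∀ pre {x post} → x ∈ post → ∀ vs → Det (pre ++ x ∷ post) vs ≡ 0ℚ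
    vanish [] m = vanish₀ m
    vanish (p ∷ pre) m = ι-zero p (vanish pre m)

  Gram : List (V d) → ℚ
  Gram vs = Det vs vs

  Gram-proportional : ∀ {us vs D} → (∀ {f} → Alternating f → f us ≡ D * f vs) → Gram us ≡ D * D * Gram vs
  Gram-proportional {us} {vs} {D} prop = trans (prop (Det-alternatingʳ us))
    (trans (cong (D *_) (prop (Det-alternatingˡ vs))) (sym (*-assoc D D (Gram vs))))

  Gram-scale : ∀ {x : V d} a y z vs → x ≈ a ∙ y ⊕ z → Span id vs z → Gram (x ∷ vs) ≡ a * a * Gram (y ∷ vs)
  Gram-scale {x} a y z vs e c = Gram-proportional {x ∷ vs} {y ∷ vs} {a} λ A → alt-scale A a y z vs e c

  -- One Gram-Schmidt step per vector. The list may be dependent, so the part y* of the new vector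
  -- orthogonal to the old ones can vanish; it is then skipped instead of divided by.
  orthogonal-part : ∀ vs (x : V d) → ∃[ z ] Span id vs z × (∀ {v} → v ∈ vs → (x ⊖ z) · v ≡ 0ℚ)
  orthogonal-part [] x = 0v , nil (λ _ → refl) , λ ()
  orthogonal-part (y ∷ vs) x with orthogonal-part vs y | orthogonal-part vs x
  ... | y₁ , cy , oy | z , cz , oz = go (y* · y* ℚ.≟ 0ℚ)
    where
    y* x* : V d
    y* = y ⊖ y₁
    x* = x ⊖ z
    x*y₁ : x* · y₁ ≡ 0ℚ
    x*y₁ = comb-vanish x* oz cy
    y*y₁ : y* · y₁ ≡ 0ℚ
    y*y₁ = comb-vanish y* oy cy
    ·y : ∀ h → h · y₁ ≡ 0ℚ → h · y ≡ h · y*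
    ·y h e = sym (trans (·-⊖ʳ h y y₁) (trans (cong (λ t → h · y - t) e) (+-identityʳ _)))
    go : Dec (y* · y* ≡ 0ℚ) → ∃[ z ] Span id (y ∷ vs) z × (∀ {v} → v ∈ y ∷ vs → (x ⊖ z) · v ≡ 0ℚ)
    go (yes e) = z , comb-skip cz , λ
      { (here refl) → trans (·y x* x*y₁) (trans (·-congʳ x* (norm≡0⇒≈0 y* e)) (·-zeroʳ x*)) ; (there m)
          → oz m }
    go (no ne) = z ⊕ c ∙ y* , comb-+ (comb-skip cz)
        (comb-∙ {a = c} tt (comb-⊖ tt (comb-∈ (here refl)) (comb-skip cy))) , λ
      { (here refl) → trans (split y) (trans (cong₂ (λ s t → s - c * t) (·y x* x*y₁) (·y y* y*y₁))
          (trans (cong (λ s → x* · y* - s)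
              (trans (*-assoc (x* · y*) (proj₁ r) (y* · y*))
              (trans (cong (x* · y* *_) (proj₂ r)) (*-identityʳ (x* · y*))))) (+-inverseʳ (x* · y*))))
      ; (there {v} m) → trans (split _) (trans (cong₂ (λ s t → s - c * t) (oz m) (oy m)) (lem c)) }
      where
      lem : ∀ c → 0ℚ - c * 0ℚ ≡ 0ℚ
      lem = solve-∀ ℚ-ring
      r : ∃[ r ] r * y* · y* ≡ 1ℚ
      r = inv (y* · y*) ne
      c : ℚ
      c = x* · y* * proj₁ r
      split : ∀ v → (x ⊖ (z ⊕ c ∙ y*)) · v ≡ x* · v - c * y* · v
      split v = trans (·-linˡ v (- c) y* x* λ i → lem′ (x i) (z i) c (y* i)) (lem″ c (y* · v) (x* · v))
        where
        lem′ : ∀ x z c y → x - (z + c * y) ≡ (- c) * y + (x - z)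
        lem′ = solve-∀ ℚ-ring
        lem″ : ∀ c p q → (- c) * p + q ≡ q - c * p
        lem″ = solve-∀ ℚ-ring

  ι-orthogonal : ∀ (u : V d) ψ vs → (∀ {v} → v ∈ vs → u · v ≡ 0ℚ) → ι u ψ vs ≡ 0ℚ
  ι-orthogonal u ψ [] _ = refl
  ι-orthogonal u ψ (v ∷ vs) o = trans
      (cong₂ (λ s t → s * ψ vs - t) (o (here refl)) (ι-orthogonal u (ψ ∘ (v ∷_)) vs (o ∘ there))) (lem (ψ vs))
    where
    lem : ∀ p → 0ℚ * p - 0ℚ ≡ 0ℚ
    lem = solve-∀ ℚ-ring

  -- Replacing v by its part v* orthogonal to vs does not change the determinant, and then only the
  -- first term of the expansion survives: v* · v* times the smaller Gram determinant.
  Gram-positive : ∀ vs → Indep id vs → 0ℚ < Gram vs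
  Gram-positive [] _ = 0<1
  Gram-positive (v ∷ vs) (¬v , ind) with orthogonal-part vs v
  ... | z , c , o = subst (0ℚ <_) (sym Gram≡) (0<* (≤∧≢⇒< (0≤norm v*) v*≢0) (Gram-positive vs ind))
    where
    v* : V d
    v* = v ⊖ z
    v*≢0 : ¬ (0ℚ ≡ v* · v*)
    v*≢0 e = ¬v (comb-≈ (λ i → trans (lem (v i) (z i))
        (trans (cong (λ t → v i - t) (norm≡0⇒≈0 v* (sym e) i)) (+-identityʳ (v i)))) c)
      where
      lem : ∀ v z → z ≡ v - (v - z)
      lem = solve-∀ ℚ-ring
    Gram≡ : Gram (v ∷ vs) ≡ v* · v* * Gram vs
    Gram≡ = trans (Gram-scale 1ℚ v* z vs (λ i → lem (v i) (z i)) c)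
      (trans (cong (λ t → 1ℚ * 1ℚ * (v* · v* * Gram vs - t)) (ι-orthogonal v* _ vs o))
          (lem′ (v* · v* * Gram vs)))
      where
      lem : ∀ v z → v ≡ 1ℚ * (v - z) + z
      lem = solve-∀ ℚ-ring
      lem′ : ∀ p → 1ℚ * 1ℚ * (p - 0ℚ) ≡ p
      lem′ = solve-∀ ℚ-ring

  Gram-minimal : ∀ us vs → length us ≡ length vs → Indep id us → (∀ {u} → u ∈ us → Comb id Int vs u)
      → Gram vs ≤ Gram us
  Gram-minimal us vs len ind inVs = go (proportional Int-neg us vs len inVs)
    where
    go : Proportional Int-neg us vs → Gram vs ≤ Gram us
    go (D , D∈ℤ , prop) = 0≤-⇒≤ (subst (0ℚ ≤_) (trans (lem (D * D) (Gram vs)) (cong (_- Gram vs) (sym eq)))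
      (0≤* (≤⇒0≤- 1≤DD) (<⇒≤ (0<*-cancelˡ (0≤square D) 0<DDG))))
      where
      eq : Gram us ≡ D * D * Gram vs
      eq = Gram-proportional {us} {vs} {D} prop
      lem : ∀ d g → (d - 1ℚ) * g ≡ d * g - g
      lem = solve-∀ ℚ-ring
      -- This one inequality gives both D ≠ 0, hence D² ≥ 1 for the integer D, and the positivity of
      -- `Gram vs`.
      0<DDG : 0ℚ < D * D * Gram vs
      0<DDG = subst (0ℚ <_) eq (Gram-positive us ind)
      1≤DD : 1ℚ ≤ D * D
      1≤DD with Nat≡0⊎1≤ (Int∧NN⇒Nat (P* D∈ℤ D∈ℤ) (0≤square D))
      ... | inj₂ p = p
      ... | inj₁ DD≡0 = ⊥-elim (<-irrefl (sym (trans (cong (_* Gram vs) DD≡0) (*-zeroˡ (Gram vs)))) 0<DDG)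

-- The integral determinant as an iterated contraction

-- The Laplace sum and its sign are local to `det` and cannot be named from outside.  The bodies written `_`
-- are solved by unification with them, in the equation that follows each: there the with-abstraction turns
-- the arguments on which the local function depends into distinct variables.

mutual
  laplace₀ : ∀ {k} (r : Vec ℤ (suc k)) (rs : Vec (Vec ℤ (suc k)) k) (js : Vec (Fin (suc k)) k) → ℤ
  laplace₀ r rs js = _

  det≡laplace₀ : ∀ {k} (r : Vec ℤ (suc k)) (rs : Vec (Vec ℤ (suc k)) k) → det (r ∷ rs) ≡
    (+ 1) ℤ.* (lookup r zero ℤ.* det (Vec.map (λ row → removeAt row zero) rs)) ℤ.+ laplace₀ r rs
        (tabulate suc)
  det≡laplace₀ {k} r rs with tabulate {n = k} (λ x → Fin.suc x)
  ... | js = refl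

mutual
  laplace : ∀ {k} (r : Vec ℤ (suc k)) (rs : Vec (Vec ℤ (suc k)) k) {m} (j : Fin (suc k))
      (js : Vec (Fin (suc k)) m) → ℤ
  laplace r rs j js = _

  laplace₀≡laplace : ∀ {k} (r : Vec ℤ (suc (suc k))) (rs : Vec (Vec ℤ (suc (suc k))) (suc k))
    (j : Fin (suc (suc k))) (js : Vec (Fin (suc (suc k))) k) → laplace₀ r rs (j ∷ js) ≡ laplace r rs j js
  laplace₀≡laplace {k} r rs j js with suc k
  ... | K = refl

mutual
  last : ∀ {k} (r : Vec ℤ (suc k)) (rs : Vec (Vec ℤ (suc k)) k) (j : Fin (suc k)) → ℕ → ℤ
  last r rs j t = _

  laplace-last : ∀ {k} (r : Vec ℤ (suc k)) (rs : Vec (Vec ℤ (suc k)) k) (j : Fin (suc k)) →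
    laplace r rs j [] ≡ last r rs j (toℕ j)
  laplace-last r rs j with toℕ j
  ... | t = refl

mutual
  step : ∀ {k} (r : Vec ℤ (suc k)) (rs : Vec (Vec ℤ (suc k)) k) {m} (j j′ : Fin (suc k))
      (js : Vec (Fin (suc k)) m) → ℤ → ℕ → ℤ
  step r rs j j′ js z t = _

  laplace-step : ∀ {k} (r : Vec ℤ (suc k)) (rs : Vec (Vec ℤ (suc k)) k) {m} (j j′ : Fin (suc k))
      (js : Vec (Fin (suc k)) m) →
    laplace r rs j (j′ ∷ js) ≡ step r rs j j′ js (laplace r rs j′ js) (toℕ j)
  laplace-step r rs j j′ js with laplace r rs j′ js | toℕ j
  ... | z | t = refl

sign : ℕ → ℚ
sign zero = 1ℚ
sign (suc t) = - sign t

minor : ∀ {k} → Vec ℤ (suc k) → Vec (Vec ℤ (suc k)) k → Fin (suc k) → ℤ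
minor r rs j = lookup r j ℤ.* det (Vec.map (λ row → removeAt row j) rs)

toℚ-signed : ∀ a b c → toℚ (a ℤ.* b ℤ.+ c) ≡ toℚ a * toℚ b + toℚ c
toℚ-signed a b c = trans (toℚ-+ (a ℤ.* b) c) (cong (_+ toℚ c) (toℚ-* a b))

neg-neg : ∀ a → - (- a) ≡ a
neg-neg = solve-∀ ℚ-ring

toℚ-last : ∀ {k} (r : Vec ℤ (suc k)) rs j t → toℚ (last r rs j t) ≡ sign t * toℚ (minor r rs j) + 0ℚ
toℚ-last r rs j zero = toℚ-signed (+ 1) (minor r rs j) (+ 0)
toℚ-last r rs j (suc zero) = toℚ-signed -[1+ 0 ] (minor r rs j) (+ 0)
toℚ-last r rs j (suc (suc t)) = trans (toℚ-last r rs j t)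
  (cong (λ s → s * toℚ (minor r rs j) + 0ℚ) (sym (neg-neg (sign t))))

toℚ-step : ∀ {k} (r : Vec ℤ (suc k)) rs {m} j j′ (js : Vec _ m) z t →
  toℚ (step r rs j j′ js z t) ≡ sign t * toℚ (minor r rs j) + toℚ z
toℚ-step r rs j j′ js z zero = toℚ-signed (+ 1) (minor r rs j) z
toℚ-step r rs j j′ js z (suc zero) = toℚ-signed -[1+ 0 ] (minor r rs j) z
toℚ-step r rs j j′ js z (suc (suc t)) = trans (toℚ-step r rs j j′ js z t)
  (cong (λ s → s * toℚ (minor r rs j) + toℚ z) (sym (neg-neg (sign t))))

sumF : ∀ n → (Fin n → ℚ) → ℚ
sumF zero f = 0ℚ
sumF (suc n) f = f zero + sumF n (f ∘ suc)

sumF-cong : ∀ n {f g : Fin n → ℚ} → (∀ i → f i ≡ g i) → sumF n f ≡ sumF n g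
sumF-cong zero e = refl
sumF-cong (suc n) e = cong₂ _+_ (e zero) (sumF-cong n (e ∘ suc))

sumF-neg : ∀ n (f : Fin n → ℚ) → sumF n (λ i → - f i) ≡ - sumF n f
sumF-neg zero f = refl
sumF-neg (suc n) f = trans (cong (λ s → - f zero + s) (sumF-neg n (f ∘ suc)))
    (sym (neg-distrib-+ (f zero) (sumF n (f ∘ suc))))

signed : ∀ {k} → Vec ℤ (suc k) → Vec (Vec ℤ (suc k)) k → Fin (suc k) → ℚ
signed r rs j = sign (toℕ j) * toℚ (minor r rs j)

toℚ-laplace : ∀ {k} (r : Vec ℤ (suc k)) rs {m} (g : Fin (suc m) → Fin (suc k)) →
  toℚ (laplace r rs (g zero) (tabulate (g ∘ suc))) ≡ sumF (suc m) (signed r rs ∘ g)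
toℚ-laplace r rs {zero} g = trans (cong toℚ (laplace-last r rs (g zero)))
    (toℚ-last r rs (g zero) (toℕ (g zero)))
toℚ-laplace r rs {suc m} g = trans (cong toℚ (laplace-step r rs (g zero) (g (suc zero)) js))
  (trans (toℚ-step r rs (g zero) (g (suc zero)) js (laplace r rs (g (suc zero)) js) (toℕ (g zero)))
    (cong (λ s → signed r rs (g zero) + s) (toℚ-laplace r rs (g ∘ Fin.suc))))
  where
  js : Vec (Fin _) m
  js = tabulate (λ i → g (suc (suc i)))

toℚ-laplace₀ : ∀ {k} (r : Vec ℤ (suc k)) rs → toℚ (laplace₀ r rs (tabulate suc)) ≡ sumF k (signed r rs ∘ suc)
toℚ-laplace₀ {zero} r rs = refl
toℚ-laplace₀ {suc k} r rs = trans (cong toℚ (laplace₀≡laplace r rs (suc zero) (tabulate (λ i → suc (suc i)))))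
    (toℚ-laplace r rs suc)

toℚ-det : ∀ {k} (r : Vec ℤ (suc k)) rs → toℚ (det (r ∷ rs)) ≡ sumF (suc k) (signed r rs)
toℚ-det r rs = trans (cong toℚ (det≡laplace₀ r rs))
  (trans (toℚ-signed (+ 1) (minor r rs zero) (laplace₀ r rs (tabulate suc)))
    (cong (λ s → signed r rs zero + s) (toℚ-laplace₀ r rs)))

ι-sum : ∀ {d k} (u : V d) ψ (vs : Vec (V d) (suc k)) →
  ι u ψ (Vec.toList vs) ≡ sumF (suc k)
      (λ j → sign (toℕ j) * (u · lookup vs j * ψ (Vec.toList (removeAt vs j))))
ι-sum {k = zero} u ψ (v ∷ []) = lem (u · v * ψ [])
  where
  lem : ∀ p → p - 0ℚ ≡ 1ℚ * p + 0ℚ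
  lem = solve-∀ ℚ-ring
ι-sum {k = suc k} u ψ (v ∷ vs@(_ ∷ _)) = cong₂ _+_ (sym (*-identityˡ (u · v * ψ (Vec.toList vs))))
  (trans (cong -_ (ι-sum u (ψ ∘ (v ∷_)) vs)) (trans (sym (sumF-neg (suc k) (λ j → sign (toℕ j) * term j)))
    (sumF-cong (suc k) λ j → neg-distribˡ-* (sign (toℕ j)) (term j))))
  where
  term : Fin (suc k) → ℚ
  term j = u · lookup vs j * ψ (v ∷ Vec.toList (removeAt vs j))

toℚ-dotℤ : ∀ {d} (u v : Pt d) → toℚ (dotℤ u v) ≡ pt u · pt v
toℚ-dotℤ [] [] = refl
toℚ-dotℤ (x ∷ u) (y ∷ v) = trans (toℚ-+ (x ℤ.* y) (dotℤ u v)) (cong₂ _+_ (toℚ-* x y) (toℚ-dotℤ u v))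

removeAt-map : ∀ {A B : Set} {n} (f : A → B) (xs : Vec A (suc n)) j → removeAt (Vec.map f xs) j ≡ Vec.map f
    (removeAt xs j)
removeAt-map f (x ∷ xs) zero = refl
removeAt-map f (x ∷ xs@(_ ∷ _)) (suc j) = cong (f x ∷_) (removeAt-map f xs j)

toList-map : ∀ {A B : Set} {n} (f : A → B) (xs : Vec A n) → Vec.toList (Vec.map f xs) ≡ map f (Vec.toList xs)
toList-map f [] = refl
toList-map f (x ∷ xs) = cong (f x ∷_) (toList-map f xs)

-- Two independent lists are needed for the induction: deleting a column removes a vector from vs
-- and deleting the first row one from us, so the minors of a Gram matrix are no longer Gram
-- matrices.
det≡Det : ∀ {d k} (us vs : Vec (Pt d) k) →
  toℚ (det (Vec.map (λ u → Vec.map (dotℤ u) vs) us)) ≡ Det (map pt (Vec.toList us))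
      (Vec.toList (Vec.map pt vs))
det≡Det [] [] = refl
det≡Det {k = suc k} (u ∷ us) vs = trans (toℚ-det row rows)
  (trans (sumF-cong (suc k) (λ j → cong (sign (toℕ j) *_) (term j)))
    (sym (ι-sum (pt u) (Det (map pt (Vec.toList us))) (Vec.map pt vs))))
  where
  row : Vec ℤ (suc k)
  row = Vec.map (dotℤ u) vs
  rows : Vec (Vec ℤ (suc k)) k
  rows = Vec.map (λ u → Vec.map (dotℤ u) vs) us
  minors : ∀ j → Vec.map (λ r → removeAt r j) rows ≡ Vec.map (λ u → Vec.map (dotℤ u) (removeAt vs j)) us
  minors j = trans (sym (map-∘ _ _ us)) (map-cong (λ u → removeAt-map (dotℤ u) vs j) us)
  term : ∀ j → toℚ (minor row rows j) ≡
    pt u · lookup (Vec.map pt vs) j * Det (map pt (Vec.toList us)) (Vec.toList (removeAt (Vec.map pt vs) j))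
  term j = trans (toℚ-* (lookup row j) _) (cong₂ _*_
    (trans (cong toℚ (lookup-map j (dotℤ u) vs))
        (trans (toℚ-dotℤ u (lookup vs j)) (cong (pt u ·_) (sym (lookup-map j pt vs)))))
    (trans (cong (toℚ ∘ det) (minors j)) (trans (det≡Det us (removeAt vs j))
      (cong (λ l → Det (map pt (Vec.toList us)) (Vec.toList l)) (sym (removeAt-map pt vs j))))))

-- Gram determinants of lattice simplices

edges : ∀ {d} → Pt d → List (Pt d) → List (V d)
edges q qs = map pt (map (_-ᵥ q) qs)

toℚ-gram : ∀ {d} (q : Pt d) qs → toℚ (gram (q ∷ qs)) ≡ Gram (edges q qs)
toℚ-gram q qs = trans (det≡Det (Vec.fromList es) (Vec.fromList es))
  (cong₂ Det (cong (map pt) (toList∘fromList es))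
      (trans (toList-map pt (Vec.fromList es)) (cong (map pt) (toList∘fromList es))))
  where
  es : List (Pt _)
  es = map (_-ᵥ q) qs

Comb-map : ∀ {d P} {vs : List (Pt d)} {x} → Comb pt P vs x → Comb id P (map pt vs) x
Comb-map (nil e) = nil e
Comb-map (cons a y p c e) = cons a y p (Comb-map c) e

Comb-unmap : ∀ {d P} (vs : List (Pt d)) {x} → Comb id P (map pt vs) x → Comb pt P vs x
Comb-unmap [] (nil e) = nil e
Comb-unmap (v ∷ vs) (cons a y p c e) = cons a y p (Comb-unmap vs c) e

Indep-map : ∀ {d} (vs : List (Pt d)) → Indep pt vs → Indep id (map pt vs)
Indep-map [] _ = tt
Indep-map (v ∷ vs) (¬v , ind) = (¬v ∘ Comb-unmap vs) , Indep-map vs ind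

module _ {d : ℕ} (w : V d) where

  -- As x has level 0, the coefficient of q is minus the sum of the others. Those others are then
  -- the coefficients over the edges, so their type P is preserved.
  edge-comb : ∀ {P} {{_ : Coeffs P}} q qs → Level1 w (q ∷ qs) → ∀ {x} → w · x ≡ 0ℚ → Comb pt P (q ∷ qs) x
      → Comb id P (edges q qs) x
  edge-comb q qs l {x} wx (cons a y p c e) = Comb-map (comb-≈ y≈x (comb-shift w q (l ∘ there) c))
    where
    a+wy : a + w · y ≡ 0ℚ
    a+wy = trans (cong (λ t → t + w · y) (sym (trans (cong (a *_) (l (here refl))) (*-identityʳ a))))
      (trans (sym (·-linʳ w a (pt q) y e)) wx)
    y≈x : y ⊖ (w · y) ∙ pt q ≈ x
    y≈x i = trans (lem a (w · y) (y i) (pt q i))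
        (trans (cong₂ (λ s t → s - t * pt q i) (sym (e i)) a+wy) (lem′ (x i) (pt q i)))
      where
      lem : ∀ a wy y q → y - wy * q ≡ a * q + y - (a + wy) * q
      lem = solve-∀ ℚ-ring
      lem′ : ∀ x q → x - 0ℚ * q ≡ x
      lem′ = solve-∀ ℚ-ring

  gram-minimal : ∀ σ τ → Level1 w σ → Level1 w τ → length τ ≡ length σ → AffIndep τ →
    (∀ {t} → t ∈ τ → Comb pt Int σ (pt t)) → gram σ ℤ.≤ gram τ
  gram-minimal [] [] _ _ _ _ _ = ℤ.≤-refl
  gram-minimal (q ∷ qs) (t ∷ ts) lσ lτ len ind inσ = toℚ-cancel-≤
    (subst₂ _≤_ (sym (toℚ-gram q qs)) (sym (toℚ-gram t ts))
      (Gram-minimal (edges t ts) (edges q qs)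
        (trans (length-edges t ts) (trans (ℕ.suc-injective len) (sym (length-edges q qs))))
        (Indep-map _ (LinIndep⇒Indep _ ind)) inEdges))
    where
    length-edges : ∀ q qs → length (edges q qs) ≡ length qs
    length-edges q qs = trans (length-map pt (map (_-ᵥ q) qs)) (length-map (_-ᵥ q) qs)
    inEdges : ∀ {u} → u ∈ edges t ts → Comb id Int (edges q qs) u
    inEdges m with ∈-map⁻ pt m
    ... | v , v∈ , refl with ∈-map⁻ (_-ᵥ t) v∈
    ... | s , s∈ , refl = edge-comb q qs lσ
            (trans (·-congʳ w (pt--ᵥ s t))
                (trans (·-⊖ʳ w (pt s) (pt t))
                (trans (cong₂ _-_ (lτ (there s∈)) (lτ (here refl))) (+-inverseʳ 1ℚ))))
            (comb-≈ (≈-sym (pt--ᵥ s t)) (comb-⊖ (-[1+ 0 ] , refl) (inσ (there s∈)) (inσ (here refl))))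

dotℚ-· : ∀ {d} (c : Vec ℚ d) (p : Pt d) → dotℚ c (toℚv p) ≡ lookup c · pt p
dotℚ-· [] [] = refl
dotℚ-· (x ∷ c) (z ∷ p) = cong (λ t → x * toℚ z + t) (dotℚ-· c p)

-- Columns of a matrix and their combinations

vec⇒comb : ∀ {d n P} (A : Mat d n) xs → (∀ j → P (lookup xs j)) → Comb pt P (toList A) (lookup (mulℚ A xs))
vec⇒comb [] [] _ = nil λ i → lookup-replicate i 0ℚ
vec⇒comb (p ∷ A) (x ∷ xs) h = cons x _ (h zero) (vec⇒comb A xs (h ∘ suc)) (lookup-lincombℚ x xs p A)

comb⇒vec : ∀ {d n P} (A : Mat d n) {x} → Comb pt P (toList A) x →
  ∃[ xs ] (∀ j → P (lookup xs j)) × lookup (mulℚ A xs) ≈ x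
comb⇒vec [] (nil e) = [] , (λ ()) , λ i → trans (lookup-replicate i 0ℚ) (sym (e i))
comb⇒vec (p ∷ A) (cons a y q c e) with comb⇒vec A c
... | xs , h , e′ = a ∷ xs , (λ { zero → q ; (suc j) → h j }) ,
      λ i → trans (lookup-lincombℚ a xs p A i) (trans (cong (λ t → a * pt p i + t) (e′ i)) (sym (e i)))

lift-coeffs : ∀ {A : Set} {n} (f : A → ℚ) (xs : Vec ℚ n) → (∀ j → ∃[ a ] lookup xs j ≡ f a)
    → ∃[ as ] Vec.map f as ≡ xs
lift-coeffs f [] h = [] , refl
lift-coeffs f (x ∷ xs) h with h zero | lift-coeffs f xs (h ∘ suc)
... | a , refl | as , refl = a ∷ as , refl

-- Brings a vector of the lattice back to the integral right-hand sides of which `LPeqIPForAll`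
-- speaks.
intComb⇒point : ∀ {d} {vs : List (Pt d)} {x} → Comb pt Int vs x → ∃[ p ] pt p ≈ x
intComb⇒point {d} (nil e) = Vec.replicate d (+ 0) , λ i → trans (cong toℚ (lookup-replicate i (+ 0)))
    (sym (e i))
intComb⇒point {d} {v ∷ _} (cons a y (z , refl) c e) with intComb⇒point c
... | p , e′ = Vec.zipWith ℤ._+_ (Vec.map (z ℤ.*_) v) p , λ i →
      trans (cong toℚ (trans (lookup-zipWith ℤ._+_ i (Vec.map (z ℤ.*_) v) p)
          (cong (ℤ._+ lookup p i) (lookup-map i (z ℤ.*_) v))))
      (trans (toℚ-+ (z ℤ.* lookup v i) (lookup p i))
          (trans (cong₂ _+_ (toℚ-* z (lookup v i)) (e′ i)) (sym (e i))))

mulℚ-update : ∀ {d n} (A : Mat d n) xs j s → lookup (mulℚ A (xs [ j ]%= (_+ s))) ≈ s ∙ pt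
    (lookup A j) ⊕ lookup (mulℚ A xs)
mulℚ-update (p ∷ A) (x ∷ xs) zero s i = trans (lookup-lincombℚ (x + s) xs p A i)
  (trans (lem x s (pt p i) _) (cong (λ t → s * pt p i + t) (sym (lookup-lincombℚ x xs p A i))))
  where
  lem : ∀ x s p y → (x + s) * p + y ≡ s * p + (x * p + y)
  lem = solve-∀ ℚ-ring
mulℚ-update (p ∷ A) (x ∷ xs) (suc j) s i = trans (lookup-lincombℚ x (xs [ j ]%= (_+ s)) p A i)
  (trans (cong (λ t → x * pt p i + t) (mulℚ-update A xs j s i))
    (trans (lem (x * pt p i) (s * pt (lookup A j) i) _)
        (cong (λ t → s * pt (lookup A j) i + t) (sym (lookup-lincombℚ x xs p A i)))))
  where
  lem : ∀ a b c → a + (b + c) ≡ b + (a + c)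
  lem = solve-∀ ℚ-ring

update-coeffs : ∀ {n} {P : ℚ → Set} (xs : Vec ℚ n) j s → (∀ i → P (lookup xs i)) → P (lookup xs j + s) →
  ∀ i → P (lookup (xs [ j ]%= (_+ s)) i)
update-coeffs {P = P} xs j s h hj i with i Fin.≟ j
... | yes refl = subst P (sym (lookup∘updateAt i xs)) hj
... | no i≢j = subst P (sym (lookup∘updateAt′ i j i≢j xs)) (h i)

∈-toList⇒index : ∀ {d n} (A : Mat d n) {p} → p ∈ toList A → ∃[ j ] lookup A j ≡ p
∈-toList⇒index (_ ∷ A) (here refl) = zero , refl
∈-toList⇒index (_ ∷ A) (there m) with ∈-toList⇒index A m
... | j , e = suc j , e

lookup∈toList : ∀ {d n} (A : Mat d n) j → lookup A j ∈ toList A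
lookup∈toList (_ ∷ A) zero = here refl
lookup∈toList (_ ∷ A) (suc j) = there (lookup∈toList A j)

sum-w : ∀ {d n} (w : V d) (A : Mat d n) xs → Level1 w (toList A) → w · lookup (mulℚ A xs) ≡ foldr _ _+_ 0ℚ xs
sum-w w [] [] l = trans (·-congʳ w λ i → lookup-replicate i 0ℚ) (·-zeroʳ w)
sum-w w (p ∷ A) (x ∷ xs) l = trans (·-linʳ w x (pt p) _ (lookup-lincombℚ x xs p A))
  (cong₂ _+_ (trans (cong (x *_) (l (here refl))) (*-identityʳ x)) (sum-w w A xs (l ∘ there)))

≈-toℚv : ∀ {d} {u : Vec ℚ d} {p : Pt d} → lookup u ≈ pt p → u ≡ toℚv p
≈-toℚv {p = p} e = vec-ext λ i → trans (e i) (sym (lookup-toℚv p i))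

toℚv-≈ : ∀ {d} {u : Vec ℚ d} {p : Pt d} → u ≡ toℚv p → lookup u ≈ pt p
toℚv-≈ {p = p} refl = lookup-toℚv p

module _ {d n : ℕ} (A : Mat d n) where

  LPFeasible⇒comb : ∀ {b} x → LPFeasible A b x → Comb pt NN (toList A) (pt b)
  LPFeasible⇒comb x (nn , e) = comb-≈ (toℚv-≈ e) (vec⇒comb A x nn)

  IPFeasible⇒comb : ∀ {b} y → IPFeasible A b y → Comb pt Nat (toList A) (pt b)
  IPFeasible⇒comb y e = comb-≈ (toℚv-≈ e) (vec⇒comb A (Vec.map ℕtoℚ y) λ j → lookup y j , lookup-map j ℕtoℚ y)

  module _ (w : V d) (level : Level1 w (toList A)) where

    InPA⇒cone : ∀ {p} → InPA A p → Comb pt NN (toList A) (pt p)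
    InPA⇒cone (λs , nn , _ , e) = comb-≈ (toℚv-≈ e) (vec⇒comb A λs nn)

    InPA⇒level : ∀ {p} → InPA A p → w · pt p ≡ 1ℚ
    InPA⇒level (λs , _ , sum , e) = trans (sym (·-congʳ w (toℚv-≈ e))) (trans (sum-w w A λs level) sum)

    InLattice⇒comb : ∀ {p} → InLattice A p → Comb pt Int (toList A) (pt p)
    InLattice⇒comb (c , e) = comb-≈ (toℚv-≈ e) (vec⇒comb A (toℚv c) λ j → lookup c j , lookup-map j toℚ c)

    column⇒InPAL : ∀ {p} → p ∈ toList A → InPAL A p
    column⇒InPAL {p} m with comb⇒vec {P = NN} A (comb-∈ m) | comb⇒vec {P = Int} A (comb-∈ m)
    ... | λs , nn , e | cs , int , e′ with lift-coeffs toℚ cs int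
    ... | zs , refl = (λs , nn , trans (sym (sum-w w A λs level))
        (trans (·-congʳ w e) (level m)) , ≈-toℚv e) , zs , ≈-toℚv e′

-- Rounding and normality of the monoid of columns

-- LP = IP for the columns T: a rational multiple of p that can be subtracted from b rounds up to a natural one.
Rounding : ∀ {d} → List (Pt d) → Set
Rounding T = ∀ {p b s} → p ∈ T → Comb pt Nat T b → 0ℚ ≤ s → Comb pt NN T (b ⊖ s ∙ pt p) →
  ∃[ k ] Nat k × s ≤ k × Comb pt Nat T (b ⊖ k ∙ pt p)

LPeqIP⇒rounding : ∀ {d n} (A : Mat d n) → LPeqIPForAll A → Rounding (toList A)
LPeqIP⇒rounding {d} {n} A lpip {b = b} {s} m bℕ 0≤s bs with ∈-toList⇒index A m
... | i , refl = assemble (intComb⇒point (comb-weaken Nat⇒Int bℕ)) (comb⇒vec A bℕ) (comb⇒vec A bs)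
  where
  Goal : Set
  Goal = ∃[ k ] Nat k × s ≤ k × Comb pt Nat (toList A) (b ⊖ k ∙ pt (lookup A i))
  module _ {b′ : Pt d} (b≈ : pt b′ ≈ b) {xs : Vec ℚ n} (0≤xs : ∀ j → 0ℚ ≤ lookup xs j)
           (xs≈ : lookup (mulℚ A xs) ≈ b ⊖ s ∙ pt (lookup A i)) where
    xs′ : Vec ℚ n
    xs′ = xs [ i ]%= (_+ s)
    xs′-feasible : LPFeasible A b′ xs′
    xs′-feasible = update-coeffs {P = NN} xs i s 0≤xs (0≤+ (0≤xs i) 0≤s) , ≈-toℚv λ j →
      trans (mulℚ-update A xs i s j) (trans (cong (λ t → s * pt (lookup A i) j + t) (xs≈ j))
        (trans (lem (s * pt (lookup A i) j) (b j)) (sym (b≈ j))))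
      where
      lem : ∀ p b → p + (b - p) ≡ b
      lem = solve-∀ ℚ-ring
    s≤xs′ : s ≤ lookup xs′ i
    s≤xs′ = subst₂ _≤_ (+-identityˡ s) (sym (lookup∘updateAt i xs)) (+-monoˡ-≤ s (0≤xs i))
    optimum : LPeqIP A b′ i → Goal
    -- k is the whole i-th coordinate of the IP optimum, so taking it off leaves 0 there and a
    -- natural combination for the rest.
    optimum (v , (_ , lp≤v) , (y , yb , yi≡v) , _) = k , (lookup y i , refl) ,
      ≤-trans s≤xs′ (subst (lookup xs′ i ≤_) (sym yi≡v) (lp≤v xs′ xs′-feasible)) ,
      comb-≈ rest≈ (vec⇒comb A (ys [ i ]%= (_+ (- k)))
          (update-coeffs {P = Nat} ys i (- k) (λ j → lookup y j , lookup-map j ℕtoℚ y)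
        (0 , trans (cong (_- k) (lookup-map i ℕtoℚ y)) (+-inverseʳ k))))
      where
      ys : Vec ℚ n
      ys = Vec.map ℕtoℚ y
      k : ℚ
      k = ℕtoℚ (lookup y i)
      rest≈ : lookup (mulℚ A (ys [ i ]%= (_+ (- k)))) ≈ b ⊖ k ∙ pt (lookup A i)
      rest≈ j = trans (mulℚ-update A ys i (- k) j) (trans (cong (λ t → (- k) * pt (lookup A i) j + t)
        (trans (toℚv-≈ yb j) (b≈ j))) (lem k (pt (lookup A i) j) (b j)))
        where
        lem : ∀ k p b → (- k) * p + b ≡ b - k * p
        lem = solve-∀ ℚ-ring
  assemble : (∃[ b′ ] pt b′ ≈ b) → (∃[ ys ] (∀ j → Nat (lookup ys j)) × lookup (mulℚ A ys) ≈ b) →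
    (∃[ xs ] (∀ j → 0ℚ ≤ lookup xs j) × lookup (mulℚ A xs) ≈ b ⊖ s ∙ pt (lookup A i)) → Goal
  assemble (b′ , b≈) (ys , ysℕ , ys≈) (xs , 0≤xs , xs≈) with lift-coeffs ℕtoℚ ys ysℕ
  ... | y , refl = optimum {b′} b≈ {xs} 0≤xs xs≈ (lpip i b′ (y , ≈-toℚv (≈-trans ys≈ (≈-sym b≈))))

-- Used to make rational coefficients nonnegative (`archimedean`) and integral ones natural
-- (`integer-shift`); in both cases the correction u is a natural combination of the same
-- generators.
natural-shift : ∀ {d} {X : Set} {f : X → V d} {P Q} → (∀ {a} → P a → ∃[ m ] Nat m × Q (a + m)) →
  ∀ {vs x} → Comb f P vs x → ∃[ u ] Comb f Nat vs u × Comb f Q vs (x ⊕ u)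
natural-shift h (nil e) = 0v , nil (λ _ → refl) , nil λ i → trans (+-identityʳ _) (e i)
natural-shift {f = f} h {v ∷ _} (cons a y p c e) with h p | natural-shift h c
... | m , mℕ , q | u , cu , c′ = m ∙ f v ⊕ u , cons m u mℕ cu (λ _ → refl) , cons (a + m) (y ⊕ u) q c′
      λ i → trans (cong (_+ (m * f v i + u i)) (e i)) (lem a (f v i) (y i) m (u i))
  where
  lem : ∀ a v y m u → a * v + y + (m * v + u) ≡ (a + m) * v + (y + u)
  lem = solve-∀ ℚ-ring

opaque
  archimedean : ∀ a → ∃[ m ] Nat m × 0ℚ ≤ a + m
  -- The numerator bounds the fraction in absolute value because the denominator is at least 1.
  archimedean a = ℕtoℚ ℤ.∣ ↥ a ∣ , (ℤ.∣ ↥ a ∣ , refl) , subst (0ℚ ≤_) (lem a (ℕtoℚ ℤ.∣ ↥ a ∣))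
      (≤⇒0≤- (bound a))
    where
    lem : ∀ a m → a - (- m) ≡ a + m
    lem = solve-∀ ℚ-ring
    bound : ∀ a → - ℕtoℚ ℤ.∣ ↥ a ∣ ≤ a
    bound a = subst (_≤ a) (toℚ-neg (+ ℤ.∣ ↥ a ∣))
        (subst (_≤ a) (sym (toℚ-mk (ℤ.- (+ ℤ.∣ ↥ a ∣)))) (*≤* (boundℤ (↥ a) (↧ₙ a))))
      where
      boundℤ : ∀ z k .{{_ : ℕ.NonZero k}} → (ℤ.- (+ ℤ.∣ z ∣)) ℤ.* + k ℤ.≤ z ℤ.* + 1
      boundℤ (+ zero) k = ℤ.≤-refl
      boundℤ (+ suc j) (suc k) = ℤ.-≤+
      boundℤ -[1+ j ] (suc k) = ℤ.-≤-
          (subst (ℕ._≤ k ℕ.+ j ℕ.* suc k) (sym (ℕ.*-identityʳ j))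
          (ℕ.≤-trans (ℕ.m≤m*n j (suc k)) (ℕ.m≤n+m (j ℕ.* suc k) k)))

integer-shift : ∀ {a} → Int a → ∃[ m ] Nat m × Nat (a + m)
integer-shift {a} int with archimedean a
... | m , mℕ , nn = m , mℕ , Int∧NN⇒Nat (P+ int (Nat⇒Int mℕ)) nn

-- The negative part of an integral combination is removed one generator at a time.
rounding⇒normal : ∀ {d} {T : List (Pt d)} → Rounding T → ∀ {x} → Comb pt Int T x → Comb pt NN T x
    → Comb pt Nat T x
rounding⇒normal {d} {T} round cℤ cN with natural-shift integer-shift cℤ
... | u , cu , cxu = remove id cu cN cxu
  where
  remove : ∀ {U x u} → (∀ {v} → v ∈ U → v ∈ T) → Comb pt Nat U u → Comb pt NN T x → Comb pt Nat T (x ⊕ u)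
      → Comb pt Nat T x
  remove {x = x} s (nil e) cx c = comb-≈ (λ i → trans (cong (λ t → x i + t) (e i)) (+-identityʳ (x i))) c
  remove {v ∷ U} {x} {u} s (cons a y aℕ cy e) cx c = finish (round (s (here refl)) c (Nat⇒NN aℕ)
         (comb-≈ (λ i → sym (trans (cong (λ t → x i + t - a * pt v i) (e i)) (lem (x i) (a * pt v i) (y i))))
           (comb-+ cx (comb-⊆ (s ∘ there) (comb-weaken Nat⇒NN cy)))))
    where
    lem : ∀ x p y → x + (p + y) - p ≡ x + y
    lem = solve-∀ ℚ-ring
    lem′ : ∀ k a v x y → (k - a) * v + (x + (a * v + y) - k * v) ≡ x + y
    lem′ = solve-∀ ℚ-ring
    finish : ∃[ k ] Nat k × a ≤ k × Comb pt Nat T ((x ⊕ u) ⊖ k ∙ pt v) → Comb pt Nat T x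
    -- Rounding may take off more than the a copies of v that are due; the surplus k - a is natural
    -- and is put back.
    finish (k , kℕ , a≤k , c′) = remove (s ∘ there) cy cx (comb-≈
      (λ i → trans (cong (λ t → (k - a) * pt v i + (x i + t - k * pt v i)) (e i))
          (lem′ k a (pt v i) (x i) (y i)))
      (comb-+ (comb-∙ (Int∧NN⇒Nat (P+ (Nat⇒Int kℕ) (Int-neg (Nat⇒Int aℕ))) (≤⇒0≤- a≤k))
          (comb-∈ (s (here refl)))) c′))

module _ {d : ℕ} (w : V d) where

  -- The coefficients are natural numbers with sum w · x = 1, so one of them is 1 and the others are
  -- 0.
  level⇒generator : ∀ {T x} → Level1 w T → Comb pt Nat T x → w · x ≡ 1ℚ → ∃[ p ] p ∈ T × x ≈ pt p
  level⇒generator l (nil e) wx = ⊥-elim (1≢0 (trans (sym wx) (trans (·-congʳ w e) (·-zeroʳ w))))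
  level⇒generator {v ∷ T} {x} l (cons a y aℕ c e) wx = go (Nat≡0⊎1≤ aℕ)
    where
    wa : a + w · y ≡ 1ℚ
    wa = trans (cong (_+ w · y) (sym (trans (cong (a *_) (l (here refl))) (*-identityʳ a))))
        (trans (sym (·-linʳ w a (pt v) y e)) wx)
    0≤level : ∀ {v} → v ∈ T → 0ℚ ≤ w · pt v
    0≤level m = subst (0ℚ ≤_) (sym (l (there m))) (<⇒≤ 0<1)
    go : a ≡ 0ℚ ⊎ 1ℚ ≤ a → ∃[ p ] p ∈ v ∷ T × x ≈ pt p
    go (inj₁ refl) with level⇒generator (l ∘ there) c (trans (sym (+-identityˡ (w · y))) wa)
    ... | p , m , e′ = p , there m , λ i → trans (e i)
        (trans (cong (_+ y i) (*-zeroˡ (pt v i))) (trans (+-identityˡ (y i)) (e′ i)))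
    go (inj₂ 1≤a) = v , here refl , λ i → trans (e i)
        (trans (cong₂ (λ s t → s * pt v i + t) a≡1 (y≈0 i)) (lem (pt v i)))
      where
      lem : ∀ v → 1ℚ * v + 0ℚ ≡ v
      lem = solve-∀ ℚ-ring
      0≤wy : 0ℚ ≤ w · y
      0≤wy = comb-nonneg w Nat⇒NN 0≤level c
      sum≡0 : (a - 1ℚ) + w · y ≡ 0ℚ
      sum≡0 = trans (lem′ a (w · y)) (trans (cong (_- 1ℚ) wa) (+-inverseʳ 1ℚ))
        where
        lem′ : ∀ a y → a - 1ℚ + y ≡ a + y - 1ℚ
        lem′ = solve-∀ ℚ-ring
      a≡1 : a ≡ 1ℚ
      a≡1 = trans (lem′ a) (trans (cong (_+ 1ℚ) (0≤+-zeroˡ (≤⇒0≤- 1≤a) 0≤wy sum≡0)) (+-identityˡ 1ℚ))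
        where
        lem′ : ∀ a → a ≡ a - 1ℚ + 1ℚ
        lem′ = solve-∀ ℚ-ring
      y≈0 : y ≈ 0v
      y≈0 = comb-[] (comb-face {g = pt} w Nat⇒NN 0≤level
        (λ m z → ⊥-elim (1≢0 (trans (sym (l (there m))) z))) (0≤+-zeroʳ (≤⇒0≤- 1≤a) 0≤wy sum≡0) c)

-- Faces, facets and pulling simplices

-- Stated by membership, so that the lists from `onHyperplane`, `zeros` and `facet` all qualify,
-- whether or not the apex was removed before filtering.
Face : ∀ {d} → V d → List (Pt d) → List (Pt d) → Set
Face ℓ F T = (∀ {v} → v ∈ F → v ∈ T) × (∀ {v} → v ∈ F → ℓ · pt v ≡ 0ℚ) ×
    (∀ {v} → v ∈ T → ℓ · pt v ≡ 0ℚ → v ∈ F)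

face-comb : ∀ {d P} {{_ : Coeffs P}} {ℓ : V d} {F T x} → (∀ {a} → P a → NN a) → Valid pt ℓ T → Face ℓ F T →
  ℓ · x ≡ 0ℚ → Comb pt P T x → Comb pt P F x
face-comb {ℓ = ℓ} nn valid (_ , _ , all) = comb-face ℓ nn valid (λ m z → comb-∈ (all m z))

-- Both b and p lie on ℓ = 0, hence so does b - k p, and a natural combination on which ℓ vanishes
-- uses generators of F only.
rounding-face : ∀ {d} {ℓ : V d} {F T} → Valid pt ℓ T → Face ℓ F T → Rounding T → Rounding F
rounding-face {ℓ = ℓ} {F} valid face@(F⊆T , zeroF , _) round {p} {b} m bℕ 0≤s bs
  with round (F⊆T m) (comb-⊆ F⊆T bℕ) 0≤s (comb-⊆ F⊆T bs)
... | k , kℕ , s≤k , c = k , kℕ , s≤k , face-comb Nat⇒NN valid face ℓ≡0 c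
  where
  ℓ≡0 : ℓ · (b ⊖ k ∙ pt p) ≡ 0ℚ
  ℓ≡0 = trans (·-⊖ʳ ℓ b (k ∙ pt p)) (trans (cong₂ _-_ (comb-vanish ℓ zeroF bℕ)
    (trans (·-∙ʳ ℓ k (pt p)) (trans (cong (k *_) (zeroF m)) (*-zeroʳ k)))) (+-inverseʳ 0ℚ))

-- With b = q + (a large natural combination of F), maximising the coefficient of p in b gives the rational
-- coefficient of p in q modulo the span of F, which is therefore integral.
opaque
  rounding⇒lattice-step : ∀ {d} {ℓ : V d} {F T} → Valid pt ℓ T → Face ℓ F T → Rounding T → ∀ {p q} → p ∈ T
      → q ∈ T →
    0ℚ < ℓ · pt p → Span pt (p ∷ F) (pt q) → ∃[ k ] Int k × Comb pt Int F (pt q ⊖ k ∙ pt p)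
  rounding⇒lattice-step {d} {ℓ} {F} {T} valid face@(F⊆T , zeroF , _) round {p} {q} p∈ q∈ ℓp
      (cons a y _ cy e) =
    shifted (natural-shift (λ {a} _ → archimedean a) cy)
    where
    Goal : Set
    Goal = ∃[ k ] Int k × Comb pt Int F (pt q ⊖ k ∙ pt p)
    ℓq : ℓ · pt q ≡ a * ℓ · pt p
    ℓq = trans (·-linʳ ℓ a (pt p) y e)
        (trans (cong (λ t → a * ℓ · pt p + t) (comb-vanish ℓ zeroF cy)) (+-identityʳ _))
    0≤a : 0ℚ ≤ a
    0≤a = 0≤*-cancelˡ ℓp (subst (0ℚ ≤_) (trans ℓq (*-comm a (ℓ · pt p))) (valid q∈))
    rounded : ∀ {u} → Comb pt Nat F u → ∃[ k ] Nat k × a ≤ k × Comb pt Nat T ((pt q ⊕ u) ⊖ k ∙ pt p) → Goal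
    rounded {u} cu (k , kℕ , a≤k , c) = k , Nat⇒Int kℕ , comb-≈ (λ i → lem (pt q i) (u i) (k * pt p i))
      (comb-⊖ (-[1+ 0 ] , refl) (comb-weaken Nat⇒Int (face-comb Nat⇒NN valid face ℓ≡0 c))
          (comb-weaken Nat⇒Int cu))
      where
      lem : ∀ q u p → q + u - p - u ≡ q - p
      lem = solve-∀ ℚ-ring
      lem′ : ∀ a p k → a * p + 0ℚ - k * p ≡ p * (a - k)
      lem′ = solve-∀ ℚ-ring
      ℓrest : ℓ · ((pt q ⊕ u) ⊖ k ∙ pt p) ≡ ℓ · pt p * (a - k)
      ℓrest = trans (·-⊖ʳ ℓ (pt q ⊕ u) (k ∙ pt p)) (trans (cong₂ _-_
        (trans (·-⊕ʳ ℓ (pt q) u) (cong₂ _+_ ℓq (comb-vanish ℓ zeroF cu))) (·-∙ʳ ℓ k (pt p)))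
            (lem′ a (ℓ · pt p) k))
      k≤a : k ≤ a
      k≤a = 0≤-⇒≤ (0≤*-cancelˡ ℓp (subst (0ℚ ≤_) ℓrest (comb-nonneg ℓ Nat⇒NN valid c)))
      ℓ≡0 : ℓ · ((pt q ⊕ u) ⊖ k ∙ pt p) ≡ 0ℚ
      ℓ≡0 = trans ℓrest (trans (cong (λ t → ℓ · pt p * (a - t)) (≤-antisym k≤a a≤k))
        (trans (cong (ℓ · pt p *_) (+-inverseʳ a)) (*-zeroʳ (ℓ · pt p))))
    shifted : (∃[ u ] Comb pt Nat F u × Comb pt NN F (y ⊕ u)) → Goal
    shifted (u , cu , cyu) = rounded cu (round p∈ (comb-+ (comb-∈ q∈) (comb-⊆ F⊆T cu)) 0≤a
      (comb-≈ (λ i → trans (lem (a * pt p i) (y i) (u i)) (cong (λ t → t + u i - a * pt p i) (sym (e i))))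
          (comb-⊆ F⊆T cyu)))
      where
      lem : ∀ p y u → y + u ≡ p + y + u - p
      lem = solve-∀ ℚ-ring

module _ {d : ℕ} (w : V d) where

  -- On level 1 the affine inequality c · x ≤ m is the linear inequality 0 ≤ (m w - c) · x.
  homogenised : Vec ℚ d → ℚ → V d
  homogenised c m = (m ∙ w) ⊖ lookup c

  homogenised-· : ∀ c m q → w · pt q ≡ 1ℚ → homogenised c m · pt q ≡ m - dotℚ c (toℚv q)
  homogenised-· c m q wq = trans (·-comm (homogenised c m) (pt q)) (trans (·-⊖ʳ (pt q) (m ∙ w) (lookup c))
    (cong₂ _-_ (trans (·-∙ʳ (pt q) m w) (trans (cong (m *_) (trans (·-comm (pt q) w) wq)) (*-identityʳ m)))
      (trans (·-comm (pt q) (lookup c)) (sym (dotℚ-· c q)))))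

  opaque
    hyperplane-face : ∀ {c m p S} → Level1 w (p ∷ S) → All (λ q → dotℚ c (toℚv q) ≤ m) (p ∷ S) → ¬
        (dotℚ c (toℚv p) ≡ m) →
      Valid pt (homogenised c m) (p ∷ S) × 0ℚ < homogenised c m · pt p × Face (homogenised c m)
          (onHyperplane c m S) (p ∷ S)
    hyperplane-face {c} {m} {p} {S} l valid p∉ = nn , 0<p , there ∘ proj₁ ∘ on⁻ , zeroF , allF
      where
      on? : Decidable (λ q → dotℚ c (toℚv q) ≡ m)
      on? q = dotℚ c (toℚv q) ℚ.≟ m
      nn : Valid pt (homogenised c m) (p ∷ S)
      nn {v} v∈ = subst (0ℚ ≤_) (sym (homogenised-· c m v (l v∈))) (≤⇒0≤- (All.lookup valid v∈))
      on⁻ : ∀ {v} → v ∈ onHyperplane c m S → v ∈ S × dotℚ c (toℚv v) ≡ m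
      on⁻ = ∈-filter⁻ on?
      tight : ∀ {v} → v ∈ p ∷ S → homogenised c m · pt v ≡ 0ℚ → dotℚ c (toℚv v) ≡ m
      tight {v} v∈ z = trans (lem _ m)
          (trans (cong (λ t → m - t) (trans (sym (homogenised-· c m v (l v∈))) z)) (+-identityʳ m))
        where
        lem : ∀ x m → x ≡ m - (m - x)
        lem = solve-∀ ℚ-ring
      0<p : 0ℚ < homogenised c m · pt p
      0<p = ≤∧≢⇒< (nn (here refl)) λ z → p∉ (tight (here refl) (sym z))
      zeroF : ∀ {v} → v ∈ onHyperplane c m S → homogenised c m · pt v ≡ 0ℚ
      zeroF {v} v∈ = trans (homogenised-· c m v (l (there (proj₁ (on⁻ v∈)))))
          (trans (cong (λ t → m - t) (proj₂ (on⁻ v∈))) (+-inverseʳ m))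
      allF : ∀ {v} → v ∈ p ∷ S → homogenised c m · pt v ≡ 0ℚ → v ∈ onHyperplane c m S
      allF (here refl) z = ⊥-elim (p∉ (tight (here refl) z))
      allF (there v∈) z = ∈-filter⁺ on? v∈ (tight (there v∈) z)

  opaque
    -- B₀ consists of k + 1 independent points of F and p is off F. A point q outside the span of p
    -- ∷ B₀ would give k + 3 independent points, one more than the dimension of p ∷ S permits.
    facet-spans : ∀ {p S F k} {ℓ : V d} → Level1 w (p ∷ S) → Face ℓ F (p ∷ S) → 0ℚ < ℓ · pt p →
      AffDim (p ∷ S) (suc k) → AffDim F k → ∀ {q} → q ∈ p ∷ S → Span pt (p ∷ F) (pt q)
    facet-spans {p} {S} {F} {k} {ℓ} l (F⊆ , zeroF , _) 0<p (_ , maxT) ((B₀ , B₀⊆ , indB₀ , lenB₀) , _) {q} q∈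
      with span? pt (p ∷ B₀) (pt q) | basis pt (p ∷ S)
    ... | yes c | _ = comb-⊆ (λ { (here refl) → here refl ; (there m) → there (Sublist.lookup B₀⊆ m) }) c
    ... | no ¬c | B , B⊆ , indB , spans = ⊥-elim (ℕ.<-irrefl refl (ℕ.≤-trans
          (subst (λ t → suc (suc t) ℕ.≤ length B) lenB₀
              (indep-length pt (q ∷ p ∷ B₀) B (¬c , ¬p , indB₀′) inB))
          (maxT B B⊆ (Indep⇒AffIndep w B indB))))
      where
      B₀⊆F : ∀ {v} → v ∈ B₀ → v ∈ F
      B₀⊆F = Sublist.lookup B₀⊆
      indB₀′ : Indep pt B₀
      indB₀′ = AffIndep⇒Indep w B₀ (l ∘ F⊆ ∘ B₀⊆F) indB₀
      ¬p : ¬ Span pt B₀ (pt p)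
      ¬p c = <-irrefl (sym (comb-vanish ℓ (zeroF ∘ B₀⊆F) c)) 0<p
      inB : ∀ {v} → v ∈ q ∷ p ∷ B₀ → Span pt B (pt v)
      inB (here refl) = spans q∈
      inB (there (here refl)) = spans (here refl)
      inB (there (there m)) = spans (F⊆ (B₀⊆F m))

  rounding⇒pulled-lattice : ∀ {T σ} → PullSimplex T σ → Level1 w T → Rounding T →
    (∀ {v} → v ∈ σ → v ∈ T) × (∀ {v} → v ∈ T → Comb pt Int σ (pt v))
  rounding⇒pulled-lattice (pull-simplex _) _ _ = id , comb-∈
  rounding⇒pulled-lattice (pull-cone {p} {S} {τ} c m k _ valid p∉ dimT dimF pull) l round =
    let nn , 0<p , face@(F⊆ , _) = hyperplane-face {c} {m} l valid p∉
        τ⊆F , F⊆ℤτ = rounding⇒pulled-lattice pull (l ∘ F⊆) (rounding-face nn face round)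
    in (λ { (here refl) → here refl ; (there v∈) → F⊆ (τ⊆F v∈) }) ,
       λ {v} v∈ → cone-lattice {v} F⊆ℤτ
         (rounding⇒lattice-step nn face round {q = v} (here refl) v∈ 0<p
             (facet-spans l face 0<p dimT dimF v∈))
    where
    cone-lattice : ∀ {v F} → (∀ {u} → u ∈ F → Comb pt Int τ (pt u)) →
      ∃[ k ] Int k × Comb pt Int F (pt v ⊖ k ∙ pt p) → Comb pt Int (p ∷ τ) (pt v)
    cone-lattice {v} F⊆ℤτ (k , kℤ , cv) = cons k _ kℤ (comb-trans F⊆ℤτ cv) λ i → lem (pt v i) (k * pt p i)
      where
      lem : ∀ v p → v ≡ p + (v - p)
      lem = solve-∀ ℚ-ring

-- LP = IP implies compressed

homogeneous⇒level : ∀ {d n} {A : Mat d n} → ((w , _) : Homogeneous A) → Level1 (lookup w) (toList A)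
homogeneous⇒level {A = A} (w , _ , level) m with ∈-toList⇒index A m
... | j , refl = trans (sym (dotℚ-· w (lookup A j))) (level j)

LPeqIP⇒compressed : ∀ {d n} (A : Mat d n) → Homogeneous A → LPeqIPForAll A → Compressed A
LPeqIP⇒compressed A hom lpip S (_ , ord) σ pull τ τ∈ indτ len =
  gram-minimal w σ τ (levelS ∘ proj₁ lattice) (levelS ∘ τ⊆S) len indτ (proj₂ lattice ∘ τ⊆S)
  where
  w : V _
  w = lookup (proj₁ hom)
  level : Level1 w (toList A)
  level = homogeneous⇒level hom
  S⇒ : ∀ {p} → p ∈ S → InPAL A p
  S⇒ {p} = proj₁ (ord p)
  levelS : Level1 w S
  levelS m = InPA⇒level A w level (proj₁ (S⇒ m))
  τ⊆S : ∀ {t} → t ∈ τ → t ∈ S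
  τ⊆S {t} m = proj₂ (ord t) (All.lookup τ∈ m)
  roundA : Rounding (toList A)
  roundA = LPeqIP⇒rounding A lpip
  A⊆S : ∀ {p} → p ∈ toList A → p ∈ S
  A⊆S {p} m = proj₂ (ord p) (column⇒InPAL A w level m)
  S⊆A : ∀ {p} → p ∈ S → p ∈ toList A
  S⊆A {p} m = column (level⇒generator w level
    (rounding⇒normal roundA (InLattice⇒comb A w level (proj₂ (S⇒ m))) (InPA⇒cone A w level (proj₁ (S⇒ m))))
        (levelS m))
    where
    column : (∃[ q ] q ∈ toList A × pt p ≈ pt q) → p ∈ toList A
    column (q , q∈ , e) = subst (_∈ toList A) (sym (pt-injective e)) q∈
  -- S and the list of columns may differ in order and repetitions; combinations depend only on the
  -- set.
  roundS : Rounding S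
  roundS m bℕ 0≤s bs =
    let k , kℕ , s≤k , c = roundA (S⊆A m) (comb-⊆ S⊆A bℕ) 0≤s (comb-⊆ S⊆A bs)
    in k , kℕ , s≤k , comb-⊆ A⊆S c
  lattice : (∀ {v} → v ∈ σ → v ∈ S) × (∀ {v} → v ∈ S → Comb pt Int σ (pt v))
  lattice = rounding⇒pulled-lattice w pull levelS roundS

-- Facets and ray shooting

-- q₀ minimises l / (− g) among the elements with g < 0.
opaque
  ratio-test : ∀ {X : Set} (l g : X → ℚ) S → (∀ {v} → v ∈ S → 0ℚ ≤ l v) →
    (∀ {v} → v ∈ S → 0ℚ ≤ g v) ⊎
    (∃[ q₀ ] q₀ ∈ S × g q₀ < 0ℚ × (∀ {r} → r ∈ S → 0ℚ ≤ (- g q₀) * l r + l q₀ * g r))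
  ratio-test l g [] nn = inj₁ λ ()
  ratio-test l g (r ∷ S) nn with ratio-test l g S (nn ∘ there) | 0ℚ ≤? g r
  ... | inj₁ pos | yes p = inj₁ λ { (here refl) → p ; (there m) → pos m }
  ... | inj₁ pos | no ¬p = inj₂ (r , here refl , ≰⇒> ¬p , λ
        { (here refl) → ≤-reflexive (sym (lem (g r) (l r)))
        ; (there m) → 0≤+ (0≤* (<⇒≤ (<0⇒0<- (≰⇒> ¬p))) (nn (there m))) (0≤* (nn (here refl)) (pos m)) })
    where
    lem : ∀ g l → (- g) * l + l * g ≡ 0ℚ
    lem = solve-∀ ℚ-ring
  ... | inj₂ (q₀ , q₀∈ , gq₀ , ok) | yes p = inj₂ (q₀ , there q₀∈ , gq₀ , λ
        { (here refl) → 0≤+ (0≤* (<⇒≤ (<0⇒0<- gq₀)) (nn (here refl))) (0≤* (nn (there q₀∈)) p) ; (there m)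
            → ok m })
  ... | inj₂ (q₀ , q₀∈ , gq₀ , ok) | no ¬p = go (0ℚ ≤? B)
    where
    B : ℚ
    B = (- g q₀) * l r + l q₀ * g r
    go : Dec (0ℚ ≤ B) → (∀ {v} → v ∈ r ∷ S → 0ℚ ≤ g v) ⊎
      (∃[ q₀ ] q₀ ∈ r ∷ S × g q₀ < 0ℚ × (∀ {s} → s ∈ r ∷ S → 0ℚ ≤ (- g q₀) * l s + l q₀ * g s))
    go (yes b) = inj₂ (q₀ , there q₀∈ , gq₀ , λ { (here refl) → b ; (there m) → ok m })
    go (no ¬b) = inj₂ (r , here refl , ≰⇒> ¬p ,
        λ { (here refl) → ≤-reflexive (sym (lem (g r) (l r))) ; (there {x = s} m) → new m (0ℚ ≤? g _) })
      where
      lem : ∀ g l → (- g) * l + l * g ≡ 0ℚ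
      lem = solve-∀ ℚ-ring
      new : ∀ {s} → s ∈ S → Dec (0ℚ ≤ g s) → 0ℚ ≤ (- g r) * l s + l r * g s
      new m (yes q) = 0≤+ (0≤* (<⇒≤ (<0⇒0<- (≰⇒> ¬p))) (nn (there m))) (0≤* (nn (here refl)) q)
      -- Transitivity of the comparison of ratios with denominators cleared: s is compared with q₀,
      -- and q₀ with r.
      new {s} m (no ¬q) = 0≤*-cancelˡ (<0⇒0<- gq₀) (subst (0ℚ ≤_) (lem′ (g q₀) (g r) (g s) (l q₀) (l r) (l s))
        (0≤+ (0≤* (<⇒≤ (<0⇒0<- (≰⇒> ¬p))) (ok m)) (0≤* (<⇒≤ (<0⇒0<- (≰⇒> ¬q))) (<⇒≤ (<0⇒0<- (≰⇒> ¬b))))))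
        where
        lem′ : ∀ gq gr gs lq lr ls → (- gr) * ((- gq) * ls + lq * gs) + (- gs) * (- ((- gq) * lr + lq * gr)) ≡
          (- gq) * ((- gr) * ls + lr * gs)
        lem′ = solve-∀ ℚ-ring

filter-shrinks : ∀ {A : Set} {P Q : A → Set} (P? : Decidable P) (Q? : Decidable Q) (xs : List A) →
  (∀ {x} → x ∈ xs → P x → Q x) → length (filter P? xs) ℕ.≤ length (filter Q? xs)
filter-shrinks P? Q? [] s = ℕ.z≤n
filter-shrinks P? Q? (x ∷ xs) s with P? x | Q? x
... | yes p | yes q = ℕ.s≤s (filter-shrinks P? Q? xs (s ∘ there))
... | yes p | no ¬q = ⊥-elim (¬q (s (here refl) p))
... | no _ | yes q = ℕ.m≤n⇒m≤1+n (filter-shrinks P? Q? xs (s ∘ there))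
... | no _ | no _ = filter-shrinks P? Q? xs (s ∘ there)

filter-shrinks-strictly : ∀ {A : Set} {P Q : A → Set} (P? : Decidable P) (Q? : Decidable Q) (xs : List A) {x}
    →
  (∀ {x} → x ∈ xs → P x → Q x) → x ∈ xs → Q x → ¬ P x → length (filter P? xs) ℕ.< length (filter Q? xs)
filter-shrinks-strictly P? Q? (x ∷ xs) s (here refl) q ¬p with P? x | Q? x
... | yes p | _ = ⊥-elim (¬p p)
... | no _ | yes _ = ℕ.s≤s (filter-shrinks P? Q? xs (s ∘ there))
... | no _ | no ¬q = ⊥-elim (¬q q)
filter-shrinks-strictly P? Q? (x ∷ xs) s (there m) q ¬p with P? x | Q? x
... | yes p | yes q′ = ℕ.s≤s (filter-shrinks-strictly P? Q? xs (s ∘ there) m q ¬p)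
... | yes p | no ¬q = ⊥-elim (¬q (s (here refl) p))
... | no _ | yes _ = ℕ.m≤n⇒m≤1+n (filter-shrinks-strictly P? Q? xs (s ∘ there) m q ¬p)
... | no _ | no _ = filter-shrinks-strictly P? Q? xs (s ∘ there) m q ¬p

zero? : ∀ {d} (ℓ : V d) → Decidable (λ (v : Pt d) → ℓ · pt v ≡ 0ℚ)
zero? ℓ v = ℓ · pt v ℚ.≟ 0ℚ

zeros : ∀ {d} → V d → List (Pt d) → List (Pt d)
zeros ℓ = filter (zero? ℓ)

zeros-face : ∀ {d} (ℓ : V d) T → Face ℓ (zeros ℓ T) T
zeros-face ℓ T = (proj₁ ∘ ∈-filter⁻ (zero? ℓ)) , (λ m → proj₂ (∈-filter⁻ (zero? ℓ) {xs = T} m)) , ∈-filter⁺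
    (zero? ℓ)

-- Spanning by p and the zeros of ℓ expresses codimension one without counting; `facet-spans` and
-- `facet-dims` relate such spanning to `AffDim`.
Facet : ∀ {d} → List (Pt d) → Pt d → V d → Set
Facet S p ℓ = Valid pt ℓ S × 0ℚ < ℓ · pt p × (∀ {q} → q ∈ S → Span pt (p ∷ zeros ℓ S) (pt q))

-- A functional vanishing on p and on the face but not on all of S tilts ℓ to a larger face.
opaque
  extend-to-facet : ∀ {d} {S : List (Pt d)} {p} ℓ → p ∈ S → Valid pt ℓ S → 0ℚ < ℓ · pt p →
    ∃[ ℓ′ ] Facet S p ℓ′ × (∀ {v} → v ∈ S → ℓ · pt v ≡ 0ℚ → ℓ′ · pt v ≡ 0ℚ)
  extend-to-facet {d} {S} {p} ℓ p∈ = go _ ℓ ℕ.≤-refl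
    where
    nonzero? : ∀ ℓ → Decidable (λ (v : Pt d) → ¬ (ℓ · pt v ≡ 0ℚ))
    nonzero? ℓ v = ¬? (zero? ℓ v)
    support : V d → List (Pt d)
    support ℓ = filter (nonzero? ℓ) S
    Result : V d → Set
    Result ℓ = ∃[ ℓ′ ] Facet S p ℓ′ × (∀ {v} → v ∈ S → ℓ · pt v ≡ 0ℚ → ℓ′ · pt v ≡ 0ℚ)
    go : ∀ n ℓ → length (support ℓ) ℕ.≤ n → Valid pt ℓ S → 0ℚ < ℓ · pt p → Result ℓ
    tilt : ∀ n ℓ g → length (support ℓ) ℕ.≤ n → Valid pt ℓ S → 0ℚ < ℓ · pt p → g · pt p ≡ 0ℚ →
      (∀ {v} → v ∈ zeros ℓ S → g · pt v ≡ 0ℚ) → (∃[ q ] q ∈ S × g · pt q < 0ℚ) → Result ℓ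
    go n ℓ len valid 0<p with ∀⊎∃ (λ q → span? pt (p ∷ zeros ℓ S) (pt q)) S
    ... | inj₁ spans = ℓ , (valid , 0<p , spans) , λ _ z → z
    ... | inj₂ (q , q∈ , ¬span) with span-separation pt (p ∷ zeros ℓ S) (pt q)
    ... | inj₁ span = ⊥-elim (¬span span)
    ... | inj₂ (h , vanish , hq≢0) with 0ℚ ≤? h · pt q
    ... | no ¬p = tilt n ℓ h len valid 0<p (vanish (here refl)) (vanish ∘ there) (q , q∈ , ≰⇒> ¬p)
    -- The sign is chosen to make the functional negative somewhere on S, which is what the ratio
    -- test needs.
    ... | yes p = tilt n ℓ (- 1ℚ ∙ h) len valid 0<p (neg-vanish (vanish (here refl)))
        (neg-vanish ∘ vanish ∘ there)
            (q , q∈ , subst (_< 0ℚ) (sym (neg-· (pt q))) (0<⇒-<0 (≤∧≢⇒< p (hq≢0 ∘ sym))))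
      where
      neg-· : ∀ x → (- 1ℚ ∙ h) · x ≡ - (h · x)
      neg-· x = trans (·-comm (- 1ℚ ∙ h) x)
          (trans (·-∙ʳ x (- 1ℚ) h) (trans (lem (x · h)) (cong -_ (·-comm x h))))
        where
        lem : ∀ a → (- 1ℚ) * a ≡ - a
        lem = solve-∀ ℚ-ring
      neg-vanish : ∀ {x} → h · x ≡ 0ℚ → (- 1ℚ ∙ h) · x ≡ 0ℚ
      neg-vanish {x} e = trans (neg-· x) (cong -_ e)
    tilt n ℓ g len valid 0<p gp vanish (q , q∈ , gq<0)
      with ratio-test (λ v → ℓ · pt v) (λ v → g · pt v) S valid
    ... | inj₁ pos = ⊥-elim (<⇒≱ gq<0 (pos q∈))
    ... | inj₂ (q₀ , q₀∈ , gq₀ , ok) = continue n len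
      where
      -- ℓ′ vanishes at q₀ by construction, is valid on S because the ratio of q₀ is minimal, and is
      -- a positive multiple of ℓ at p because g vanishes there.
      ℓ′ : V d
      ℓ′ = (- (g · pt q₀)) ∙ ℓ ⊕ (ℓ · pt q₀) ∙ g
      ℓ′-· : ∀ v → ℓ′ · pt v ≡ (- (g · pt q₀)) * ℓ · pt v + ℓ · pt q₀ * g · pt v
      ℓ′-· v = ·-lin₂ˡ (- (g · pt q₀)) ℓ (ℓ · pt q₀) g (pt v)
      valid′ : Valid pt ℓ′ S
      valid′ {v} m = subst (0ℚ ≤_) (sym (ℓ′-· v)) (ok m)
      lem : ∀ a b c → a * b + c * 0ℚ ≡ a * b
      lem = solve-∀ ℚ-ring
      0<p′ : 0ℚ < ℓ′ · pt p
      0<p′ = subst (0ℚ <_) (sym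
          (trans (ℓ′-· p) (trans (cong (λ t → (- (g · pt q₀)) * ℓ · pt p + ℓ · pt q₀ * t) gp)
        (lem (- (g · pt q₀)) (ℓ · pt p) (ℓ · pt q₀))))) (0<* (<0⇒0<- gq₀) 0<p)
      keep : ∀ {v} → v ∈ S → ℓ · pt v ≡ 0ℚ → ℓ′ · pt v ≡ 0ℚ
      keep {v} m z = trans (ℓ′-· v)
          (trans (cong₂ (λ s t → (- (g · pt q₀)) * s + ℓ · pt q₀ * t) z (vanish (∈-filter⁺ (zero? ℓ) m z)))
        (lem′ (- (g · pt q₀)) (ℓ · pt q₀)))
        where
        lem′ : ∀ a c → a * 0ℚ + c * 0ℚ ≡ 0ℚ
        lem′ = solve-∀ ℚ-ring
      new : ℓ′ · pt q₀ ≡ 0ℚ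
      new = trans (ℓ′-· q₀) (lem′ (g · pt q₀) (ℓ · pt q₀))
        where
        lem′ : ∀ g l → (- g) * l + l * g ≡ 0ℚ
        lem′ = solve-∀ ℚ-ring
      -- q₀ is a new zero: g is negative at q₀ but vanishes on all zeros of ℓ. The support of the
      -- functional is therefore the termination measure.
      smaller : length (support ℓ′) ℕ.< length (support ℓ)
      smaller = filter-shrinks-strictly (nonzero? ℓ′) (nonzero? ℓ) S (λ m nz z → nz (keep m z)) q₀∈
        (λ z → <⇒≢ gq₀ (vanish (∈-filter⁺ (zero? ℓ) q₀∈ z))) (λ nz → nz new)
      continue : ∀ n → length (support ℓ) ℕ.≤ n → Result ℓ
      continue zero len = ⊥-elim (ℕ.n≮0 (ℕ.<-≤-trans smaller len))
      continue (suc n) len =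
        let ℓ″ , facet , keep′ = go n ℓ′ (ℕ.≤-pred (ℕ.≤-trans smaller len)) valid′ 0<p′
        in ℓ″ , facet , λ m z → keep′ m (keep m z)

module _ {d : ℕ} (w : V d) where

  level-valid : ∀ {S} → Level1 w S → Valid pt w S
  level-valid l m = subst (0ℚ ≤_) (sym (l m)) (<⇒≤ 0<1)

  opaque
    -- Going from b in direction -p, the first inequality of the cone to become tight is h₀, at s =
    -- (h₀ · b) / (h₀ · p). The list from `minkowski-weyl` may contain inequalities that define no
    -- facet, so h₀ is tilted to one.
    ray-shooting : ∀ {S p b} → Level1 w S → p ∈ S → Comb pt NN S b →
      ∃[ ℓ ] ∃[ s ] Facet S p ℓ × 0ℚ ≤ s × Comb pt NN S (b ⊖ s ∙ pt p) × ℓ · (b ⊖ s ∙ pt p) ≡ 0ℚ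
    ray-shooting {S} {p} {b} l p∈ cb with minkowski-weyl pt S
    ... | H , valid , complete with ratio-test (λ h → h · b) (λ h → - (h · pt p)) H
        (λ m → comb-nonneg _ id (valid m) cb)
    -- If no inequality stopped the ray, -p would lie in the cone, although its level is -1.
    ... | inj₁ pos = ⊥-elim (<⇒≱ (0<⇒-<0 0<1) (subst (0ℚ ≤_)
            (trans (·-⊖ʳ w 0v (pt p)) (trans (cong₂ _-_ (·-zeroʳ w) (l p∈)) (+-identityˡ (- 1ℚ))))
            (comb-nonneg w id (level-valid l) (complete (0v ⊖ pt p) λ {h} m →
              subst (0ℚ ≤_) (sym (trans (·-⊖ʳ h 0v (pt p))
                  (trans (cong (_- h · pt p) (·-zeroʳ h)) (+-identityˡ _)))) (pos m)))))
    ... | inj₂ (h₀ , h₀∈ , h₀p , ok) = finish (extend-to-facet h₀ p∈ (valid h₀∈) 0<h₀p)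
      where
      0<h₀p : 0ℚ < h₀ · pt p
      0<h₀p = subst (0ℚ <_) (neg-neg (h₀ · pt p)) (<0⇒0<- h₀p)
      r : ∃[ r ] 0ℚ < r × r * h₀ · pt p ≡ 1ℚ
      r = inv-pos 0<h₀p
      s : ℚ
      s = proj₁ r * h₀ · b
      x : V d
      x = b ⊖ s ∙ pt p
      ·x : ∀ h → h · x ≡ proj₁ r * ((- (- (h₀ · pt p))) * h · b + h₀ · b * (- (h · pt p)))
      ·x h = trans (·-⊖ʳ h b (s ∙ pt p)) (trans (cong (λ t → h · b - t) (·-∙ʳ h s (pt p)))
        (trans (cong (_- s * h · pt p)
            (trans (sym (*-identityˡ (h · b))) (cong (_* h · b) (sym (proj₂ (proj₂ r))))))
          (lem (proj₁ r) (h₀ · pt p) (h · b) (h₀ · b) (h · pt p))))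
        where
        lem : ∀ r p b b₀ q → r * p * b - r * b₀ * q ≡ r * ((- (- p)) * b + b₀ * (- q))
        lem = solve-∀ ℚ-ring
      cx : Comb pt NN S x
      cx = complete x λ {h} m → subst (0ℚ ≤_) (sym (·x h)) (0≤* (<⇒≤ (proj₁ (proj₂ r))) (ok m))
      h₀x : h₀ · x ≡ 0ℚ
      h₀x = trans (·x h₀) (lem (proj₁ r) (h₀ · pt p) (h₀ · b))
        where
        lem : ∀ r p b → r * ((- (- p)) * b + b * (- p)) ≡ 0ℚ
        lem = solve-∀ ℚ-ring
      Goal : Set
      Goal = ∃[ ℓ ] ∃[ s ] Facet S p ℓ × 0ℚ ≤ s × Comb pt NN S (b ⊖ s ∙ pt p) × ℓ · (b ⊖ s ∙ pt p) ≡ 0ℚ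
      finish : (∃[ ℓ ] Facet S p ℓ × (∀ {v} → v ∈ S → h₀ · pt v ≡ 0ℚ → ℓ · pt v ≡ 0ℚ)) → Goal
      finish (ℓ , facet , keep) = ℓ , s , facet , 0≤* (<⇒≤ (proj₁ (proj₂ r)))
          (comb-nonneg h₀ id (valid h₀∈) cb) , cx ,
        -- b - s p is a combination of zeros of h₀ alone, and these are zeros of ℓ.
        comb-vanish ℓ (λ m → keep (proj₁ (∈-filter⁻ (zero? h₀) {xs = S} m))
            (proj₂ (∈-filter⁻ (zero? h₀) {xs = S} m)))
          (face-comb {F = zeros h₀ S} id (valid h₀∈) (zeros-face h₀ S) h₀x cx)

-- A valid inequality 0 ≤ ℓ · x is c · x ≤ 0 with c = −ℓ.
outer : ∀ {d} → V d → Vec ℚ d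
outer ℓ = Vec.tabulate (λ i → - ℓ i)

dotℚ-outer : ∀ {d} (ℓ : V d) q → dotℚ (outer ℓ) (toℚv q) ≡ - (ℓ · pt q)
dotℚ-outer ℓ q = trans (dotℚ-· (outer ℓ) q)
    (trans (·-linˡ (pt q) (- 1ℚ) ℓ 0v λ i → trans (lookup∘tabulate (λ i → - ℓ i) i) (lem (ℓ i)))
  (trans (cong (λ t → (- 1ℚ) * ℓ · pt q + t) (trans (·-comm 0v (pt q)) (·-zeroʳ (pt q))))
      (sym (lem (ℓ · pt q)))))
  where
  lem : ∀ x → - x ≡ (- 1ℚ) * x + 0ℚ
  lem = solve-∀ ℚ-ring

facet : ∀ {d} → V d → List (Pt d) → List (Pt d)
facet ℓ = onHyperplane (outer ℓ) 0ℚ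

module _ {d : ℕ} (ℓ : V d) where

  outer≡0⇒ : ∀ {q} → dotℚ (outer ℓ) (toℚv q) ≡ 0ℚ → ℓ · pt q ≡ 0ℚ
  outer≡0⇒ {q} e = trans (sym (neg-neg (ℓ · pt q))) (cong -_ (trans (sym (dotℚ-outer ℓ q)) e))

  ⇒outer≡0 : ∀ {q} → ℓ · pt q ≡ 0ℚ → dotℚ (outer ℓ) (toℚv q) ≡ 0ℚ
  ⇒outer≡0 {q} e = trans (dotℚ-outer ℓ q) (cong -_ e)

  onFacet? : Decidable (λ q → dotℚ (outer ℓ) (toℚv q) ≡ 0ℚ)
  onFacet? q = dotℚ (outer ℓ) (toℚv q) ℚ.≟ 0ℚ

  facet-face : ∀ T → Face ℓ (facet ℓ T) T
  facet-face T = proj₁ ∘ on⁻ , outer≡0⇒ ∘ proj₂ ∘ on⁻ , λ m z → ∈-filter⁺ onFacet? m (⇒outer≡0 z)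
    where
    on⁻ : ∀ {v} → v ∈ facet ℓ T → v ∈ T × dotℚ (outer ℓ) (toℚv v) ≡ 0ℚ
    on⁻ = ∈-filter⁻ onFacet?

  outer-valid : ∀ {S} → Valid pt ℓ S → All (λ q → dotℚ (outer ℓ) (toℚv q) ≤ 0ℚ) S
  outer-valid valid = All.tabulate λ {q} m → subst (_≤ 0ℚ) (sym (dotℚ-outer ℓ q)) (0≤⇒-≤0 (valid m))

level-span-[] : ∀ {d} (w : V d) F → Level1 w F → (∀ {v} → v ∈ F → Span pt [] (pt v)) → F ≡ []
level-span-[] w [] _ _ = refl
level-span-[] w (v ∷ _) l s =
  ⊥-elim (1≢0 (trans (sym (l (here refl))) (trans (·-congʳ w (comb-[] (s (here refl)))) (·-zeroʳ w))))

module _ {d : ℕ} (w : V d) where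

  opaque
    -- Adding p to a basis of the facet gives a basis of everything. `AffDim` holds for no k on the
    -- empty list, hence the nonemptiness premise.
    facet-dims : ∀ {p S} ℓ → Level1 w (p ∷ S) → 0ℚ < ℓ · pt p →
      (∀ {q} → q ∈ p ∷ S → Span pt (p ∷ facet ℓ S) (pt q)) → ¬ (facet ℓ S ≡ []) →
      ∃[ k ] AffDim (p ∷ S) (suc k) × AffDim (facet ℓ S) k
    facet-dims {p} {S} ℓ l 0<p spans nonempty = go (basis pt F)
      where
      F : List (Pt d)
      F = facet ℓ S
      F⊆S : ∀ {v} → v ∈ F → v ∈ S
      F⊆S = proj₁ (facet-face ℓ S)
      levelF : Level1 w F
      levelF = l ∘ there ∘ F⊆S
      go : (∃[ B ] B ⊆ F × Indep pt B × (∀ {v} → v ∈ F → Span pt B (pt v))) → ∃[ k ] AffDim (p ∷ S)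
          (suc k) × AffDim F k
      go ([] , _ , _ , spansF) = ⊥-elim (nonempty (level-span-[] w F levelF spansF))
      go (B@(b₀ ∷ B₁) , B⊆F , indB , spansF) = length B₁ ,
        ((p ∷ B , refl ∷ ⊆-trans B⊆F (filter-⊆ (onFacet? ℓ) S) , Indep⇒AffIndep w (p ∷ B)
            (¬p , indB) , refl) ,
         λ T T⊆ aff → indep-length pt T (p ∷ B) (AffIndep⇒Indep w T (l ∘ Sublist.lookup T⊆) aff)
           (λ m → comb-trans inB (spans (Sublist.lookup T⊆ m)))) ,
        ((B , B⊆F , Indep⇒AffIndep w B indB , refl) ,
         λ T T⊆ aff → indep-length pt T B (AffIndep⇒Indep w T (levelF ∘ Sublist.lookup T⊆) aff)
             (λ m → spansF (Sublist.lookup T⊆ m)))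
        where
        ¬p : ¬ Span pt B (pt p)
        ¬p c = <-irrefl (sym (comb-vanish ℓ (proj₁ (proj₂ (facet-face ℓ S)) ∘ Sublist.lookup B⊆F) c)) 0<p
        inB : ∀ {v} → v ∈ p ∷ F → Span pt (p ∷ B) (pt v)
        inB (here refl) = comb-∈ (here refl)
        inB (there m) = comb-skip (spansF m)

  same-line : ∀ {p q} → w · pt p ≡ 1ℚ → w · pt q ≡ 1ℚ → Span pt (p ∷ []) (pt q) → q ≡ p
  same-line {p} {q} wp wq (cons a y _ (nil y≈0) e) = pt-injective λ i → trans (q≈ i)
      (trans (cong (_* pt p i) a≡1) (*-identityˡ (pt p i)))
    where
    q≈ : pt q ≈ a ∙ pt p
    q≈ i = trans (e i) (trans (cong (λ t → a * pt p i + t) (y≈0 i)) (+-identityʳ _))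
    a≡1 : a ≡ 1ℚ
    a≡1 = trans (sym (trans (cong (a *_) wp) (*-identityʳ a)))
        (trans (sym (·-∙ʳ w a (pt p))) (trans (sym (·-congʳ w q≈)) wq))

  facet-nonempty : ∀ {p q S} ℓ → w · pt p ≡ 1ℚ → w · pt q ≡ 1ℚ → ¬ (q ≡ p) → Span pt (p ∷ facet ℓ S) (pt q)
      → ¬ (facet ℓ S ≡ [])
  facet-nonempty {p} ℓ wp wq q≢p c empty = q≢p (same-line wp wq (subst (λ F → Span pt (p ∷ F) _) empty c))

  opaque
    pulled-simplex : ∀ F → Unique F → Level1 w F →
      ∃[ τ ] PullSimplex F τ × Indep pt τ × (∀ {v} → v ∈ τ → v ∈ F) × (∀ {v} → v ∈ F → Span pt τ (pt v))
    pulled-simplex F = go (length F) F ℕ.≤-refl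
      where
      Result : List (Pt d) → Set
      Result F = ∃[ τ ] PullSimplex F τ × Indep pt τ × (∀ {v} → v ∈ τ → v ∈ F) ×
          (∀ {v} → v ∈ F → Span pt τ (pt v))
      go : ∀ n F → length F ℕ.≤ n → Unique F → Level1 w F → Result F
      go n F len uniq l with indep? pt F
      ... | yes ind = F , pull-simplex (Indep⇒AffIndep w F ind) , ind , id , comb-∈
      go n [] len uniq l | no dep = ⊥-elim (dep tt)
      go n (p ∷ []) len uniq l | no dep = ⊥-elim
          (dep ((λ { (nil e) → 1≢0 (trans (sym (l (here refl))) (trans (·-congʳ w e) (·-zeroʳ w))) }) , tt))
      go (suc n) (p ∷ F₁@(q ∷ F₂)) len ((p≢q All.∷ _) ∷ uniq) l | no dep =
        -- w is valid with no zeros on the list, so tilting starts from the empty face and ends at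
        -- some facet that avoids p. Uniqueness makes q differ from p, so this facet is not empty.
        cone (extend-to-facet w (here refl) (level-valid w l) (subst (0ℚ <_) (sym (l (here refl))) 0<1))
        where
        cone : (∃[ ℓ ] Facet (p ∷ F₁) p ℓ × (∀ {v} → v ∈ p ∷ F₁ → w · pt v ≡ 0ℚ → ℓ · pt v ≡ 0ℚ)) → Result
            (p ∷ F₁)
        cone (ℓ , (valid , 0<p , spans) , _) =
          let k , dimF , dimZ = facet-dims ℓ l 0<p spans′
                (facet-nonempty ℓ (l (here refl)) (l (there (here refl))) (p≢q ∘ sym)
                    (spans′ (there (here refl))))
              τ , pull , indτ , τ⊆ , spansτ = go n Z
                  (ℕ.≤-trans (length-filter (onFacet? ℓ) F₁) (ℕ.≤-pred len))
                  (Unique.filter⁺ (onFacet? ℓ) uniq) (l ∘ there ∘ Z⊆)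
          in p ∷ τ ,
             pull-cone (outer ℓ) 0ℚ k (dep ∘ AffIndep⇒Indep w (p ∷ F₁) l) (outer-valid ℓ valid)
               (λ e → <-irrefl (sym (outer≡0⇒ ℓ {p} e)) 0<p) dimF dimZ pull ,
             ((λ c → <-irrefl (sym (comb-vanish ℓ (zeroZ ∘ τ⊆) c)) 0<p) , indτ) ,
             (λ { (here refl) → here refl ; (there m) → there (Z⊆ (τ⊆ m)) }) ,
             λ v∈ → comb-trans (λ { (here refl) → comb-∈ (here refl) ; (there m) → comb-skip (spansτ m) })
                 (spans′ v∈)
          where
          Z : List (Pt d)
          Z = facet ℓ F₁
          Z⊆ : ∀ {v} → v ∈ Z → v ∈ F₁
          Z⊆ = proj₁ (facet-face ℓ F₁)
          zeroZ : ∀ {v} → v ∈ Z → ℓ · pt v ≡ 0ℚ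
          zeroZ = proj₁ (proj₂ (facet-face ℓ F₁))
          inZ : ∀ {v} → v ∈ p ∷ F₁ × ℓ · pt v ≡ 0ℚ → v ∈ Z
          inZ (here refl , z) = ⊥-elim (<-irrefl (sym z) 0<p)
          inZ (there m , z) = proj₂ (proj₂ (facet-face ℓ F₁)) m z
          spans′ : ∀ {v} → v ∈ p ∷ F₁ → Span pt (p ∷ Z) (pt v)
          spans′ v∈ = comb-⊆ (λ { (here refl) → here refl ; (there m) → there (inZ (∈-filter⁻ (zero? ℓ) m)) })
              (spans v∈)

-- Comparing two simplices over the same facet

module _ {d : ℕ} (w : V d) where

  Indep-swap : ∀ (p t : Pt d) {ts} → Indep pt (p ∷ t ∷ ts) → Indep pt (t ∷ p ∷ ts)
  Indep-swap p t {ts} (¬p , ¬t , ind) = ¬t′ , ¬p ∘ comb-skip , ind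
    where
    ¬t′ : ¬ Span pt (p ∷ ts) (pt t)
    ¬t′ (cons a y _ c e) = cases (a ℚ.≟ 0ℚ)
      where
      cases : Dec (a ≡ 0ℚ) → ⊥
      cases (yes a≡0) = ¬t (comb-≈ (λ i → sym (trans (e i) (trans (cong (λ s → s * pt p i + y i) a≡0)
        (trans (cong (_+ y i) (*-zeroˡ (pt p i))) (+-identityˡ (y i)))))) c)
      cases (no a≢0) = ¬p (comb-≈ p≈ (comb-∙ {a = proj₁ r} tt (comb-⊖ tt (comb-∈ (here refl)) (comb-skip c))))
        where
        r : ∃[ r ] r * a ≡ 1ℚ
        r = inv a a≢0
        lem : ∀ r a p y → r * (a * p + y - y) ≡ r * a * p
        lem = solve-∀ ℚ-ring
        p≈ : proj₁ r ∙ (pt t ⊖ y) ≈ pt p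
        p≈ i = trans (cong (λ s → proj₁ r * (s - y i)) (e i)) (trans (lem (proj₁ r) a (pt p i) (y i))
          (trans (cong (_* pt p i) (proj₂ r)) (*-identityˡ (pt p i))))

  -- `gram` takes its edges from the first vertex. Each order generates the same lattice, so
  -- `gram-minimal` applies both ways; the base point can thus be moved from the apex to a vertex of
  -- the facet.
  gram-swap : ∀ {p t ts} → Level1 w (p ∷ t ∷ ts) → Indep pt (p ∷ t ∷ ts) → gram (p ∷ t ∷ ts) ≡ gram
      (t ∷ p ∷ ts)
  gram-swap {p} {t} {ts} l ind = ℤ.≤-antisym
    (gram-minimal w (p ∷ t ∷ ts) (t ∷ p ∷ ts) l (l ∘ swapped) refl (Indep⇒AffIndep w _ (Indep-swap p t ind))
        (comb-∈ ∘ swapped))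
    (gram-minimal w (t ∷ p ∷ ts) (p ∷ t ∷ ts) (l ∘ swapped) l refl (Indep⇒AffIndep w _ ind)
        (comb-∈ ∘ swapped))
    where
    swapped : ∀ {p t v : Pt d} → v ∈ p ∷ t ∷ ts → v ∈ t ∷ p ∷ ts
    swapped (here e) = there (here e)
    swapped (there (here e)) = here e
    swapped (there (there m)) = there (there m)

  -- Seen from the common vertex t the two simplices differ in one edge, and q - t is s (p - t) plus
  -- z + s t - t, which has level 0 and hence is a combination of edges of the facet.
  gram-apex : ∀ {p q t ts} s z → Level1 w (p ∷ q ∷ t ∷ ts) → pt q ≈ s ∙ pt p ⊕ z → Span pt (t ∷ ts) z →
    toℚ (gram (t ∷ q ∷ ts)) ≡ s * s * toℚ (gram (t ∷ p ∷ ts))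
  gram-apex {p} {q} {t} {ts} s z l e c = trans (toℚ-gram t (q ∷ ts))
    (trans (Gram-scale s (pt (p -ᵥ t)) z′ (edges t ts) q-t≈ (edge-comb w t ts (l ∘ there ∘ there) wz′
      (comb-⊖ tt (comb-+ c (comb-∙ {a = s} tt (comb-∈ (here refl)))) (comb-∈ (here refl)))))
      (cong (s * s *_) (sym (toℚ-gram t (p ∷ ts)))))
    where
    z′ : V d
    z′ = (z ⊕ s ∙ pt t) ⊖ pt t
    q-t≈ : pt (q -ᵥ t) ≈ s ∙ pt (p -ᵥ t) ⊕ z′
    q-t≈ i = trans (pt--ᵥ q t i) (trans (cong (_- pt t i) (e i)) (trans (lem s (pt p i) (z i) (pt t i))
      (cong (λ x → s * x + z′ i) (sym (pt--ᵥ p t i)))))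
      where
      lem : ∀ s p z t → s * p + z - t ≡ s * (p - t) + (z + s * t - t)
      lem = solve-∀ ℚ-ring
    wz : s + w · z ≡ 1ℚ
    wz = trans (cong (_+ w · z) (sym (trans (cong (s *_) (l (here refl))) (*-identityʳ s))))
      (trans (sym (·-linʳ w s (pt p) z e)) (l (there (here refl))))
    wz′ : w · z′ ≡ 0ℚ
    wz′ = trans (·-⊖ʳ w (z ⊕ s ∙ pt t) (pt t))
        (trans (cong₂ _-_ (trans (·-⊕ʳ w z (s ∙ pt t)) (cong (λ x → w · z + x)
      (trans (·-∙ʳ w s (pt t)) (trans (cong (s *_) wt) (*-identityʳ s))))) wt)
      (trans (cong (_- 1ℚ) (trans (+-comm (w · z) s) wz)) (+-inverseʳ 1ℚ)))
      where
      wt : w · pt t ≡ 1ℚ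
      wt = l (there (there (here refl)))

  apex-unique : ∀ {p q τ} s z → 0ℚ < s → Level1 w (p ∷ q ∷ τ) → ¬ (τ ≡ []) → Indep pt (p ∷ τ) → Indep pt
      (q ∷ τ) →
    pt q ≈ s ∙ pt p ⊕ z → Span pt τ z → gram (p ∷ τ) ≡ gram (q ∷ τ) → s ≡ 1ℚ
  apex-unique {τ = []} _ _ _ _ τ≢[] = ⊥-elim (τ≢[] refl)
  apex-unique {p} {q} {t ∷ ts} s z 0<s l _ indp indq e c same = cases
      (*-zero-cases {s - 1ℚ} {(s + 1ℚ) * G} product≡0)
    where
    G : ℚ
    G = toℚ (gram (t ∷ p ∷ ts))
    0<G : 0ℚ < G
    0<G = subst (0ℚ <_) (sym (toℚ-gram t (p ∷ ts)))
        (Gram-positive (edges t (p ∷ ts))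
        (Indep-map (map (_-ᵥ t) (p ∷ ts)) (Indep-unshift w t (p ∷ ts) (Indep-swap p t indp))))
    lp : Level1 w (p ∷ t ∷ ts)
    lp (here refl) = l (here refl)
    lp (there m) = l (there (there m))
    G≡ : G ≡ s * s * G
    G≡ = trans (cong toℚ (trans (sym (gram-swap lp indp)) (trans same (gram-swap (l ∘ there) indq))))
      (gram-apex s z l e c)
    product≡0 : (s - 1ℚ) * ((s + 1ℚ) * G) ≡ 0ℚ
    product≡0 = trans (lem s G) (trans (cong (λ t → s * s * G - t) G≡) (+-inverseʳ (s * s * G)))
      where
      lem : ∀ s g → (s - 1ℚ) * ((s + 1ℚ) * g) ≡ s * s * g - g
      lem = solve-∀ ℚ-ring
    cases : s - 1ℚ ≡ 0ℚ ⊎ (s + 1ℚ) * G ≡ 0ℚ → s ≡ 1ℚ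
    cases (inj₁ z) = trans (lem s) (trans (cong (_+ 1ℚ) z) (+-identityˡ 1ℚ))
      where
      lem : ∀ s → s ≡ s - 1ℚ + 1ℚ
      lem = solve-∀ ℚ-ring
    cases (inj₂ z) = ⊥-elim (<-irrefl (sym z) (0<* (+-mono-< 0<s 0<1) 0<G))

_≟ₚ_ : ∀ {d} (p q : Pt d) → Dec (p ≡ q)
_≟ₚ_ = ≡-dec ℤ._≟_

-- For two points p, q off the facet of ℓ, orderings starting with p, q and with q, p share a simplex τ of the
-- facet; p ∷ τ and q ∷ τ both have minimal volume, so p and q lie at the same height ℓ.
module TwoLevel {d n : ℕ} (A : Mat d n) (w : V d) (level : Level1 w (toList A)) (compressed : Compressed A)
                (S : List (Pt d)) (ord : IsOrdering A S) where

  levelS : Level1 w S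
  levelS {p} m = InPA⇒level A w level (proj₁ (proj₁ (proj₂ ord p) m))

  module _ {p q : Pt d} (p∈ : p ∈ S) (q∈ : q ∈ S) (p≢q : ¬ (p ≡ q)) {ℓ : V d} (ℓ-facet : Facet S p ℓ)
      (0<q : 0ℚ < ℓ · pt q) where

    valid : Valid pt ℓ S
    valid = proj₁ ℓ-facet
    0<p : 0ℚ < ℓ · pt p
    0<p = proj₁ (proj₂ ℓ-facet)

    other? : Decidable (λ (v : Pt d) → ¬ (v ≡ p) × ¬ (v ≡ q))
    other? v = ¬? (v ≟ₚ p) ×-dec ¬? (v ≟ₚ q)

    R : List (Pt d)
    R = filter other? S

    R⁻ : ∀ {v} → v ∈ R → v ∈ S × ¬ (v ≡ p) × ¬ (v ≡ q)
    R⁻ = ∈-filter⁻ other?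

    F : List (Pt d)
    F = facet ℓ R

    F⊆R : ∀ {v} → v ∈ F → v ∈ R
    F⊆R = proj₁ (facet-face ℓ R)

    zeroF : ∀ {v} → v ∈ F → ℓ · pt v ≡ 0ℚ
    zeroF = proj₁ (proj₂ (facet-face ℓ R))

    inF : ∀ {v} → v ∈ S → ℓ · pt v ≡ 0ℚ → v ∈ F
    inF v∈ z = proj₂ (proj₂ (facet-face ℓ R)) (∈-filter⁺ other? v∈
      ((λ { refl → <-irrefl (sym z) 0<p }) , λ { refl → <-irrefl (sym z) 0<q })) z

    spans-p : ∀ {v} → v ∈ S → Span pt (p ∷ F) (pt v)
    spans-p v∈ = comb-⊆ (λ { (here refl) → here refl ; (there m) → there
        (let v∈ , z = ∈-filter⁻ (zero? ℓ) {xs = S} m in inF v∈ z) })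
      (proj₂ (proj₂ ℓ-facet) v∈)

    -- s is the quotient of the heights of q and p over the facet; the aim is s = 1.
    q-split : ∃[ s ] ∃[ z ] Span pt F z × pt q ≈ s ∙ pt p ⊕ z
    q-split with spans-p q∈
    ... | cons s z _ c e = s , z , c , e

    s : ℚ
    s = proj₁ q-split
    z : V d
    z = proj₁ (proj₂ q-split)
    z∈ : Span pt F z
    z∈ = proj₁ (proj₂ (proj₂ q-split))
    q≈ : pt q ≈ s ∙ pt p ⊕ z
    q≈ = proj₂ (proj₂ (proj₂ q-split))

    ℓq : ℓ · pt q ≡ s * ℓ · pt p
    ℓq = trans (·-linʳ ℓ s (pt p) z q≈)
        (trans (cong (λ t → s * ℓ · pt p + t) (comb-vanish ℓ zeroF z∈)) (+-identityʳ _))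

    0<s : 0ℚ < s
    0<s = 0<*-cancelˡ (<⇒≤ 0<p) (subst (0ℚ <_) (trans ℓq (*-comm s (ℓ · pt p))) 0<q)

    p∈q : Span pt (q ∷ F) (pt p)
    p∈q = comb-≈ p≈ (comb-∙ {a = proj₁ r} tt (comb-⊖ tt (comb-∈ (here refl)) (comb-skip z∈)))
      where
      r : ∃[ r ] r * s ≡ 1ℚ
      r = inv s (λ e → <-irrefl (sym e) 0<s)
      lem : ∀ r a p y → r * (a * p + y - y) ≡ r * a * p
      lem = solve-∀ ℚ-ring
      p≈ : proj₁ r ∙ (pt q ⊖ z) ≈ pt p
      p≈ i = trans (cong (λ t → proj₁ r * (t - z i)) (q≈ i)) (trans (lem (proj₁ r) s (pt p i) (z i))
        (trans (cong (_* pt p i) (proj₂ r)) (*-identityˡ (pt p i))))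

    spans-q : ∀ {v} → v ∈ S → Span pt (q ∷ F) (pt v)
    spans-q v∈ = comb-trans (λ { (here refl) → p∈q ; (there m) → comb-skip (comb-∈ m) }) (spans-p v∈)

    F-nonempty : ¬ (F ≡ [])
    F-nonempty = facet-nonempty w {S = R} ℓ (levelS p∈) (levelS q∈) (p≢q ∘ sym) (spans-p q∈)

    uniqueR : Unique R
    uniqueR = Unique.filter⁺ other? (proj₁ ord)

    levelF : Level1 w F
    levelF = levelS ∘ proj₁ ∘ R⁻ ∘ F⊆R

    simplex : ∃[ τ ] PullSimplex F τ × Indep pt τ × (∀ {v} → v ∈ τ → v ∈ F) ×
        (∀ {v} → v ∈ F → Span pt τ (pt v))
    simplex = pulled-simplex w F (Unique.filter⁺ (onFacet? ℓ) uniqueR) levelF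

    τ : List (Pt d)
    τ = proj₁ simplex
    τ⊆F : ∀ {v} → v ∈ τ → v ∈ F
    τ⊆F = proj₁ (proj₂ (proj₂ (proj₂ simplex)))
    spansτ : ∀ {v} → v ∈ F → Span pt τ (pt v)
    spansτ = proj₂ (proj₂ (proj₂ (proj₂ simplex)))

    τ-nonempty : ¬ (τ ≡ [])
    τ-nonempty τ≡[] = F-nonempty (level-span-[] w F levelF (λ m → subst (λ τ → Span pt τ _) τ≡[] (spansτ m)))

    module Pull {a b : Pt d} (a∈ : a ∈ S) (b∈ : b ∈ S) (a≢b : ¬ (a ≡ b)) (0<a : 0ℚ < ℓ · pt a)
        (0<b : 0ℚ < ℓ · pt b)
                (R-off : ∀ {v} → v ∈ R → ¬ (v ≡ a) × ¬ (v ≡ b))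
                    (R-all : ∀ {v} → v ∈ S → ¬ (v ≡ a) → ¬ (v ≡ b) → v ∈ R)
                (spans-a : ∀ {v} → v ∈ S → Span pt (a ∷ F) (pt v))
                    (spans-b : ∀ {v} → v ∈ S → Span pt (b ∷ F) (pt v)) where

      S′ : List (Pt d)
      S′ = a ∷ b ∷ R

      S′⊆S : ∀ {v} → v ∈ S′ → v ∈ S
      S′⊆S (here refl) = a∈
      S′⊆S (there (here refl)) = b∈
      S′⊆S (there (there m)) = proj₁ (R⁻ m)

      S⊆S′ : ∀ {v} → v ∈ S → v ∈ S′
      S⊆S′ {v} v∈ = cases (v ≟ₚ a) (v ≟ₚ b)
        where
        cases : Dec (v ≡ a) → Dec (v ≡ b) → v ∈ S′
        cases (yes e) _ = here e
        cases (no _) (yes e) = there (here e)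
        cases (no ¬a) (no ¬b) = there (there (R-all v∈ ¬a ¬b))

      ordering : IsOrdering A S′
      ordering = ((a≢b All.∷ All.tabulate λ m e → proj₁ (R-off m) (sym e)) ∷
          (All.tabulate λ m e → proj₂ (R-off m) (sym e)) ∷ uniqueR) ,
        λ v → (λ m → proj₁ (proj₂ ord v) (S′⊆S m)) , λ m → S⊆S′ (proj₂ (proj₂ ord v) m)

      -- The second point is off the facet and is dropped by the filter, so both orderings induce
      -- the same list F and can share τ.
      facet≡ : facet ℓ (b ∷ R) ≡ F
      facet≡ = filter-reject (onFacet? ℓ) (λ e → <-irrefl (sym (outer≡0⇒ ℓ {b} e)) 0<b)

      dims : ∃[ k ] AffDim S′ (suc k) × AffDim F k
      dims = subst (λ Z → ∃[ k ] AffDim S′ (suc k) × AffDim Z k) facet≡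
        (facet-dims w {a} {b ∷ R} ℓ (levelS ∘ S′⊆S) 0<a
          (λ {v} m → subst (λ Z → Span pt (a ∷ Z) (pt v)) (sym facet≡) (spans-a (S′⊆S m)))
          (λ e → F-nonempty (trans (sym facet≡) e)))

      dependent : ¬ AffIndep S′
      dependent aff = proj₁ (AffIndep⇒Indep w S′ (levelS ∘ S′⊆S) aff)
        (comb-⊆ (λ { (here refl) → here refl ; (there m) → there (F⊆R m) }) (spans-b a∈))

      pull : PullSimplex S′ (a ∷ τ)
      pull = pull-cone (outer ℓ) 0ℚ (proj₁ dims) dependent (outer-valid ℓ (λ m → valid (S′⊆S m)))
        (λ e → <-irrefl (sym (outer≡0⇒ ℓ {a} e)) 0<a) (proj₁ (proj₂ dims))
        (subst (λ Z → AffDim Z (proj₁ dims)) (sym facet≡) (proj₂ (proj₂ dims)))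
        (subst (λ Z → PullSimplex Z τ) (sym facet≡) (proj₁ (proj₂ simplex)))

      indep : Indep pt (a ∷ τ)
      indep = (λ c → <-irrefl (sym (comb-vanish ℓ (zeroF ∘ τ⊆F) c)) 0<a) , proj₁ (proj₂ (proj₂ simplex))

      inPAL : All (InPAL A) (a ∷ τ)
      inPAL = All.tabulate λ { (here refl) → proj₁ (proj₂ ord a) a∈ ; (there m) → proj₁ (proj₂ ord _)
          (proj₁ (R⁻ (F⊆R (τ⊆F m)))) }

    R⁺ : ∀ {v} → v ∈ S → ¬ (v ≡ p) → ¬ (v ≡ q) → v ∈ R
    R⁺ v∈ ¬p ¬q = ∈-filter⁺ other? v∈ (¬p , ¬q)

    R⁺′ : ∀ {v} → v ∈ S → ¬ (v ≡ q) → ¬ (v ≡ p) → v ∈ R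
    R⁺′ v∈ ¬q ¬p = R⁺ v∈ ¬p ¬q

    R≢ : ∀ {v} → v ∈ R → ¬ (v ≡ p) × ¬ (v ≡ q)
    R≢ m = proj₂ (R⁻ m)

    R≢′ : ∀ {v} → v ∈ R → ¬ (v ≡ q) × ¬ (v ≡ p)
    R≢′ m = swap× (R≢ m)

    module Pull-p = Pull p∈ q∈ p≢q 0<p 0<q R≢ R⁺ spans-p spans-q
    module Pull-q = Pull q∈ p∈ (p≢q ∘ sym) 0<q 0<p R≢′ R⁺′ spans-q spans-p

    same-gram : gram (p ∷ τ) ≡ gram (q ∷ τ)
    same-gram = ℤ.≤-antisym
      (compressed Pull-p.S′ Pull-p.ordering (p ∷ τ) Pull-p.pull (q ∷ τ) Pull-q.inPAL
          (Indep⇒AffIndep w _ Pull-q.indep) refl)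
      (compressed Pull-q.S′ Pull-q.ordering (q ∷ τ) Pull-q.pull (p ∷ τ) Pull-p.inPAL
          (Indep⇒AffIndep w _ Pull-p.indep) refl)

    levels-agree : ℓ · pt q ≡ ℓ · pt p
    levels-agree = trans ℓq (trans (cong (_* ℓ · pt p)
      (apex-unique w s z 0<s lev τ-nonempty Pull-p.indep Pull-q.indep q≈ (comb-trans spansτ z∈) same-gram))
          (*-identityˡ _))
      where
      lev : Level1 w (p ∷ q ∷ τ)
      lev (here refl) = levelS p∈
      lev (there (here refl)) = levelS q∈
      lev (there (there m)) = levelF (τ⊆F m)

  two-level : ∀ {p q ℓ} → p ∈ S → q ∈ S → Facet S p ℓ → ℓ · pt q ≡ 0ℚ ⊎ ℓ · pt q ≡ ℓ · pt p
  two-level {p} {q} {ℓ} p∈ q∈ ℓ-facet = cases (ℓ · pt q ℚ.≟ 0ℚ) (p ≟ₚ q)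
    where
    cases : Dec (ℓ · pt q ≡ 0ℚ) → Dec (p ≡ q) → ℓ · pt q ≡ 0ℚ ⊎ ℓ · pt q ≡ ℓ · pt p
    cases (yes e) _ = inj₁ e
    cases (no _) (yes refl) = inj₂ refl
    cases (no ≢0) (no p≢q) = inj₂ (levels-agree p∈ q∈ p≢q ℓ-facet (≤∧≢⇒< (proj₁ ℓ-facet q∈) (≢0 ∘ sym)))

-- Enumerating integral solutions and lattice points

allVecs : ∀ {A : Set} → List A → ∀ n → List (Vec A n)
allVecs L zero = [] ∷ []
allVecs L (suc n) = cartesianProductWith _∷_ L (allVecs L n)

∈-allVecs : ∀ {A : Set} {L : List A} {n} (v : Vec A n) → (∀ j → lookup v j ∈ L) → v ∈ allVecs L n
∈-allVecs [] h = here refl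
∈-allVecs (x ∷ v) h = ∈-cartesianProductWith⁺ _∷_ (h zero) (∈-allVecs v (h ∘ suc))

maximum : ∀ {A : Set} (f : A → ℕ) {x₀} xs → x₀ ∈ xs → ∃[ x ] x ∈ xs × (∀ {y} → y ∈ xs → f y ℕ.≤ f x)
maximum f (x ∷ []) _ = x , here refl , λ { (here refl) → ℕ.≤-refl }
maximum f (x ∷ xs@(_ ∷ _)) _ with maximum f xs (here refl)
... | m , m∈ , max with f m ℕ.≤? f x
... | yes p = x , here refl , λ { (here refl) → ℕ.≤-refl ; (there y∈) → ℕ.≤-trans (max y∈) p }
... | no ¬p = m , there m∈ , λ { (here refl) → ℕ.<⇒≤ (ℕ.≰⇒> ¬p) ; (there y∈) → max y∈ }

sumℕ : ∀ {n} → Vec ℕ n → ℕ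
sumℕ = foldr _ ℕ._+_ 0

foldr-ℕtoℚ : ∀ {n} (y : Vec ℕ n) → foldr _ _+_ 0ℚ (Vec.map ℕtoℚ y) ≡ ℕtoℚ (sumℕ y)
foldr-ℕtoℚ [] = refl
foldr-ℕtoℚ (k ∷ y) = trans (cong (λ t → ℕtoℚ k + t) (foldr-ℕtoℚ y)) (sym (toℚ-+ (+ k) (+ sumℕ y)))

lookup≤sumℕ : ∀ {n} (y : Vec ℕ n) j → lookup y j ℕ.≤ sumℕ y
lookup≤sumℕ (k ∷ y) zero = ℕ.m≤m+n k (sumℕ y)
lookup≤sumℕ (k ∷ y) (suc j) = ℕ.≤-trans (lookup≤sumℕ y j) (ℕ.m≤n+m (sumℕ y) k)

module _ {d n : ℕ} (A : Mat d n) (w : V d) (level : Level1 w (toList A)) where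

  IP-sum : ∀ {b} y → IPFeasible A b y → ℕtoℚ (sumℕ y) ≡ w · pt b
  IP-sum {b} y e = trans (sym (foldr-ℕtoℚ y))
      (trans (sym (sum-w w A (Vec.map ℕtoℚ y) level)) (·-congʳ w (toℚv-≈ e)))

  -- Homogeneity bounds the search: every solution has coordinate sum w · b, which is the sum N of
  -- the given one, so its entries lie between 0 and N.
  IP-maximum : ∀ {b} i → IPFeasibleRHS A b →
    ∃[ y* ] IPFeasible A b y* × (∀ y → IPFeasible A b y → lookup y i ℕ.≤ lookup y* i)
  IP-maximum {b} i (y₀ , y₀-feasible) =
    let y* , y*∈ , max = maximum (λ y → lookup y i) solutions (complete y₀ y₀-feasible)
    in y* , proj₂ (∈-filter⁻ feasible? {xs = allVecs (upTo (suc N)) n} y*∈) , λ y e → max (complete y e)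
    where
    N : ℕ
    N = sumℕ y₀
    feasible? : Decidable (IPFeasible A b)
    feasible? y = ≡-dec ℚ._≟_ (mulℕ A y) (toℚv b)
    solutions : List (Vec ℕ n)
    solutions = filter feasible? (allVecs (upTo (suc N)) n)
    complete : ∀ y → IPFeasible A b y → y ∈ solutions
    complete y e = ∈-filter⁺ feasible? (∈-allVecs y λ j → ∈-upTo⁺ (ℕ.s≤s (subst (lookup y j ℕ.≤_)
      (ℤ.+-injective (toℚ-injective (trans (IP-sum y e) (sym (IP-sum y₀ y₀-feasible)))))
          (lookup≤sumℕ y j)))) e

entry-bound : ∀ {d} (p : Pt d) → ∃[ B ] (∀ i → ℤ.∣ lookup p i ∣ ℕ.≤ B)
entry-bound [] = 0 , λ ()
entry-bound (z ∷ p) = let B , h = entry-bound p in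
  ℤ.∣ z ∣ ℕ.⊔ B , λ { zero → ℕ.m≤m⊔n ℤ.∣ z ∣ B ; (suc i) → ℕ.≤-trans (h i) (ℕ.m≤n⊔m ℤ.∣ z ∣ B) }

entries-bound : ∀ {d} (T : List (Pt d)) → ∃[ B ] (∀ {p} → p ∈ T → ∀ i → ℤ.∣ lookup p i ∣ ℕ.≤ B)
entries-bound [] = 0 , λ ()
entries-bound (p ∷ T) = let B , h = entry-bound p ; C , k = entries-bound T in
  B ℕ.⊔ C , λ { (here refl) i → ℕ.≤-trans (h i) (ℕ.m≤m⊔n B C) ; (there m) i → ℕ.≤-trans (k m i)
      (ℕ.m≤n⊔m B C) }

-- A bound on the generators scales with the level. With c = ±1 and level 1 it confines the lattice
-- points of P_A to a box.
cone-bound : ∀ {d} (w : V d) {T x} → Level1 w T → Comb pt NN T x → ∀ i c B → (∀ {v} → v ∈ T → c * pt v i ≤ B)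
    → c * x i ≤ B * w · x
cone-bound w {x = x} l (nil e) i c B h = ≤-reflexive (trans (cong (c *_) (e i)) (trans (*-zeroʳ c)
  (sym (trans (cong (B *_) (trans (·-congʳ w e) (·-zeroʳ w))) (*-zeroʳ B)))))
cone-bound w {v ∷ T} {x} l (cons a y 0≤a cy e) i c B h = 0≤-⇒≤ (subst (0ℚ ≤_) eq
  (0≤+ (0≤* 0≤a (≤⇒0≤- (h (here refl)))) (≤⇒0≤- (cone-bound w (l ∘ there) cy i c B (h ∘ there)))))
  where
  lem : ∀ a B c v wy y → a * (B - c * v) + (B * wy - c * y) ≡ B * (a * 1ℚ + wy) - c * (a * v + y)
  lem = solve-∀ ℚ-ring
  eq : a * (B - c * pt v i) + (B * w · y - c * y i) ≡ B * w · x - c * x i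
  eq = trans (lem a B c (pt v i) (w · y) (y i)) (cong₂ (λ s t → B * s - c * t)
    (sym (trans (·-linʳ w a (pt v) y e) (cong (λ t → a * t + w · y) (l (here refl))))) (sym (e i)))

-- 0 is listed twice; the repetitions are removed later by `classical-selection`.
ints : ℕ → List ℤ
ints B = map +_ (upTo (suc B)) ++ map (λ k → ℤ.- (+ k)) (upTo (suc B))

∈-ints : ∀ {B} z → z ℤ.≤ + B → ℤ.- z ℤ.≤ + B → z ∈ ints B
∈-ints (+ k) (ℤ.+≤+ k≤B) _ = ∈-++⁺ˡ (∈-map⁺ +_ (∈-upTo⁺ (ℕ.s≤s k≤B)))
∈-ints {B} -[1+ k ] _ (ℤ.+≤+ k≤B) = ∈-++⁺ʳ (map +_ (upTo (suc B)))
    (∈-map⁺ (λ k → ℤ.- (+ k)) (∈-upTo⁺ (ℕ.s≤s k≤B)))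

-- Filtering by Q would require deciding it. Under a double negation, excluded middle may be used
-- once for each of the finitely many elements: `skip` treats elements that need not be added, `add`
-- the others.
classical-selection : ∀ {A : Set} → (∀ (x y : A) → Dec (x ≡ y)) → (Q : A → Set) → ∀ xs →
  ¬ ¬ (∃[ S ] Unique S × (∀ p → (p ∈ S → Q p) × (p ∈ xs → Q p → p ∈ S)))
classical-selection _≟_ Q [] k = k ([] , [] , λ p → (λ ()) , λ ())
classical-selection {A} _≟_ Q (x ∷ xs) k = classical-selection _≟_ Q xs λ (S , uniq , sel) →
  let skip : (Q x → x ∈ S) → ⊥
      skip in-S = k (S , uniq , λ p → proj₁ (sel p) ,
          λ { (here refl) q → in-S q ; (there m) q → proj₂ (sel p) m q })
      add : ¬ (x ∈ S) → Q x → ⊥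
      add x∉S q = k (x ∷ S , All.tabulate (λ { m refl → x∉S m }) ∷ uniq ,
        λ p → (λ { (here refl) → q ; (there m) → proj₁ (sel p) m }) ,
            λ { (here refl) _ → here refl ; (there m) r → there (proj₂ (sel p) m r) })
  in cases (∈-dec _≟_ x S) skip add
  where
  cases : ∀ {S : List A} → Dec (x ∈ S) → ((Q x → x ∈ S) → ⊥) → (¬ (x ∈ S) → Q x → ⊥) → ⊥
  cases (yes x∈S) skip add = skip λ _ → x∈S
  cases (no x∉S) skip add = skip λ q → ⊥-elim (add x∉S q)

module _ {d n : ℕ} (A : Mat d n) (w : V d) (level : Level1 w (toList A)) where

  ordering-exists : ¬ ¬ (∃[ S ] IsOrdering A S)
  ordering-exists = ¬¬-map
      (λ (S , uniq , sel) → S , uniq , λ p → proj₁ (sel p) , λ q → proj₂ (sel p) (in-box q) q)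
    (classical-selection _≟ₚ_ (InPAL A) (allVecs (ints B) d))
    where
    B : ℕ
    B = proj₁ (entries-bound (toList A))
    bounded : ∀ {v} → v ∈ toList A → ∀ i → ℤ.∣ lookup v i ∣ ℕ.≤ B
    bounded = proj₂ (entries-bound (toList A))
    ≤∣∣ : ∀ z → z ℤ.≤ + ℤ.∣ z ∣
    ≤∣∣ (+ k) = ℤ.≤-refl
    ≤∣∣ -[1+ k ] = ℤ.-≤+
    -≤∣∣ : ∀ z → ℤ.- z ℤ.≤ + ℤ.∣ z ∣
    -≤∣∣ z = subst (λ t → ℤ.- z ℤ.≤ + t) (ℤ.∣-i∣≡∣i∣ z) (≤∣∣ (ℤ.- z))
    lem : ∀ x → (- 1ℚ) * x ≡ - x
    lem = solve-∀ ℚ-ring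
    module _ {p : Pt d} (q : InPAL A p) (i : Fin d) where
      bound : ∀ c → (∀ {v} → v ∈ toList A → c * pt v i ≤ ℕtoℚ B) → c * pt p i ≤ ℕtoℚ B
      bound c h = subst (c * pt p i ≤_)
          (trans (cong (ℕtoℚ B *_) (InPA⇒level A w level (proj₁ q))) (*-identityʳ (ℕtoℚ B)))
        (cone-bound w level (InPA⇒cone A w level (proj₁ q)) i c (ℕtoℚ B) h)
      upper : lookup p i ℤ.≤ + B
      upper = toℚ-cancel-≤ (subst (_≤ ℕtoℚ B) (*-identityˡ (pt p i)) (bound 1ℚ λ {v} m →
        subst (_≤ ℕtoℚ B) (sym (*-identityˡ (pt v i)))
            (toℚ-mono-≤ (ℤ.≤-trans (≤∣∣ (lookup v i)) (ℤ.+≤+ (bounded m i))))))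
      lower : ℤ.- lookup p i ℤ.≤ + B
      lower = toℚ-cancel-≤ (subst (_≤ ℕtoℚ B) (trans (lem (pt p i)) (sym (toℚ-neg (lookup p i))))
          (bound (- 1ℚ) λ {v} m →
        subst (_≤ ℕtoℚ B) (trans (toℚ-neg (lookup v i)) (sym (lem (pt v i))))
          (toℚ-mono-≤ (ℤ.≤-trans (-≤∣∣ (lookup v i)) (ℤ.+≤+ (bounded m i))))))
    in-box : ∀ {p} → InPAL A p → p ∈ allVecs (ints B) d
    in-box {p} q = ∈-allVecs p λ i → ∈-ints (lookup p i) (upper q i) (lower q i)

  -- Integral shots and greedy decomposition

  module _ (compressed : Compressed A) {S : List (Pt d)} (ord : IsOrdering A S) where

    open TwoLevel A w level compressed S ord using (levelS; two-level)

    T : List (Pt d)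
    T = toList A

    T⊆S : ∀ {p} → p ∈ T → p ∈ S
    T⊆S {p} m = proj₂ (proj₂ ord p) (column⇒InPAL A w level m)

    S⊆coneT : ∀ {p} → p ∈ S → Comb pt NN T (pt p)
    S⊆coneT {p} m = InPA⇒cone A w level (proj₁ (proj₁ (proj₂ ord p) m))

    -- By `two-level` every generator has height 0 or the height of p, so k is the sum of the
    -- coefficients of the latter kind.
    integral-level : ∀ {p ℓ} → p ∈ T → Facet S p ℓ → ∀ {U x} → (∀ {v} → v ∈ U → v ∈ T) → Comb pt Int U x
        → ∃[ k ] Int k × ℓ · x ≡ k * ℓ · pt p
    integral-level {p} {ℓ} p∈ ℓ-facet s (nil e) = 0ℚ , P0 , trans (·-congʳ ℓ e)
        (trans (·-zeroʳ ℓ) (sym (*-zeroˡ (ℓ · pt p))))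
    integral-level {p} {ℓ} p∈ ℓ-facet {v ∷ U} {x} s (cons a y aℤ c e) =
      cases (two-level (T⊆S p∈) (T⊆S (s (here refl))) ℓ-facet) (integral-level p∈ ℓ-facet (s ∘ there) c)
      where
      lem₀ : ∀ a k p → a * 0ℚ + k * p ≡ k * p
      lem₀ = solve-∀ ℚ-ring
      lem₁ : ∀ a k p → a * p + k * p ≡ (a + k) * p
      lem₁ = solve-∀ ℚ-ring
      cases : ℓ · pt v ≡ 0ℚ ⊎ ℓ · pt v ≡ ℓ · pt p → ∃[ k ] Int k × ℓ · y ≡ k * ℓ · pt p
          → ∃[ k ] Int k × ℓ · x ≡ k * ℓ · pt p
      cases (inj₁ z) (k , kℤ , ek) = k , kℤ , trans (·-linʳ ℓ a (pt v) y e)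
          (trans (cong₂ (λ s t → a * s + t) z ek) (lem₀ a k (ℓ · pt p)))
      cases (inj₂ z) (k , kℤ , ek) = a + k , P+ aℤ kℤ , trans (·-linʳ ℓ a (pt v) y e)
          (trans (cong₂ (λ s t → a * s + t) z ek) (lem₁ a k (ℓ · pt p)))

    Shot : Pt d → V d → Set
    Shot p b = ∃[ ℓ ] ∃[ s ] Valid pt ℓ T × 0ℚ < ℓ · pt p × Nat s × Comb pt NN T (b ⊖ s ∙ pt p) × ℓ ·
        (b ⊖ s ∙ pt p) ≡ 0ℚ

    integral-shot : ∀ {p b} → p ∈ T → Comb pt Int T b → Comb pt NN T b → Shot p b
    integral-shot {p} {b} p∈ bℤ bN = shot (ray-shooting w levelS (T⊆S p∈) (comb-⊆ T⊆S bN))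
      where
      shot : (∃[ ℓ ] ∃[ s ] Facet S p ℓ × 0ℚ ≤ s × Comb pt NN S (b ⊖ s ∙ pt p) × ℓ · (b ⊖ s ∙ pt p) ≡ 0ℚ)
          → Shot p b
      shot (ℓ , s , ℓ-facet@(valid , 0<p , _) , 0≤s , c , z) =
        let k , kℤ , ek = integral-level p∈ ℓ-facet id bℤ
            s≡k : s ≡ k
            s≡k = cancel s k (trans (sym (ℓb s z)) ek)
        in ℓ , s , valid ∘ T⊆S , 0<p , Int∧NN⇒Nat (subst Int (sym s≡k) kℤ) 0≤s , comb-trans S⊆coneT c , z
        where
        ℓb : ∀ s → ℓ · (b ⊖ s ∙ pt p) ≡ 0ℚ → ℓ · b ≡ s * ℓ · pt p
        ℓb s z = trans (lem (ℓ · b) (s * ℓ · pt p)) (trans (cong (_+ s * ℓ · pt p)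
          (trans (cong (λ t → ℓ · b - t) (sym (·-∙ʳ ℓ s (pt p)))) (trans (sym (·-⊖ʳ ℓ b (s ∙ pt p))) z)))
              (+-identityˡ _))
          where
          lem : ∀ x y → x ≡ x - y + y
          lem = solve-∀ ℚ-ring
        cancel : ∀ s k → s * ℓ · pt p ≡ k * ℓ · pt p → s ≡ k
        cancel s k e = cases (*-zero-cases {s - k} {ℓ · pt p}
            (trans (lem s k (ℓ · pt p)) (trans (cong (_- k * ℓ · pt p) e) (+-inverseʳ (k * ℓ · pt p)))))
          where
          lem : ∀ s k p → (s - k) * p ≡ s * p - k * p
          lem = solve-∀ ℚ-ring
          lem′ : ∀ s k → s ≡ s - k + k
          lem′ = solve-∀ ℚ-ring
          cases : s - k ≡ 0ℚ ⊎ ℓ · pt p ≡ 0ℚ → s ≡ k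
          cases (inj₁ z) = trans (lem′ s k) (trans (cong (_+ k) z) (+-identityˡ k))
          cases (inj₂ z) = ⊥-elim (<-irrefl (sym z) 0<p)

    -- Each shot along a generator of the current face moves b to a smaller face.
    greedy : ∀ m F {b} κ → length F ℕ.≤ m → Valid pt κ T → Face κ F T → Comb pt Int T b → Comb pt NN F b
        → Comb pt Nat T b
    greedy m [] κ _ _ _ _ c = comb-≈ (≈-sym (comb-[] c)) (comb-0 T)
    greedy (suc m) (p ∷ F) {b} κ (ℕ.s≤s len) validκ (F⊆T , zeroF , allF) bℤ bF = step′
        (integral-shot (F⊆T (here refl)) bℤ (comb-⊆ F⊆T bF))
      where
      step′ : Shot p b → Comb pt Nat T b
      step′ (ℓ , s , valid , 0<p , sℕ , c , z) = comb-≈ (λ i → lem (s * pt p i) (b i))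
        (comb-+ (comb-∙ sℕ (comb-∈ (F⊆T (here refl)))) rest)
        where
        lem : ∀ p b → p + (b - p) ≡ b
        lem = solve-∀ ℚ-ring
        b′ : V d
        b′ = b ⊖ s ∙ pt p
        -- A sum of two valid functionals vanishes at a generator exactly when both do, so κ′ cuts
        -- out the intersection of the two faces; p is not on it.
        κ′ : V d
        κ′ = 1ℚ ∙ κ ⊕ 1ℚ ∙ ℓ
        κ′-· : ∀ x → κ′ · x ≡ κ · x + ℓ · x
        κ′-· x = trans (·-lin₂ˡ 1ℚ κ 1ℚ ℓ x) (cong₂ _+_ (*-identityˡ (κ · x)) (*-identityˡ (ℓ · x)))
        valid′ : Valid pt κ′ T
        valid′ {v} m = subst (0ℚ ≤_) (sym (κ′-· (pt v))) (0≤+ (validκ m) (valid m))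
        F⁻ : ∀ {v} → v ∈ zeros ℓ F → v ∈ F × ℓ · pt v ≡ 0ℚ
        F⁻ = ∈-filter⁻ (zero? ℓ)
        face′ : Face κ′ (zeros ℓ F) T
        face′ = (λ m → F⊆T (there (proj₁ (F⁻ m)))) ,
          (λ {v} m → trans (κ′-· (pt v))
              (trans (cong₂ _+_ (zeroF (there (proj₁ (F⁻ m)))) (proj₂ (F⁻ m))) (+-identityʳ 0ℚ))) ,
          λ {v} m e → in-face m (trans (sym (κ′-· (pt v))) e)
          where
          in-face : ∀ {v} → v ∈ T → κ · pt v + ℓ · pt v ≡ 0ℚ → v ∈ zeros ℓ F
          in-face {v} m e = cases (allF m (0≤+-zeroˡ (validκ m) (valid m) e))
            where
            ℓ≡0 : ℓ · pt v ≡ 0ℚ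
            ℓ≡0 = 0≤+-zeroʳ (validκ m) (valid m) e
            cases : v ∈ p ∷ F → v ∈ zeros ℓ F
            cases (here refl) = ⊥-elim (<-irrefl (sym ℓ≡0) 0<p)
            cases (there n) = ∈-filter⁺ (zero? ℓ) n ℓ≡0
        κb′ : κ · b′ ≡ 0ℚ
        κb′ = trans (·-⊖ʳ κ b (s ∙ pt p)) (trans (cong₂ _-_ (comb-vanish κ zeroF bF)
          (trans (·-∙ʳ κ s (pt p)) (trans (cong (s *_) (zeroF (here refl))) (*-zeroʳ s)))) (+-inverseʳ 0ℚ))
        -- The shot places b′ only in the cone over T. Both κ and ℓ vanish at b′, which confines it
        -- to the cone over the smaller face.
        rest : Comb pt Nat T b′
        rest = greedy m (zeros ℓ F) κ′ (ℕ.≤-trans (length-filter (zero? ℓ) F) len) valid′ face′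
          (comb-⊖ (-[1+ 0 ] , refl) bℤ (comb-∙ (Nat⇒Int sℕ) (comb-∈ (F⊆T (here refl)))))
          (face-comb id valid′ face′ (trans (κ′-· b′) (trans (cong₂ _+_ κb′ z) (+-identityʳ 0ℚ))) c)

    -- Validity of ℓ at b - xᵢ p, together with its vanishing at b - s p, gives xᵢ ≤ s. The
    -- remainder b - s p has a natural decomposition by `greedy`, and adding s to its i-th
    -- coordinate gives y.
    rounding-up : ∀ i {b} x → IPFeasibleRHS A b → LPFeasible A b x
        → ∃[ y ] IPFeasible A b y × lookup x i ≤ ℕtoℚ (lookup y i)
    rounding-up i {b} x (y₀ , y₀-feasible) x-feasible@(0≤x , x≡b) =
      shot (integral-shot p∈ (comb-weaken Nat⇒Int bℕ) (LPFeasible⇒comb A x x-feasible))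
      where
      p : Pt d
      p = lookup A i
      p∈ : p ∈ T
      p∈ = lookup∈toList A i
      bℕ : Comb pt Nat T (pt b)
      bℕ = IPFeasible⇒comb A y₀ y₀-feasible
      xᵢ : ℚ
      xᵢ = lookup x i
      without-i : Comb pt NN T (pt b ⊖ xᵢ ∙ pt p)
      without-i = comb-≈ (λ j → trans (mulℚ-update A x i (- xᵢ) j)
          (trans (cong (λ t → (- xᵢ) * pt p j + t) (toℚv-≈ x≡b j)) (lem xᵢ (pt p j) (pt b j))))
        (vec⇒comb A (x [ i ]%= (_+ (- xᵢ)))
            (update-coeffs {P = NN} x i (- xᵢ) 0≤x (≤-reflexive (sym (+-inverseʳ xᵢ)))))
        where
        lem : ∀ x p b → (- x) * p + b ≡ b - x * p
        lem = solve-∀ ℚ-ring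
      shot : Shot p (pt b) → ∃[ y ] IPFeasible A b y × xᵢ ≤ ℕtoℚ (lookup y i)
      shot (ℓ , s , valid , 0<p , sℕ , c , z) = assemble (comb⇒vec A
        (greedy (length (zeros ℓ T)) (zeros ℓ T) ℓ ℕ.≤-refl valid (zeros-face ℓ T)
          (comb-⊖ (-[1+ 0 ] , refl) (comb-weaken Nat⇒Int bℕ) (comb-∙ (Nat⇒Int sℕ) (comb-∈ p∈)))
          (face-comb id valid (zeros-face ℓ T) z c)))
        where
        ℓ-shift : ∀ t → ℓ · (pt b ⊖ t ∙ pt p) ≡ ℓ · pt b - t * ℓ · pt p
        ℓ-shift t = trans (·-⊖ʳ ℓ (pt b) (t ∙ pt p)) (cong (λ u → ℓ · pt b - u) (·-∙ʳ ℓ t (pt p)))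
        xᵢ≤s : xᵢ ≤ s
        xᵢ≤s = 0≤-⇒≤ (0≤*-cancelˡ 0<p
            (subst (0ℚ ≤_) (trans (ℓ-shift xᵢ) (trans (lem (ℓ · pt b) xᵢ s (ℓ · pt p))
          (trans (cong (λ t → t + ℓ · pt p * (s - xᵢ)) (trans (sym (ℓ-shift s)) z)) (+-identityˡ _))))
          (comb-nonneg ℓ id valid without-i)))
          where
          lem : ∀ b x s p → b - x * p ≡ b - s * p + p * (s - x)
          lem = solve-∀ ℚ-ring
        assemble : (∃[ ys ] (∀ j → Nat (lookup ys j)) × lookup (mulℚ A ys) ≈ pt b ⊖ s ∙ pt p)
            → ∃[ y ] IPFeasible A b y × xᵢ ≤ ℕtoℚ (lookup y i)
        assemble (ys , ysℕ , ys≈) = finish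
            (lift-coeffs ℕtoℚ ys′ (update-coeffs {P = Nat} ys i s ysℕ (P+ (ysℕ i) sℕ)))
          where
          ys′ : Vec ℚ n
          ys′ = ys [ i ]%= (_+ s)
          ys′≈ : lookup (mulℚ A ys′) ≈ pt b
          ys′≈ j = trans (mulℚ-update A ys i s j)
              (trans (cong (λ t → s * pt p j + t) (ys≈ j)) (lem (s * pt p j) (pt b j)))
            where
            lem : ∀ p b → p + (b - p) ≡ b
            lem = solve-∀ ℚ-ring
          s≤ : s ≤ lookup ys′ i
          s≤ = subst₂ _≤_ (+-identityˡ s) (sym (lookup∘updateAt i ys)) (+-monoˡ-≤ s (Nat⇒NN (ysℕ i)))
          finish : (∃[ y ] Vec.map ℕtoℚ y ≡ ys′) → ∃[ y ] IPFeasible A b y × xᵢ ≤ ℕtoℚ (lookup y i)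
          finish (y , e) = y , trans (cong (mulℚ A) e) (≈-toℚv ys′≈) ,
            ≤-trans xᵢ≤s (subst (s ≤_) (trans (cong (λ v → lookup v i) (sym e)) (lookup-map i ℕtoℚ y)) s≤)

  -- No LP optimum is computed: the IP optimum is itself LP-feasible, and it remains to show that no
  -- LP-feasible point exceeds it.
  compressed⇒LPeqIP : Compressed A → LPeqIPForAll A
  compressed⇒LPeqIP compressed i b feasible =
    let y* , y*-feasible , max = IP-maximum A w level i feasible
        v = ℕtoℚ (lookup y* i)
        ip≤ : ∀ y → IPFeasible A b y → ℕtoℚ (lookup y i) ≤ v
        ip≤ y e = toℚ-mono-≤ (ℤ.+≤+ (max y e))
    in v , ((Vec.map ℕtoℚ y* ,
        ((λ j → subst (0ℚ ≤_) (sym (lookup-map j ℕtoℚ y*))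
        (Nat⇒NN (lookup y* j , refl))) , y*-feasible) , lookup-map i ℕtoℚ y*) ,
            λ x x-feasible → bound v ip≤ x x-feasible (lookup x i ≤? v)) ,
           (y* , y*-feasible , refl) , ip≤
    where
    -- The bound is decidable, so the list of all lattice points is needed only up to double negation.
    bound : ∀ v → (∀ y → IPFeasible A b y → ℕtoℚ (lookup y i) ≤ v) → ∀ x → LPFeasible A b x → Dec
        (lookup x i ≤ v) → lookup x i ≤ v
    bound v ip≤ x x-feasible (yes p) = p
    bound v ip≤ x x-feasible (no ¬p) = ⊥-elim (ordering-exists λ (S , ord) →
      let y , y-feasible , x≤y = rounding-up compressed ord i x feasible x-feasible
      in ¬p (≤-trans x≤y (ip≤ y y-feasible)))

theorem4p3 : ∀ (d n : ℕ) (A : Mat d n) → Homogeneous A →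
    (LPeqIPForAll A ⇔ Compressed A)
theorem4p3 d n A hom = mk⇔ (LPeqIP⇒compressed A hom)
  (compressed⇒LPeqIP A (lookup (proj₁ hom)) (homogeneous⇒level hom))
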